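{- Let $\psi\colon\mathbb{G}\to\mathbb{C}$ be the linear function defined on a graph $G$ with vertex set $V$ by $$\psi(G)=2^{ -|V|}\sum_{V'\subseteq V}(-1)^{|V'|}\,3^{\eta(G_{V'})},$$ where $G_{V'}$ is the framed graph obtained from $G$ by assigning framing $1$ to the vertices in $V'$ and framing $0$ to the vertices in $V\setminus V'$. Then $\psi$ is a 4-invariant extending $w_{\mathfrak{sl}(2)}$ at $c=1$; that is, $\psi$ is a 4-invariant and $\psi(\Gamma_D)=w_{\mathfrak{sl}(2)}(D)|_{c=1}$ for every chord diagram $D$.
   Context: Chord diagrams. A chord diagram of order $n\ge 0$ is a set of $2n$ pairwise distinct points on an oriented circle together with a complete pairing of these points (the pairs are called chords), considered up to orientation-preserving diffeomorphism of the circle. $\mathbb{A}$ is the complex vector space freely spanned by all chord diagrams. Two chords intersect if their endpoints interlace on the circle. The intersection graph $\Gamma_D$ of a chord diagram $D$ has the chords of $D$ as vertices, two vertices being adjacent iff the chords intersect. The $\mathfrak{sl}(2)$-weight system $w_{\mathfrak{sl}(2)}\colon\mathbb{A}\to\mathbb{C}[c]$ is the weight system associated with the Lie algebra $\mathfrak{sl}(2)$ with its Killing form, $c$ being the Casimir element. It is well defined and uniquely determined (Chmutov–Varchenko) by: its value on the diagram with no chords is $1$, and for every chord diagram $D$ and every chord $a$ of $D$ intersecting exactly $k$ other chords $a_1,\dots,a_k$, $$w_{\mathfrak{sl}(2)}(D)=\Bigl(c-\frac k2\Bigr)w_{\mathfrak{sl}(2)}(D_a)+\frac12\sum_{1\le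 i<j\le k}\bigl(w_{\mathfrak{sl}(2)}(D''_{i,j})-w_{\mathfrak{sl}(2)}(D^{\times}_{i,j})\bigr).$$ Here $D_a$ is $D$ with $a$ deleted. The endpoints of $a$ split the circle into two open arcs, and each $a_i$ has one endpoint $p_i$ on the first arc and one endpoint $p_i^*$ on the second; $D''_{i,j}$ (resp. $D^\times_{i,j}$) is obtained from $D$ by deleting $a$ and replacing $a_i,a_j$ by the chords $\{p_i,p_j\},\{p_i^*,p_j^*\}$ (resp. $\{p_i,p_j^*\},\{p_i^*,p_j\}$). Graphs. All graphs are finite and simple, considered up to isomorphism; $\mathbb{G}$ is the complex vector space freely spanned by isomorphism classes of graphs. A framed graph is a graph together with a function (framing) from its vertex set to $\mathbb{Z}/2\mathbb{Z}$. The adjacency matrix over $\mathbb{Z}/2\mathbb{Z}$ of a framed graph has the usual off-diagonal adjacency entries, and its diagonal entries are the framings of the corresponding vertices. $\eta$ denotes the corank (dimension of the kernel) of this matrix over $\mathbb{Z}/2\mathbb{Z}$; it is $0$ for the empty graph. A linear map $g\colon\mathbb{G}\to M$ to a complex vector space is a 4-invariant if for every graph $G$ and every ordered pair $(a,b)$ of adjacent vertices of $G$, $$g(G)-g(G'_{ab})=g(\widetilde G_{ab})-g(\widetilde G'_{ab}),$$ where $G'_{ab}$ is $G$ with the edge $ab$ removed; $\widetilde G_{ab}$ is obtained from $G$ by switching the adjacency of $a$ with every vertex $v\ne a,b$ that is adjacent to $b$, everything else (including the edge $ab$) being kept; and $\widetilde G'_{ab}$ is $\widetilde G_{ab}$ with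 the edge $ab$ removed. -}

module Defs where

open import Algebra.Bundles using (CommutativeRing)
open import Algebra.Module.Bundles using (Module)
open import Algebra.Module.Structures.Biased using (IsModuleFromLeft)
open import Algebra.Module.Morphism.Structures using (IsModuleHomomorphism)
import Algebra.Module.Construct.TensorUnit as TensorUnit
import Algebra.Properties.CommutativeMonoid.Sum as Sum
import Algebra.Properties.Semiring.Exp as Exp
import Algebra.Properties.Semiring.Mult as Mult
open import Data.Bool using (Bool; true; false; not; _∧_; _∨_; _xor_; if_then_else_)
import Data.Bool.Properties as Bool
open import Data.Empty using (⊥-elim)
open import Data.Fin using (Fin; zero; suc; punchIn; _<?_)
import Data.Fin.Properties as Fin
open import Data.Fin.Permutation using (Permutation; _⟨$⟩ʳ_; inverseʳ; flip; _∘ₚ_)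
  renaming (id to idₚ)
open import Data.Fin.Subset using (Subset; inside; outside; ∣_∣)
open import Data.Fin.Subset.Properties using (anySubset?)
open import Data.List using (List; length; filter; allFin) renaming (lookup to lookupᴸ)
open import Data.Nat using (ℕ; zero; suc; _+_; _<_)
import Data.Nat.Properties as ℕ
open import Data.Product using (Σ; ∃; _×_; _,_; proj₁; proj₂; map₁)
open import Data.Product.Properties using (≡-dec)
open import Data.Sum using (_⊎_; inj₁; inj₂)
open import Data.Vec using ([]; _∷_; lookup; tabulate)
open import Data.Vec.Properties using (lookup∘tabulate)
open import Data.Vec.Functional using (Vector; tail) renaming (_∷_ to _∷ᶠ_)
open import Function using (_∘_; _↔_; _⇔_; Inverse; mk⇔)
open import Function.Construct.Composition using (_↔-∘_; _⇔-∘_)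
open import Function.Construct.Identity using (↔-id; ⇔-id)
open import Function.Construct.Symmetry using (↔-sym; ⇔-sym)
open import Function.Definitions using (Injective)
open import Level using (_⊔_; 0ℓ)
open import Relation.Binary.Bundles using (Setoid)
open import Relation.Binary.Definitions using (DecidableEquality)
open import Relation.Binary.PropositionalEquality
  using (_≡_; refl; sym; trans; cong; cong₂; subst; setoid; module ≡-Reasoning)
open import Relation.Nullary using (¬_; Dec; yes; no; does)
open import Relation.Nullary.Decidable using (_×-dec_; _⊎-dec_; dec-false; does-⇔)

------------------------------------------------------------------------

-- The circle is ℕ with the cyclic order obtained by closing up its linear
-- order.  Only finitely many points are ever used, and every finite
-- cyclically ordered set embeds in ℕ.  Cyc x y z: starting at x and going
-- round in the positive direction one meets y strictly before z.

Cyc : ℕ → ℕ → ℕ → Set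
Cyc x y z = (x < y × y < z) ⊎ (y < z × z < x) ⊎ (z < x × x < y)

cyc? : ∀ x y z → Dec (Cyc x y z)
cyc? x y z = ((x ℕ.<? y) ×-dec (y ℕ.<? z)) ⊎-dec
             (((y ℕ.<? z) ×-dec (z ℕ.<? x)) ⊎-dec ((z ℕ.<? x) ×-dec (x ℕ.<? y)))

-- The chords are indexed by Fin n; (i , false) and (i , true) are the two
-- endpoints of the i-th chord.  The indexing, and which endpoint comes
-- first, are forgotten by _≅ᴰ_ below.

Endpoint : ℕ → Set
Endpoint n = Fin n × Bool

partner : ∀ {n} → Endpoint n → Endpoint n
partner (i , s) = i , not s

_≟ᴱ_ : ∀ {n} → DecidableEquality (Endpoint n)
_≟ᴱ_ = ≡-dec Fin._≟_ Bool._≟_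

record ChordDiagram (n : ℕ) : Set where
  field
    position           : Endpoint n → ℕ
    position-injective : Injective _≡_ _≡_ position

open ChordDiagram public

-- An orientation-preserving diffeomorphism of the circle carrying one chord
-- diagram to another exists iff some bijection of the endpoints respects
-- the pairing and the cyclic order.

record _≅ᴰ_ {m n} (D : ChordDiagram m) (E : ChordDiagram n) : Set where
  field
    bijection : Endpoint m ↔ Endpoint n
  open Inverse bijection using (to)
  field
    pairing : ∀ x → to (partner x) ≡ partner (to x)
    cyclic  : ∀ x y z → Cyc (position D x) (position D y) (position D z) ⇔
                        Cyc (position E (to x)) (position E (to y)) (position E (to z))

≅ᴰ-refl : ∀ {n} {D : ChordDiagram n} → D ≅ᴰ D
≅ᴰ-refl = record { bijection = ↔-id _ ; pairing = λ _ → refl ; cyclic = λ _ _ _ → ⇔-id _ }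

≅ᴰ-sym : ∀ {m n} {D : ChordDiagram m} {E : ChordDiagram n} → D ≅ᴰ E → E ≅ᴰ D
≅ᴰ-sym {D = D} {E} f = record
  { bijection = ↔-sym bijection
  ; pairing   = λ x → trans (cong (from ∘ partner) (sym (toFrom x)))
                     (trans (cong from (sym (pairing (from x)))) (fromTo _))
  ; cyclic    = λ x y z → ⇔-sym (subst
      (λ (x′ , y′ , z′) → Cyc (position D (from x)) (position D (from y)) (position D (from z)) ⇔
                          Cyc (position E x′) (position E y′) (position E z′))
      (cong₂ _,_ (toFrom x) (cong₂ _,_ (toFrom y) (toFrom z)))
      (cyclic (from x) (from y) (from z)))
  }
  where
  open _≅ᴰ_ f
  open Inverse bijection using (from; strictlyInverseˡ; strictlyInverseʳ)
  toFrom = strictlyInverseˡ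
  fromTo = strictlyInverseʳ

≅ᴰ-trans : ∀ {l m n} {D : ChordDiagram l} {E : ChordDiagram m} {F : ChordDiagram n} →
           D ≅ᴰ E → E ≅ᴰ F → D ≅ᴰ F
≅ᴰ-trans f g = record
  { bijection = G.bijection ↔-∘ F.bijection
  ; pairing   = λ x → trans (cong (Inverse.to G.bijection) (F.pairing x)) (G.pairing _)
  ; cyclic    = λ x y z → G.cyclic _ _ _ ⇔-∘ F.cyclic x y z
  }
  where
  module F = _≅ᴰ_ f
  module G = _≅ᴰ_ g

chordDiagrams : Setoid 0ℓ 0ℓ
chordDiagrams = record
  { Carrier       = Σ ℕ ChordDiagram
  ; _≈_           = λ D E → proj₂ D ≅ᴰ proj₂ E
  ; isEquivalence = record { refl = ≅ᴰ-refl ; sym = ≅ᴰ-sym ; trans = ≅ᴰ-trans }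
  }

-- The endpoints interlace: the cyclic order is a₀ b₀ a₁ b₁ or a₀ b₁ a₁ b₀.

Interlace : (a₀ a₁ b₀ b₁ : ℕ) → Set
Interlace a₀ a₁ b₀ b₁ = (Cyc a₀ b₀ a₁ × Cyc a₁ b₁ a₀) ⊎ (Cyc a₀ b₁ a₁ × Cyc a₁ b₀ a₀)

Intersect : ∀ {n} → ChordDiagram n → Fin n → Fin n → Set
Intersect D a b = Interlace (position D (a , false)) (position D (a , true))
                            (position D (b , false)) (position D (b , true))

intersect? : ∀ {n} (D : ChordDiagram n) a b → Dec (Intersect D a b)
intersect? D a b = (cyc? _ _ _ ×-dec cyc? _ _ _) ⊎-dec (cyc? _ _ _ ×-dec cyc? _ _ _)

cyc-rotate : ∀ {x y z} → Cyc x y z → Cyc y z x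
cyc-rotate (inj₁ (p , q))        = inj₂ (inj₂ (p , q))
cyc-rotate (inj₂ (inj₁ (p , q))) = inj₁ (p , q)
cyc-rotate (inj₂ (inj₂ (p , q))) = inj₂ (inj₁ (p , q))

cyc-rotate² : ∀ {x y z} → Cyc x y z → Cyc z x y
cyc-rotate² = cyc-rotate ∘ cyc-rotate

cyc-irrefl : ∀ {x y} → ¬ Cyc x x y
cyc-irrefl (inj₁ (p , _))        = ℕ.<-irrefl refl p
cyc-irrefl (inj₂ (inj₁ (p , q))) = ℕ.<-asym p q
cyc-irrefl (inj₂ (inj₂ (_ , q))) = ℕ.<-irrefl refl q

cyc-trans : ∀ {x y z w} → Cyc x y z → Cyc x z w → Cyc x y w
cyc-trans (inj₁ (p , q)) (inj₁ (r , s))               = inj₁ (p , ℕ.<-trans q s)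
cyc-trans (inj₁ (p , q)) (inj₂ (inj₁ (r , s)))        = ⊥-elim (ℕ.<-asym (ℕ.<-trans r s) (ℕ.<-trans p q))
cyc-trans (inj₁ (p , q)) (inj₂ (inj₂ (r , s)))        = inj₂ (inj₂ (r , p))
cyc-trans (inj₂ (inj₁ (p , q))) (inj₁ (r , s))        = ⊥-elim (ℕ.<-asym q r)
cyc-trans (inj₂ (inj₁ (p , q))) (inj₂ (inj₁ (r , s))) = inj₂ (inj₁ (ℕ.<-trans p r , s))
cyc-trans (inj₂ (inj₁ (p , q))) (inj₂ (inj₂ (r , s))) = ⊥-elim (ℕ.<-asym q s)
cyc-trans (inj₂ (inj₂ (p , q))) (inj₁ (r , s))        = ⊥-elim (ℕ.<-asym p r)
cyc-trans (inj₂ (inj₂ (p , q))) (inj₂ (inj₁ (r , s))) = inj₂ (inj₂ (s , q))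
cyc-trans (inj₂ (inj₂ (p , q))) (inj₂ (inj₂ (r , s))) = inj₂ (inj₂ (r , q))

interlace-sym : ∀ {a₀ a₁ b₀ b₁} → Interlace a₀ a₁ b₀ b₁ → Interlace b₀ b₁ a₀ a₁
interlace-sym (inj₁ (p , q)) =
  inj₂ (cyc-rotate² (cyc-trans q (cyc-rotate² p)) , cyc-rotate² (cyc-trans p (cyc-rotate² q)))
interlace-sym (inj₂ (p , q)) =
  inj₁ (cyc-rotate² (cyc-trans p (cyc-rotate² q)) , cyc-rotate² (cyc-trans q (cyc-rotate² p)))

interlace-irrefl : ∀ {a₀ a₁} → ¬ Interlace a₀ a₁ a₀ a₁
interlace-irrefl (inj₁ (p , _)) = cyc-irrefl p
interlace-irrefl (inj₂ (_ , q)) = cyc-irrefl (cyc-rotate q)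

deleteChord : ∀ {n} → ChordDiagram (suc n) → Fin (suc n) → ChordDiagram n
deleteChord D a = record
  { position           = position D ∘ map₁ (punchIn a)
  ; position-injective = λ eq → let e = position-injective D eq in
      cong₂ _,_ (Fin.punchIn-injective a _ _ (cong proj₁ e)) (cong proj₂ e)
  }

transposeᴱ : ∀ {n} → Endpoint n → Endpoint n → Endpoint n → Endpoint n
transposeᴱ x y z with z ≟ᴱ x | z ≟ᴱ y
... | yes _ | _     = y
... | no _  | yes _ = x
... | no _  | no _  = z

transposeᴱ-injective : ∀ {n} (x y : Endpoint n) → Injective _≡_ _≡_ (transposeᴱ x y)
transposeᴱ-injective x y {u} {v} eq with u ≟ᴱ x | u ≟ᴱ y | v ≟ᴱ x | v ≟ᴱ y
... | yes p | _     | yes q | _     = trans p (sym q)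
... | yes p | _     | no ¬q | yes q = trans p (trans (sym eq) (sym q))
... | yes p | _     | no _  | no ¬q = ⊥-elim (¬q (sym eq))
... | no ¬p | yes p | yes q | _     = trans p (trans (sym eq) (sym q))
... | no _  | yes p | no _  | yes q = trans p (sym q)
... | no _  | yes _ | no ¬q | no _  = ⊥-elim (¬q (sym eq))
... | no _  | no ¬p | yes _ | _     = ⊥-elim (¬p eq)
... | no ¬p | no _  | no _  | yes _ = ⊥-elim (¬p eq)
... | no _  | no _  | no _  | no _  = eq

exchange : ∀ {n} → Endpoint n → Endpoint n → ChordDiagram n → ChordDiagram n
exchange x y D = record
  { position           = position D ∘ transposeᴱ x y
  ; position-injective = transposeᴱ-injective x y ∘ position-injective D
  }

-- For b intersecting a: near is the endpoint of b on the open arc from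
-- (a , false) to (a , true), far the one on the complementary arc.

near far : ∀ {n} → ChordDiagram n → Fin n → Fin n → Endpoint n
near D a b = if does (cyc? (position D (a , false)) (position D (b , false)) (position D (a , true)))
             then (b , false) else (b , true)
far D a b = partner (near D a b)

-- Exchanging the points far i and near j re-pairs the chords i and j into
-- {near i , near j} and {far i , far j}; exchanging far i and far j re-pairs
-- them into {near i , far j} and {far i , near j}.

parallel crossed : ∀ {n} → ChordDiagram (suc n) → (a i j : Fin (suc n)) → ChordDiagram n
parallel D a i j = deleteChord (exchange (far D a i) (near D a j) D) a
crossed  D a i j = deleteChord (exchange (far D a i) (far  D a j) D) a

intersecting : ∀ {n} → ChordDiagram n → Fin n → List (Fin n)
intersecting D a = filter (intersect? D a) (allFin _)

------------------------------------------------------------------------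

record Graph : Set where
  field
    order      : ℕ
    adj        : Fin order → Fin order → Bool
    adj-sym    : ∀ i j → adj i j ≡ adj j i
    adj-irrefl : ∀ i → adj i i ≡ false

open Graph public

Vertex : Graph → Set
Vertex G = Fin (order G)

record _≅ᴳ_ (G H : Graph) : Set where
  field
    bijection : Permutation (order G) (order H)
    adjacency : ∀ i j → adj G i j ≡ adj H (bijection ⟨$⟩ʳ i) (bijection ⟨$⟩ʳ j)

≅ᴳ-refl : ∀ {G} → G ≅ᴳ G
≅ᴳ-refl = record { bijection = idₚ ; adjacency = λ _ _ → refl }

≅ᴳ-sym : ∀ {G H} → G ≅ᴳ H → H ≅ᴳ G
≅ᴳ-sym {G} {H} f = record
  { bijection = flip bijection
  ; adjacency = λ i j → sym (trans (adjacency _ _)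
      (cong₂ (adj H) (inverseʳ bijection) (inverseʳ bijection)))
  }
  where
  open _≅ᴳ_ f

≅ᴳ-trans : ∀ {G H I} → G ≅ᴳ H → H ≅ᴳ I → G ≅ᴳ I
≅ᴳ-trans f g = record
  { bijection = F.bijection ∘ₚ G.bijection
  ; adjacency = λ i j → trans (F.adjacency i j) (G.adjacency _ _)
  }
  where
  module F = _≅ᴳ_ f
  module G = _≅ᴳ_ g

graphs : Setoid 0ℓ 0ℓ
graphs = record
  { Carrier       = Graph
  ; _≈_           = _≅ᴳ_
  ; isEquivalence = record { refl = ≅ᴳ-refl ; sym = ≅ᴳ-sym ; trans = ≅ᴳ-trans }
  }

intersectionGraph : ∀ {n} → ChordDiagram n → Graph
intersectionGraph {n} D = record
  { order      = n
  ; adj        = λ a b → does (intersect? D a b)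
  ; adj-sym    = λ a b → does-⇔ (mk⇔ interlace-sym interlace-sym) (intersect? D a b) (intersect? D b a)
  ; adj-irrefl = λ a → dec-false (intersect? D a a) interlace-irrefl
  }

_==_ : ∀ {n} → Fin n → Fin n → Bool
i == j = does (i Fin.≟ j)

removeEdge : (G : Graph) → Vertex G → Vertex G → Graph
removeEdge G a b = record
  { order      = order G
  ; adj        = λ i j → adj G i j ∧ not (((i == a) ∧ (j == b)) ∨ ((i == b) ∧ (j == a)))
  ; adj-sym    = λ i j → cong₂ _∧_ (adj-sym G i j) (cong not
      (trans (Bool.∨-comm ((i == a) ∧ (j == b)) _)
             (cong₂ _∨_ (Bool.∧-comm (i == b) _) (Bool.∧-comm (i == a) _))))
  ; adj-irrefl = λ i → cong (_∧ _) (adj-irrefl G i)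
  }

-- toggled G a b i j: i is a, and j is a vertex other than a and b that is
-- adjacent to b.

toggled : (G : Graph) (a b i j : Vertex G) → Bool
toggled G a b i j = (i == a) ∧ not (j == a) ∧ not (j == b) ∧ adj G j b

switch : (G : Graph) → Vertex G → Vertex G → Graph
switch G a b = record
  { order      = order G
  ; adj        = λ i j → adj G i j xor (toggled G a b i j ∨ toggled G a b j i)
  ; adj-sym    = λ i j → cong₂ _xor_ (adj-sym G i j) (Bool.∨-comm (toggled G a b i j) _)
  ; adj-irrefl = λ i → cong₂ _xor_ (adj-irrefl G i)
                         (trans (Bool.∨-idem (toggled G a b i i)) (toggled-irrefl i))
  }
  where
  toggled-irrefl : ∀ i → toggled G a b i i ≡ false
  toggled-irrefl i with i == a
  ... | true  = refl
  ... | false = refl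

record FramedGraph : Set where
  field
    graph   : Graph
    framing : Vertex graph → Bool

open FramedGraph public

_framedOn_ : (G : Graph) → Subset (order G) → FramedGraph
G framedOn V′ = record { graph = G ; framing = lookup V′ }

------------------------------------------------------------------------
-- ℤ/2ℤ is the field Bool with _xor_ and _∧_.

module 𝔽₂ = CommutativeRing Bool.xor-∧-commutativeRing
module Sum₂ = Sum 𝔽₂.+-commutativeMonoid

Matrix₂ : ℕ → Set
Matrix₂ n = Fin n → Fin n → Bool

adjacencyMatrix : (F : FramedGraph) → Matrix₂ (order (graph F))
adjacencyMatrix F i j = if i == j then framing F i else adj (graph F) i j

InKernel : ∀ {n} → Matrix₂ n → Vector Bool n → Set
InKernel {n} A v = ∀ i → Sum₂.sum (λ j → A i j ∧ v j) ≡ false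

combination : ∀ {d n} → Vector Bool d → (Fin d → Vector Bool n) → Vector Bool n
combination c b i = Sum₂.sum (λ k → c k ∧ b k i)

record Basis {n} (U : Vector Bool n → Set) (d : ℕ) : Set where
  field
    vectors     : Fin d → Vector Bool n
    members     : ∀ k → U (vectors k)
    independent : ∀ c → (∀ i → combination c vectors i ≡ false) → ∀ k → c k ≡ false
    spanning    : ∀ v → U v → ∃ λ c → ∀ i → v i ≡ combination c vectors i

record DecSubspace {n} (U : Vector Bool n → Set) : Set where
  field
    resp   : ∀ {v w} → (∀ i → v i ≡ w i) → U v → U w
    closed : ∀ {v w} → U v → U w → U (λ i → v i xor w i)
    dec    : ∀ v → Dec (U v)

xor-cancel : ∀ x y → x ≡ y xor (x xor y)
xor-cancel false false = refl
xor-cancel false true  = refl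
xor-cancel true  false = refl
xor-cancel true  true  = refl

combination-head : ∀ {d n} (c : Vector Bool d) (b : Fin d → Vector Bool n) →
                   combination c (λ k → false ∷ᶠ b k) zero ≡ false
combination-head {d} c b = trans (Sum₂.sum-cong-≗ (λ k → Bool.∧-zeroʳ (c k))) (Sum₂.sum-replicate-zero d)

basis : ∀ {n} {U : Vector Bool n → Set} → DecSubspace U → ∃ (Basis U)
basis {zero} S = 0 , record
  { vectors = λ () ; members = λ () ; independent = λ _ _ () ; spanning = λ _ _ → (λ ()) , λ () }
basis {suc n} {U} S = extend (anySubset? (λ s → dec (true ∷ᶠ lookup s)))
  where
  open DecSubspace S

  cons-eta : ∀ {x} (v : Vector Bool (suc n)) → v zero ≡ x → ∀ i → v i ≡ (x ∷ᶠ tail v) i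
  cons-eta v eq zero    = eq
  cons-eta v eq (suc i) = refl

  cons-cong : ∀ {x} {v w : Vector Bool n} → (∀ i → v i ≡ w i) → ∀ i → (x ∷ᶠ v) i ≡ (x ∷ᶠ w) i
  cons-cong eq zero    = refl
  cons-cong eq (suc i) = eq i

  rec : ∃ (Basis (λ v → U (false ∷ᶠ v)))
  rec = basis record
    { resp   = λ eq → resp (cons-cong eq)
    ; closed = λ u w → resp (cons-eta _ refl) (closed u w)
    ; dec    = λ v → dec _
    }

  d = proj₁ rec
  open Basis (proj₂ rec)

  extend : Dec (∃ λ s → U (true ∷ᶠ lookup s)) → ∃ (Basis U)
  extend (no ∄) = d , record
    { vectors     = λ k → false ∷ᶠ vectors k
    ; members     = members
    ; independent = λ c eq → independent c (eq ∘ suc)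
    ; spanning    = spans
    }
    where
    spans : ∀ v → U v → ∃ λ c → ∀ i → v i ≡ combination c (λ k → false ∷ᶠ vectors k) i
    spans v u with v zero in eq
    ... | true  = ⊥-elim (∄ (tabulate (tail v) , resp
                    (λ { zero → eq ; (suc i) → sym (lookup∘tabulate (tail v) i) }) u))
    ... | false with spanning (tail v) (resp (cons-eta v eq) u)
    ...   | c , sp = c , λ { zero    → trans eq (sym (combination-head c vectors))
                           ; (suc i) → sp i }
  extend (yes (s , u₀)) = suc d , record
    { vectors     = b
    ; members     = λ { zero → u₀ ; (suc k) → members k }
    ; independent = indep
    ; spanning    = spans
    }
    where
    b : Fin (suc d) → Vector Bool (suc n)
    b = (true ∷ᶠ lookup s) ∷ᶠ (λ k → false ∷ᶠ vectors k)

    indep : ∀ c → (∀ i → combination c b i ≡ false) → ∀ k → c k ≡ false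
    indep c eq = λ { zero → c₀ ; (suc k) → independent (tail c) rest k }
      where
      c₀ : c zero ≡ false
      c₀ = begin
        c zero                                        ≡⟨ Bool.∧-identityʳ (c zero) ⟨
        c zero ∧ true                                 ≡⟨ Bool.xor-identityʳ _ ⟨
        (c zero ∧ true) xor false                     ≡⟨ cong ((c zero ∧ true) xor_) (combination-head (tail c) vectors) ⟨
        combination c b zero                          ≡⟨ eq zero ⟩
        false                                         ∎
        where open ≡-Reasoning
      rest : ∀ i → combination (tail c) vectors i ≡ false
      rest i = trans (cong (λ x → (x ∧ lookup s i) xor combination (tail c) vectors i) (sym c₀)) (eq (suc i))

    spans : ∀ v → U v → ∃ λ c → ∀ i → v i ≡ combination c b i
    spans v u with v zero in eq
    ... | false with spanning (tail v) (resp (cons-eta v eq) u)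
    ...   | c , sp = false ∷ᶠ c , λ { zero    → trans eq (sym (combination-head c vectors))
                                    ; (suc i) → sp i }
    spans v u | true with spanning (λ i → v (suc i) xor lookup s i)
                            (resp (λ { zero → trans (cong (_xor true) eq) refl ; (suc i) → refl }) (closed u u₀))
    ...   | c , sp = true ∷ᶠ c , λ { zero    → trans eq (cong (true xor_) (sym (combination-head c vectors)))
                                   ; (suc i) → trans (xor-cancel (v (suc i)) (lookup s i)) (cong (lookup s i xor_) (sp i)) }

kernel-decSubspace : ∀ {n} (A : Matrix₂ n) → DecSubspace (InKernel A)
kernel-decSubspace A = record
  { resp   = λ eq u i → trans (Sum₂.sum-cong-≗ (λ j → cong (A i j ∧_) (sym (eq j)))) (u i)
  ; closed = λ {v} {w} u t i → trans
      (Sum₂.sum-cong-≗ (λ j → 𝔽₂.distribˡ (A i j) (v j) (w j)))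
      (trans (Sum₂.∑-distrib-+ (λ j → A i j ∧ v j) (λ j → A i j ∧ w j)) (cong₂ _xor_ (u i) (t i)))
  ; dec    = λ v → Fin.all? (λ i → Sum₂.sum (λ j → A i j ∧ v j) Bool.≟ false)
  }

kernelBasis : ∀ {n} (A : Matrix₂ n) → ∃ (Basis (InKernel A))
kernelBasis A = basis (kernel-decSubspace A)

-- The dimension of the kernel, as the length of a basis.

η : FramedGraph → ℕ
η F = proj₁ (kernelBasis (adjacencyMatrix F))

------------------------------------------------------------------------
-- The K-module freely spanned by the elements of S up to its equality:
-- formal linear combinations modulo the module axioms.

module FreeModule {k ℓ s ℓs} (K : CommutativeRing k ℓ) (S : Setoid s ℓs) where
  open CommutativeRing K
    using (1#; 0#)
    renaming (Carrier to ∣K∣; _≈_ to _≈ᴷ_; _+_ to _+ᴷ_; _*_ to _*ᴷ_; -_ to -ᴷ_)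
  private module K = CommutativeRing K
  open Setoid S using () renaming (Carrier to X; _≈_ to _∼_)

  infixr 7 _·_
  infixl 6 _⊕_
  infix  4 _≋_

  data Free : Set (k ⊔ s) where
    ⟦_⟧ : X → Free
    𝟎   : Free
    _⊕_ : Free → Free → Free
    _·_ : ∣K∣ → Free → Free

  data _≋_ : Free → Free → Set (k ⊔ ℓ ⊔ s ⊔ ℓs) where
    ≋-refl    : ∀ {u} → u ≋ u
    ≋-sym     : ∀ {u v} → u ≋ v → v ≋ u
    ≋-trans   : ∀ {u v w} → u ≋ v → v ≋ w → u ≋ w
    ⟦⟧-cong   : ∀ {x y} → x ∼ y → ⟦ x ⟧ ≋ ⟦ y ⟧
    ⊕-cong    : ∀ {u u′ v v′} → u ≋ u′ → v ≋ v′ → u ⊕ v ≋ u′ ⊕ v′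
    ·-cong    : ∀ {r r′ u u′} → r ≈ᴷ r′ → u ≋ u′ → r · u ≋ r′ · u′
    ⊕-assoc   : ∀ u v w → (u ⊕ v) ⊕ w ≋ u ⊕ (v ⊕ w)
    ⊕-comm    : ∀ u v → u ⊕ v ≋ v ⊕ u
    ⊕-idˡ     : ∀ u → 𝟎 ⊕ u ≋ u
    ·-distribˡ : ∀ r u v → r · (u ⊕ v) ≋ r · u ⊕ r · v
    ·-distribʳ : ∀ u r r′ → (r +ᴷ r′) · u ≋ r · u ⊕ r′ · u
    ·-assoc   : ∀ r r′ u → (r *ᴷ r′) · u ≋ r · (r′ · u)
    ·-idˡ     : ∀ u → 1# · u ≋ u
    ·-zeroˡ   : ∀ u → 0# · u ≋ 𝟎

  private
    ⊕-idʳ : ∀ u → u ⊕ 𝟎 ≋ u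
    ⊕-idʳ u = ≋-trans (⊕-comm u 𝟎) (⊕-idˡ u)

    ·-zeroʳ : ∀ r → r · 𝟎 ≋ 𝟎
    ·-zeroʳ r = ≋-trans (·-cong K.refl (≋-sym (·-zeroˡ 𝟎)))
               (≋-trans (≋-sym (·-assoc r 0# 𝟎))
               (≋-trans (·-cong (K.zeroʳ r) ≋-refl) (·-zeroˡ 𝟎)))

    ⊖_ : Free → Free
    ⊖ u = (-ᴷ 1#) · u

    ⊖-inverseˡ : ∀ u → ⊖ u ⊕ u ≋ 𝟎
    ⊖-inverseˡ u = ≋-trans (⊕-cong ≋-refl (≋-sym (·-idˡ u)))
                  (≋-trans (≋-sym (·-distribʳ u (-ᴷ 1#) 1#))
                  (≋-trans (·-cong (K.-‿inverseˡ 1#) ≋-refl) (·-zeroˡ u)))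

  freeModule : Module K (k ⊔ s) (k ⊔ ℓ ⊔ s ⊔ ℓs)
  freeModule = record
    { Carrierᴹ = Free
    ; _≈ᴹ_ = _≋_
    ; _+ᴹ_ = _⊕_
    ; _*ₗ_ = _·_
    ; 0ᴹ   = 𝟎
    ; -ᴹ_  = ⊖_
    ; isModule = IsModuleFromLeft.isModule {commutativeRing = K} record
      { isLeftModule = record
        { isLeftSemimodule = record
          { +ᴹ-isCommutativeMonoid = record
            { isMonoid = record
              { isSemigroup = record
                { isMagma = record
                  { isEquivalence = record { refl = ≋-refl ; sym = ≋-sym ; trans = ≋-trans }
                  ; ∙-cong = ⊕-cong
                  }
                ; assoc = ⊕-assoc
                }
              ; identity = ⊕-idˡ , ⊕-idʳ
              }
            ; comm = ⊕-comm
            }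
          ; isPreleftSemimodule = record
            { *ₗ-cong      = ·-cong
            ; *ₗ-zeroˡ     = ·-zeroˡ
            ; *ₗ-distribʳ  = ·-distribʳ
            ; *ₗ-identityˡ = ·-idˡ
            ; *ₗ-assoc     = ·-assoc
            ; *ₗ-zeroʳ     = ·-zeroʳ
            ; *ₗ-distribˡ  = ·-distribˡ
            }
          }
        ; -ᴹ‿cong    = ·-cong K.refl
        ; -ᴹ‿inverse = ⊖-inverseˡ , λ u → ≋-trans (⊕-comm u (⊖ u)) (⊖-inverseˡ u)
        }
      }
    }

  -- Linear extension.  It respects _≋_ as soon as f respects _∼_, which is
  -- not assumed here.
  linearExtension : ∀ {m ℓm} (M : Module K m ℓm) → (X → Module.Carrierᴹ M) → Free → Module.Carrierᴹ M
  linearExtension M f = go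
    where
    open Module M
    go : Free → Carrierᴹ
    go ⟦ x ⟧   = f x
    go 𝟎       = 0ᴹ
    go (u ⊕ v) = go u +ᴹ go v
    go (r · u) = r *ₗ go u

IsLinear : ∀ {k ℓ m ℓm p ℓp} {K : CommutativeRing k ℓ} (M : Module K m ℓm) (P : Module K p ℓp) →
           (Module.Carrierᴹ M → Module.Carrierᴹ P) → Set _
IsLinear M P = IsModuleHomomorphism (Module.rawModule M) (Module.rawModule P)

------------------------------------------------------------------------
-- K plays the role of ℂ, which the library lacks: any commutative ring will
-- do, together with an element ½ intended to satisfy ½ + ½ ≈ 1.

module WeightSystems {k ℓ} (K : CommutativeRing k ℓ) (½ : CommutativeRing.Carrier K) where
  open CommutativeRing K
    using (semiring; 0#; 1#)
    renaming (Carrier to ∣K∣; _≈_ to _≈ᴷ_; _+_ to _+ᴷ_; _*_ to _*ᴷ_; -_ to -ᴷ_)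
  open Exp semiring using (_^_)
  open Mult semiring using () renaming (_×_ to _×ᴷ_)

  scalars : Module K k ℓ
  scalars = TensorUnit.⟨module⟩ {R = K}

  module Graphs   = FreeModule K graphs
  module Diagrams = FreeModule K chordDiagrams

  𝔾 : Module K k (k ⊔ ℓ)
  𝔾 = Graphs.freeModule

  𝔸 : Module K k (k ⊔ ℓ)
  𝔸 = Diagrams.freeModule

  [_]ᴳ : Graph → Module.Carrierᴹ 𝔾
  [ G ]ᴳ = Graphs.⟦ G ⟧

  [_]ᴰ : ∀ {n} → ChordDiagram n → Module.Carrierᴹ 𝔸
  [ D ]ᴰ = Diagrams.⟦ _ , D ⟧

  record Is4Invariant {m ℓm} (M : Module K m ℓm) (g : Module.Carrierᴹ 𝔾 → Module.Carrierᴹ M) :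
                      Set (k ⊔ ℓ ⊔ m ⊔ ℓm) where
    open Module M
    field
      linear   : IsLinear 𝔾 M g
      fourTerm : ∀ (G : Graph) (a b : Vertex G) → adj G a b ≡ true →
                 (g [ G ]ᴳ +ᴹ -ᴹ g [ removeEdge G a b ]ᴳ) ≈ᴹ
                 (g [ switch G a b ]ᴳ +ᴹ -ᴹ g [ removeEdge (switch G a b) a b ]ᴳ)

  ∑⊆ : ∀ n → (Subset n → ∣K∣) → ∣K∣
  ∑⊆ zero    f = f []
  ∑⊆ (suc n) f = ∑⊆ n (f ∘ (outside ∷_)) +ᴷ ∑⊆ n (f ∘ (inside ∷_))

  3# : ∣K∣
  3# = 1# +ᴷ 1# +ᴷ 1#

  ψᴳ : Graph → ∣K∣
  ψᴳ G = (½ ^ order G) *ᴷ ∑⊆ (order G) (λ V′ → ((-ᴷ 1#) ^ ∣ V′ ∣) *ᴷ (3# ^ η (G framedOn V′)))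

  ψ : Module.Carrierᴹ 𝔾 → ∣K∣
  ψ = Graphs.linearExtension scalars ψᴳ

  -- The polynomial algebra K[c], as the module freely spanned by the
  -- monomials cⁿ (represented by their exponents n : ℕ).

  module Polynomials = FreeModule K (setoid ℕ)

  K[c] : Module K k (k ⊔ ℓ)
  K[c] = Polynomials.freeModule

  open Module K[c]
    using () renaming (Carrierᴹ to Poly; _≈ᴹ_ to _≈ᴾ_; _+ᴹ_ to _+ᴾ_; _*ₗ_ to _·ᴾ_; 0ᴹ to 0ᴾ; -ᴹ_ to -ᴾ_)
  module Sumᴾ = Sum (Module.+ᴹ-commutativeMonoid K[c])

  infixl 7 _*ᴾ_
  infixl 6 _-ᴾ_

  c^_ : ℕ → Poly
  c^ n = Polynomials.⟦ n ⟧

  const : ∣K∣ → Poly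
  const r = r ·ᴾ c^ 0

  _-ᴾ_ : Poly → Poly → Poly
  p -ᴾ q = p +ᴾ -ᴾ q

  _*ᴾ_ : Poly → Poly → Poly
  p *ᴾ q = Polynomials.linearExtension K[c]
             (λ m → Polynomials.linearExtension K[c] (λ n → c^ (m + n)) q) p

  eval : ∣K∣ → Poly → ∣K∣
  eval x = Polynomials.linearExtension scalars (x ^_)

  ∑-pairs : ∀ k → (Fin k → Fin k → Poly) → Poly
  ∑-pairs k f = Sumᴾ.sum {k} λ i → Sumᴾ.sum {k} λ j → if does (i <? j) then f i j else 0ᴾ

  -- The properties by which Chmutov and Varchenko characterise the sl(2)-weight
  -- system w : 𝔸 → K[c] uniquely; here aᵢ 0 , aᵢ 1 , … are the chords
  -- intersecting a.

  record IsSl2WeightSystem (w : Module.Carrierᴹ 𝔸 → Poly) : Set (k ⊔ ℓ) where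
    field
      linear    : IsLinear 𝔸 K[c] w
      empty     : (D : ChordDiagram 0) → w [ D ]ᴰ ≈ᴾ c^ 0
      recursion : ∀ {n} (D : ChordDiagram (suc n)) (a : Fin (suc n)) →
        let as = intersecting D a
            aᵢ = lookupᴸ as
        in w [ D ]ᴰ ≈ᴾ
           ((c^ 1 -ᴾ const (length as ×ᴷ ½)) *ᴾ w [ deleteChord D a ]ᴰ)
           +ᴾ (½ ·ᴾ ∑-pairs (length as) λ i j →
                 w [ parallel D a (aᵢ i) (aᵢ j) ]ᴰ -ᴾ w [ crossed D a (aᵢ i) (aᵢ j) ]ᴰ)

{-# OPTIONS --safe #-}

-- After multiplication by 2ⁿ everything takes place in ℤ, with
-- Ψ(A) = ∑ (-1)^|V| 3^corank(A + V), the sum being over the framings V.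
-- Adding the vertex b to the vertex a is a congruence of matrices that
-- permutes the four framings of a and b; this gives the four-term relation.
--
-- For the recursion at a chord a, let H be the diagram of the other chords and
-- h(s, t) the value of Ψ on H together with a chord from the gap s to the gap
-- t of the circle.  The second difference of h that moves the two ends across
-- endpoints x and y of H is 2Ψ(H) if x and y belong to one chord (a four-term
-- relation with a twin vertex), and otherwise the difference between the two
-- other ways of joining x, y and the opposite endpoints x̄, ȳ.  Hence
-- 2h(s, t) - 4Ψ(H) is a quadratic form in the signed numbers of endpoints of
-- the chords of H between s and t, and this is the recursion at c = 1.
--
-- The statement on second differences holds for each framing of the remaining
-- chords.  A remaining chord of framing 1 is eliminated by reversing the arc
-- between its endpoints.  Two intersecting chords of framing 0 are reduced to
-- this case by inserting a tiny chord of framing 1.  If all remaining chords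
-- are disjoint and of framing 0, only the way in which they separate
-- x, x̄, y, ȳ matters, and finitely many matrices are left, for which the
-- powers of 3 are compared.  The circle is needed here: the identity fails for
-- general matrices, namely if a chord separates {x, y} from {x̄, ȳ} although
-- the chords (x, y) and (x̄, ȳ) intersect.

module Submission where

open import Defs
open import Algebra.Bundles using (CommutativeRing)
open import Algebra.Module.Bundles using (Module)
import Algebra.Properties.AbelianGroup as AbelianGroupProperties
import Algebra.Properties.Ring as RingProperties
import Algebra.Properties.Semiring.Exp as Exp
import Algebra.Properties.Semiring.Mult as Mult
open import Data.Bool using (Bool; true; false; not; _∧_; _∨_; _xor_; if_then_else_)
import Data.Bool.Properties as Bool
open import Data.Fin using (Fin; zero; suc)
import Data.Fin as F
import Data.Fin.Properties as Fin
open import Data.Fin.Permutation using (Permutation; _⟨$⟩ʳ_; _⟨$⟩ˡ_; inverseˡ; ↔⇒≡)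
open import Data.Fin.Subset using (Subset; ∣_∣)
open import Data.Integer using (ℤ; +_; -[1+_]; _⊖_) renaming (_+_ to _+ℤ_; _*_ to _*ℤ_; _-_ to _-ℤ_; -_ to -ℤ_)
import Data.Integer.Properties as ℤ
open import Data.Integer.Solver using (module +-*-Solver)
open import Data.List using () renaming (lookup to lookupᴸ)
open import Data.Nat using (ℕ; zero; suc)
import Data.Nat as ℕ using (_+_; _^_)
import Data.Nat.Properties as ℕ using (+-suc)
open import Data.Product using (∃; _×_; _,_)
open import Data.Vec using (_∷_; [])
open import Data.Vec.Functional using () renaming (_∷_ to _∷ᶠ_)
open import Function using (_∘_)
open import Relation.Binary.Bundles using (Setoid)
import Relation.Binary.Reasoning.Setoid as SetoidReasoning
open import Relation.Binary.PropositionalEquality as ≡ using (_≡_; _≢_; cong; cong₂)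
open import Relation.Nullary using (Dec; yes; no; does; contradiction)

-- The reduction stays among chord diagrams because two operations coincide. Eliminating a vertex b
-- of framing 1 is a Schur complement: it adds b_j b_k to the entry at j, k, framings included.
-- Reversing the arc between the endpoints of b changes the order of exactly the pairs of points
-- inside it, and so changes the intersection number of two other chords by the same product. A
-- vertex of framing 0 is no pivot, which the tiny chord repairs: it costs one chord, and the two
-- eliminations that follow gain two.
--
-- The base 3 shows itself at isolated vertices: their two framings contribute 3 - 1 = 2, which
-- after halving is the value c = 1 of a single chord. The same 2 gives h(s, s) = 2Ψ(H), hence the
-- constant 4Ψ(H) beside the quadratic form. The factor 2 in 2h is there because polarising a
-- symmetric form yields every mixed term twice.
--
-- Coranks are evaluated only for matrices of order at most 4; everywhere else they are compared by
-- explicit bijections between kernels.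

module IntegerInvariant where

  open import Data.Bool using (Bool; true; false; not; _∧_; _∨_; _xor_; if_then_else_)
  import Data.Bool.Properties as Bool
  open import Data.Bool.Solver using (module xor-∧-Solver)
  open import Data.Fin using (Fin; zero; suc; punchIn; punchOut; splitAt; _↑ˡ_; _↑ʳ_; combine; remQuot; toℕ)
  import Data.Fin as F
  open import Data.Fin.Permutation as Perm using (Permutation; _⟨$⟩ʳ_; _⟨$⟩ˡ_; inverseʳ; inverseˡ)
  import Data.Fin.Properties as Fin
  open import Data.Fin.Subset using (Subset)
  open import Data.Integer using (ℤ; +_; _-_; -_) renaming (_+_ to _+ℤ_; _*_ to _*ℤ_)
  import Data.Integer.Properties as ℤ
  open import Data.Integer.Solver using (module +-*-Solver)
  open import Data.List using (List; []; _∷_; length; filter; allFin) renaming (lookup to lookupᴸ; tabulate to tabulateᴸ)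
  open import Data.List.Membership.Propositional.Properties using (∈-lookup)
  open import Data.List.Relation.Unary.All as All using ([]; _∷_)
  import Data.List.Relation.Unary.All.Properties as All
  open import Data.List.Relation.Unary.AllPairs using ([]; _∷_)
  open import Data.List.Relation.Unary.Unique.Propositional using (Unique)
  import Data.List.Relation.Unary.Unique.Propositional.Properties as Unique
  open import Data.Nat using (ℕ; zero; suc; _<_; _≤_; _+_; _*_; _∸_; _^_; _%_; _<?_; s≤s; z≤n)
  import Data.Nat.DivMod as ℕ
  import Data.Nat.Properties as ℕ
  open import Data.Product using (∃; _×_; _,_; proj₁; proj₂; map₁)
  open import Data.Product.Relation.Binary.Pointwise.NonDependent using (×-setoid)
  open import Data.Sum using (_⊎_; inj₁; inj₂; [_,_]′)
  open import Data.Vec using (Vec; []; _∷_; lookup; tabulate; insertAt)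
  open import Data.Vec.Functional using (Vector) renaming (_∷_ to _∷ᶠ_; [] to []ᶠ; insertAt to insertAtᶠ)
  import Data.Vec.Functional.Properties as Vectorᶠ
  open import Data.Vec.Properties
    using (lookup∘tabulate; tabulate∘lookup; tabulate-cong; ∷-injective; insertAt-lookup; insertAt-punchIn)
  open import Function using (_∘_; Injective; mk⇔)
  open import Level using (0ℓ)
  open import Relation.Binary using (tri<; tri≈; tri>)
  open import Relation.Binary.Bundles using (Setoid)
  open import Relation.Binary.PropositionalEquality
    using (_≡_; _≢_; _≗_; refl; sym; trans; cong; cong₂; subst; subst₂; module ≡-Reasoning)
  open import Relation.Nullary using (¬_; Dec; yes; no; does; contradiction)
  open import Relation.Nullary.Decidable
    using (_×-dec_; _⊎-dec_; _→-dec_; map′; from-yes; dec-true; dec-false; does-⇔)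
  open import Relation.Unary using (Pred; Decidable)
  open import Algebra.Properties.Semiring.Sum 𝔽₂.semiring using () renaming (*-distribˡ-sum to ∧-sum)
  open import Algebra.Properties.Semiring.Sum ℤ.+-*-semiring using ()
    renaming (sum to ∑; sum-cong-≗ to ∑-cong; ∑-comm to ∑-swap; sum-replicate-zero to ∑-replicate-zero) public

  open Sum₂ using (sum; sum-cong-≗; ∑-distrib-+; sum-remove; sum-replicate-zero; sum-permute)
  open +-*-Solver using (solve; _:+_; _:*_; _:-_; :-_; _:=_; con)
  open xor-∧-Solver using ()
    renaming (solve to solve₂; _:+_ to _⊹_; _:*_ to _⊛_; _:=_ to _⊜_; con to con₂)

  -- Linear algebra over 𝔽₂

  sum-false : ∀ {n} {f : Vector Bool n} → (∀ i → f i ≡ false) → sum f ≡ false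
  sum-false {n} f≗0 = trans (sum-cong-≗ f≗0) (sum-replicate-zero n)

  sum-select : ∀ {n} (f : Vector Bool n) (j : Fin n) → sum (λ k → f k ∧ (k == j)) ≡ f j
  sum-select {suc n} f zero = begin
    (f zero ∧ true) xor sum (λ k → f (suc k) ∧ false)
      ≡⟨ cong₂ _xor_ (Bool.∧-identityʳ (f zero)) (sum-false (λ k → Bool.∧-zeroʳ (f (suc k)))) ⟩
    f zero xor false  ≡⟨ Bool.xor-identityʳ (f zero) ⟩
    f zero            ∎
    where open ≡-Reasoning
  sum-select {suc n} f (suc j) =
    trans (cong (_xor sum (λ k → f (suc k) ∧ (k == j))) (Bool.∧-zeroʳ (f zero))) (sum-select (f ∘ suc) j)

  sum-↑ : ∀ m {n} (f : Vector Bool (m + n)) → sum f ≡ sum (f ∘ (_↑ˡ n)) xor sum (f ∘ (m ↑ʳ_))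
  sum-↑ zero    f = refl
  sum-↑ (suc m) f = trans (cong (f zero xor_) (sum-↑ m (f ∘ suc))) (sym (Bool.xor-assoc (f zero) _ _))

  xor-∧-sum : ∀ {n} (f g v : Vector Bool n) b →
              sum (λ k → (f k xor (b ∧ g k)) ∧ v k) ≡ sum (λ k → f k ∧ v k) xor (b ∧ sum (λ k → g k ∧ v k))
  xor-∧-sum f g v b = begin
    sum (λ k → (f k xor (b ∧ g k)) ∧ v k)
      ≡⟨ sum-cong-≗ (λ k → solve₂ 4 (λ b f g v → (f ⊹ b ⊛ g) ⊛ v ⊜ f ⊛ v ⊹ b ⊛ (g ⊛ v)) refl b (f k) (g k) (v k)) ⟩
    sum (λ k → (f k ∧ v k) xor (b ∧ (g k ∧ v k)))
      ≡⟨ ∑-distrib-+ (λ k → f k ∧ v k) (λ k → b ∧ (g k ∧ v k)) ⟩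
    sum (λ k → f k ∧ v k) xor sum (λ k → b ∧ (g k ∧ v k))
      ≡⟨ cong (sum (λ k → f k ∧ v k) xor_) (∧-sum b (λ k → g k ∧ v k)) ⟨
    sum (λ k → f k ∧ v k) xor (b ∧ sum (λ k → g k ∧ v k)) ∎
    where open ≡-Reasoning

  xor≡false⇒≡ : ∀ {x y} → x xor y ≡ false → x ≡ y
  xor≡false⇒≡ {false} {false} _ = refl
  xor≡false⇒≡ {true}  {true}  _ = refl

  ≡⇒xor≡false : ∀ {x y} → x ≡ y → x xor y ≡ false
  ≡⇒xor≡false {x} refl = Bool.xor-same x

  ==-refl : ∀ {n} (i : Fin n) → (i == i) ≡ true
  ==-refl i = dec-true (i Fin.≟ i) refl

  ==-false : ∀ {n} {i j : Fin n} → i ≢ j → (i == j) ≡ false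
  ==-false {i = i} {j} i≢j = dec-false (i Fin.≟ j) i≢j

  -- A subspace of an 𝔽₂-vector space has dimension d as soon as it is in
  -- bijection with 𝔽₂ᵈ, so linearity plays no role in comparing dimensions.

  module _ (S : Setoid 0ℓ 0ℓ) where
    open Setoid S using (_≈_) renaming (Carrier to X)

    record Dim (U : X → Set) (d : ℕ) : Set where
      field
        vector     : Vec Bool d → X
        member     : ∀ c → U (vector c)
        injective  : ∀ {c c′} → vector c ≈ vector c′ → c ≡ c′
        surjective : ∀ {x} → U x → ∃ λ c → x ≈ vector c

  open Dim

  encode : ∀ {n} → Vec Bool n → Fin (2 ^ n)
  encode []          = zero
  encode (false ∷ v) = combine {2} zero (encode v)
  encode (true ∷ v)  = combine {2} (suc zero) (encode v)

  encode-injective : ∀ {n} → Injective _≡_ _≡_ (encode {n})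
  encode-injective {x = []} {[]} _ = refl
  encode-injective {x = false ∷ v} {false ∷ w} eq = cong (false ∷_) (encode-injective (Fin.combine-injectiveʳ {2} zero (encode v) zero (encode w) eq))
  encode-injective {x = true ∷ v}  {true ∷ w}  eq = cong (true ∷_) (encode-injective (Fin.combine-injectiveʳ {2} (suc zero) (encode v) (suc zero) (encode w) eq))
  encode-injective {x = false ∷ v} {true ∷ w}  eq with () ← Fin.combine-injectiveˡ {2} zero (encode v) (suc zero) (encode w) eq
  encode-injective {x = true ∷ v}  {false ∷ w} eq with () ← Fin.combine-injectiveˡ {2} (suc zero) (encode v) zero (encode w) eq

  bit : Fin 2 → Bool
  bit zero       = false
  bit (suc zero) = true

  bit-injective : Injective _≡_ _≡_ bit
  bit-injective {zero}     {zero}     _ = refl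
  bit-injective {zero}     {suc zero} ()
  bit-injective {suc zero} {zero}     ()
  bit-injective {suc zero} {suc zero} _ = refl

  decode : ∀ {n} → Fin (2 ^ n) → Vec Bool n
  decode {zero}  _ = []
  decode {suc n} i = bit (proj₁ (remQuot {2} (2 ^ n) i)) ∷ decode (proj₂ (remQuot {2} (2 ^ n) i))

  decode-injective : ∀ {n} → Injective _≡_ _≡_ (decode {n})
  decode-injective {zero}  {zero} {zero} _ = refl
  decode-injective {suc n} {i} {j} eq with p , q ← ∷-injective eq =
    trans (sym (Fin.combine-remQuot {2} (2 ^ n) i))
    (trans (cong₂ combine (bit-injective p) (decode-injective {n} q)) (Fin.combine-remQuot {2} (2 ^ n) j))

  -- Pigeonhole: in binary the map becomes an injection of `Fin (2 ^ d)` into `Fin (2 ^ e)`, and 2^e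
  -- < 2^d for e < d.
  injection⇒≤ : ∀ {d e} (f : Vec Bool d → Vec Bool e) → Injective _≡_ _≡_ f → d ≤ e
  injection⇒≤ {d} {e} f inj = ℕ.≮⇒≥ λ e<d →
    ℕ.<⇒≱ (ℕ.^-monoʳ-< 2 (s≤s (s≤s z≤n)) e<d)
      (Fin.injective⇒≤ {f = encode ∘ f ∘ decode {d}} (λ eq → decode-injective {d} (inj (encode-injective eq))))

  module _ {S : Setoid 0ℓ 0ℓ} where
    open Setoid S using (_≈_) renaming (Carrier to X; sym to ≈-sym; trans to ≈-trans)

    dim-≤ : ∀ {U : X → Set} {d e} → Dim S U d → Dim S U e → d ≤ e
    dim-≤ p q = injection⇒≤ (λ c → proj₁ (surjective q (member p c))) λ {c} {c′} eq →
      injective p (≈-trans (proj₂ (surjective q (member p c)))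
        (≈-trans (subst (λ c″ → vector q (proj₁ (surjective q (member p c))) ≈ vector q c″) eq (Setoid.refl S))
                 (≈-sym (proj₂ (surjective q (member p c′))))))

    dim-unique : ∀ {U : X → Set} {d e} → Dim S U d → Dim S U e → d ≡ e
    dim-unique p q = ℕ.≤-antisym (dim-≤ p q) (dim-≤ q p)

  -- The maps are inverse to each other only on `U` and `W`. A kernel may therefore be projected to
  -- coordinates that determine the others, the inverse being the solution of the equations left
  -- out.
  record Iso (S T : Setoid 0ℓ 0ℓ) (U : Setoid.Carrier S → Set) (W : Setoid.Carrier T → Set) : Set where
    module S = Setoid S
    module T = Setoid T
    field
      to        : S.Carrier → T.Carrier
      from      : T.Carrier → S.Carrier
      to-cong   : ∀ {x y} → x S.≈ y → to x T.≈ to y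
      from-cong : ∀ {x y} → x T.≈ y → from x S.≈ from y
      to-∈      : ∀ {x} → U x → W (to x)
      from-∈    : ∀ {y} → W y → U (from y)
      to-from   : ∀ {y} → W y → to (from y) T.≈ y
      from-to   : ∀ {x} → U x → from (to x) S.≈ x

  module _ {S T : Setoid 0ℓ 0ℓ} {U : Setoid.Carrier S → Set} {W : Setoid.Carrier T → Set} where

    dim-iso : ∀ {d} → Iso S T U W → Dim S U d → Dim T W d
    dim-iso I D = record
      { vector     = to ∘ vector D
      ; member     = to-∈ ∘ member D
      ; injective  = λ {c} {c′} eq → injective D
          (S.trans (S.sym (from-to (member D c))) (S.trans (from-cong eq) (from-to (member D c′))))
      ; surjective = λ {y} w → let c , eq = surjective D (from-∈ w) in
          c , T.trans (T.sym (to-from w)) (to-cong eq)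
      }
      where open Iso I

    -- W ≅ U × 𝔽₂
    dim-suc : ∀ {d} (extend : Bool → Setoid.Carrier S → Setoid.Carrier T)
              (to : Setoid.Carrier T → Setoid.Carrier S) (head : Setoid.Carrier T → Bool) →
              (∀ b {x y} → Setoid._≈_ S x y → Setoid._≈_ T (extend b x) (extend b y)) →
              (∀ {x y} → Setoid._≈_ T x y → Setoid._≈_ S (to x) (to y)) →
              (∀ {x y} → Setoid._≈_ T x y → head x ≡ head y) →
              (∀ b {x} → U x → W (extend b x)) → (∀ {y} → W y → U (to y)) →
              (∀ b x → Setoid._≈_ S (to (extend b x)) x) → (∀ b x → head (extend b x) ≡ b) →
              (∀ y → Setoid._≈_ T (extend (head y) (to y)) y) →
              Dim S U d → Dim T W (suc d)
    dim-suc extend to head extend-cong to-cong head-cong extend-∈ to-∈ to-extend head-extend extend-to D = record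
      { vector     = λ { (b ∷ c) → extend b (vector D c) }
      ; member     = λ { (b ∷ c) → extend-∈ b (member D c) }
      ; injective  = λ { {b ∷ c} {b′ ∷ c′} eq → cong₂ _∷_
          (trans (sym (head-extend b _)) (trans (head-cong eq) (head-extend b′ _)))
          (injective D (S.trans (S.sym (to-extend b _)) (S.trans (to-cong eq) (to-extend b′ _)))) }
      ; surjective = λ {y} w → let c , eq = surjective D (to-∈ w) in
          head y ∷ c , T.trans (T.sym (extend-to y)) (extend-cong (head y) eq)
      }
      where
      module S = Setoid S
      module T = Setoid T

  Coords : ℕ → Setoid 0ℓ 0ℓ
  Coords n = record
    { Carrier = Vector Bool n ; _≈_ = _≗_
    ; isEquivalence = record { refl = λ _ → refl ; sym = λ p i → sym (p i) ; trans = λ p q i → trans (p i) (q i) } }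

  dim-basis : ∀ {n} {U : Vector Bool n → Set} → U (λ _ → false) → DecSubspace U → ∀ {d} → Basis U d → Dim (Coords n) U d
  dim-basis {n} {U} 0∈U subspace {d} B = record
    { vector     = λ c → combination (lookup c) vectors
    ; member     = λ c → combination-∈ (lookup c) vectors members
    ; injective  = λ {c} {c′} eq → trans (sym (tabulate∘lookup c)) (trans
        (tabulate-cong (λ k → xor≡false⇒≡ (independent (λ k → lookup c k xor lookup c′ k) (λ i → trans
          (trans (sum-cong-≗ (λ k → 𝔽₂.distribʳ (vectors k i) (lookup c k) (lookup c′ k)))
                 (∑-distrib-+ (λ k → lookup c k ∧ vectors k i) (λ k → lookup c′ k ∧ vectors k i)))
          (≡⇒xor≡false (eq i))) k)))
        (tabulate∘lookup c′))
    ; surjective = λ {x} u → let c , eq = spanning x u in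
        tabulate c , λ i → trans (eq i) (sum-cong-≗ (λ k → cong (_∧ vectors k i) (sym (lookup∘tabulate c k))))
    }
    where
    open Basis B
    open DecSubspace subspace

    combination-∈ : ∀ {e} (c : Vector Bool e) (b : Fin e → Vector Bool n) → (∀ k → U (b k)) →
                    U (combination c b)
    combination-∈ {zero}  c b b∈ = 0∈U
    combination-∈ {suc e} c b b∈ = closed scaled (combination-∈ (c ∘ suc) (b ∘ suc) (b∈ ∘ suc))
      where
      scaled : U (λ i → c zero ∧ b zero i)
      scaled with c zero
      ... | true  = b∈ zero
      ... | false = 0∈U

  opaque
    -- Opaque, so that type checking does not start searching for kernel bases. Dimensions being
    -- unique, `dim-kernel` determines the value; the definition is unfolded to evaluate the few
    -- small matrices left at the end and to compare with `η`.
    cork : ∀ {n} → Matrix₂ n → ℕ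
    cork A = proj₁ (kernelBasis A)

    dim-kernel : ∀ {n} (A : Matrix₂ n) → Dim (Coords n) (InKernel A) (cork A)
    dim-kernel A = dim-basis (λ i → sum-false (λ j → Bool.∧-zeroʳ (A i j))) (kernel-decSubspace A) (proj₂ (kernelBasis A))

  cork-iso : ∀ {m n} {A : Matrix₂ m} {A′ : Matrix₂ n} →
             Iso (Coords m) (Coords n) (InKernel A) (InKernel A′) → cork A ≡ cork A′
  cork-iso {A = A} {A′} I = dim-unique (dim-iso I (dim-kernel A)) (dim-kernel A′)

  -- The matrix [B R; Rᵀ X], with m "rest" and s "special" indices.

  Pair : ℕ → ℕ → Setoid 0ℓ 0ℓ
  Pair m s = ×-setoid (Coords m) (Coords s)

  module _ {m s} (B : Matrix₂ m) (R : Fin m → Fin s → Bool) (X : Matrix₂ s) where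

    record Kernel (v : Vector Bool m × Vector Bool s) : Set where
      constructor kernel
      field
        rest    : ∀ j → sum (λ k → B j k ∧ proj₁ v k) xor sum (λ p → R j p ∧ proj₂ v p) ≡ false
        special : ∀ p → sum (λ k → R k p ∧ proj₁ v k) xor sum (λ q → X p q ∧ proj₂ v q) ≡ false

    blockEntry : Fin m ⊎ Fin s → Fin m ⊎ Fin s → Bool
    blockEntry (inj₁ j) (inj₁ k) = B j k
    blockEntry (inj₁ j) (inj₂ p) = R j p
    blockEntry (inj₂ p) (inj₁ k) = R k p
    blockEntry (inj₂ p) (inj₂ q) = X p q

    block : Matrix₂ (m + s)
    block i j = blockEntry (splitAt m i) (splitAt m j)

    opaque
      nullity : ℕ
      nullity = cork block

  open Kernel

  module _ {m s} {B : Matrix₂ m} {R : Fin m → Fin s → Bool} {X : Matrix₂ s} where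

    opaque
      unfolding nullity

      dim-Kernel : Dim (Pair m s) (Kernel B R X) (nullity B R X)
      dim-Kernel = dim-iso record
        { to        = λ v → (v ∘ (_↑ˡ s)) , (v ∘ (m ↑ʳ_))
        ; from      = λ v i → [ proj₁ v , proj₂ v ]′ (splitAt m i)
        ; to-cong   = λ eq → (λ j → eq (j ↑ˡ s)) , (λ p → eq (m ↑ʳ p))
        ; from-cong = λ eq i → [,]-cong eq (splitAt m i)
        ; to-∈      = λ {v} u → kernel
            (λ j → split-row v (j ↑ˡ s) (Fin.splitAt-↑ˡ m j s) (u (j ↑ˡ s)))
            (λ p → split-row v (m ↑ʳ p) (Fin.splitAt-↑ʳ m s p) (u (m ↑ʳ p)))
        ; from-∈    = λ {v} u i → row-from u i
        ; to-from   = λ {v} _ → (λ j → cong [ proj₁ v , proj₂ v ]′ (Fin.splitAt-↑ˡ m j s)) ,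
                                (λ p → cong [ proj₁ v , proj₂ v ]′ (Fin.splitAt-↑ʳ m s p))
        ; from-to   = λ {v} _ i → from-to v i
        } (dim-kernel (block B R X))
        where
        [,]-cong : ∀ {v w : Vector Bool m × Vector Bool s} → Setoid._≈_ (Pair m s) v w →
                   ∀ i → [ proj₁ v , proj₂ v ]′ i ≡ [ proj₁ w , proj₂ w ]′ i
        [,]-cong eq (inj₁ j) = proj₁ eq j
        [,]-cong eq (inj₂ p) = proj₂ eq p

        from-to : ∀ (v : Vector Bool (m + s)) i → [ v ∘ (_↑ˡ s) , v ∘ (m ↑ʳ_) ]′ (splitAt m i) ≡ v i
        from-to v i with splitAt m i | Fin.join-splitAt m s i
        ... | inj₁ j | eq = cong v eq
        ... | inj₂ p | eq = cong v eq

        entry : Fin m ⊎ Fin s → Fin m ⊎ Fin s → Bool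
        entry = blockEntry B R X

        row : ∀ e (v : Vector Bool (m + s)) → sum (λ i → entry e (splitAt m i) ∧ v i) ≡
              sum (λ k → entry e (inj₁ k) ∧ v (k ↑ˡ s)) xor sum (λ p → entry e (inj₂ p) ∧ v (m ↑ʳ p))
        row e v = trans (sum-↑ m _) (cong₂ _xor_
          (sum-cong-≗ (λ k → cong (λ i → entry e i ∧ v (k ↑ˡ s)) (Fin.splitAt-↑ˡ m k s)))
          (sum-cong-≗ (λ p → cong (λ i → entry e i ∧ v (m ↑ʳ p)) (Fin.splitAt-↑ʳ m s p))))

        row-join : ∀ e (v : Vector Bool m × Vector Bool s) →
                   sum (λ i → entry e (splitAt m i) ∧ [ proj₁ v , proj₂ v ]′ (splitAt m i)) ≡
                   sum (λ k → entry e (inj₁ k) ∧ proj₁ v k) xor sum (λ p → entry e (inj₂ p) ∧ proj₂ v p)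
        row-join e v = trans (row e _) (cong₂ _xor_
          (sum-cong-≗ (λ k → cong (λ i → entry e (inj₁ k) ∧ [ proj₁ v , proj₂ v ]′ i) (Fin.splitAt-↑ˡ m k s)))
          (sum-cong-≗ (λ p → cong (λ i → entry e (inj₂ p) ∧ [ proj₁ v , proj₂ v ]′ i) (Fin.splitAt-↑ʳ m s p))))

        split-row : ∀ {e} (v : Vector Bool (m + s)) i → splitAt m i ≡ e → sum (λ j → block B R X i j ∧ v j) ≡ false →
                    sum (λ k → entry e (inj₁ k) ∧ v (k ↑ˡ s)) xor sum (λ p → entry e (inj₂ p) ∧ v (m ↑ʳ p)) ≡ false
        split-row v i refl u = trans (sym (row (splitAt m i) v)) u

        row-from : ∀ {v} → Kernel B R X v → InKernel (block B R X) (λ i → [ proj₁ v , proj₂ v ]′ (splitAt m i))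
        row-from {v} u i with splitAt m i
        ... | inj₁ j = trans (row-join (inj₁ j) v) (rest u j)
        ... | inj₂ p = trans (row-join (inj₂ p) v) (special u p)

  module _ {m s m′ s′} {B : Matrix₂ m} {R : Fin m → Fin s → Bool} {X : Matrix₂ s}
           {B′ : Matrix₂ m′} {R′ : Fin m′ → Fin s′ → Bool} {X′ : Matrix₂ s′} where

    nullity-iso : Iso (Pair m s) (Pair m′ s′) (Kernel B R X) (Kernel B′ R′ X′) →
                  nullity B R X ≡ nullity B′ R′ X′
    nullity-iso I = dim-unique (dim-iso I dim-Kernel) dim-Kernel

  -- The changes of coordinates below are involutions, adding being its own inverse in
  -- characteristic 2, so a single map serves both directions.
  nullity-involution : ∀ {m s} {B B′ : Matrix₂ m} {R R′ : Fin m → Fin s → Bool} {X X′ : Matrix₂ s}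
    (f : Vector Bool m × Vector Bool s → Vector Bool m × Vector Bool s) →
    (∀ {v w} → Setoid._≈_ (Pair m s) v w → Setoid._≈_ (Pair m s) (f v) (f w)) →
    (∀ v → Setoid._≈_ (Pair m s) (f (f v)) v) →
    (∀ {v} → Kernel B R X v → Kernel B′ R′ X′ (f v)) → (∀ {v} → Kernel B′ R′ X′ v → Kernel B R X (f v)) →
    nullity B R X ≡ nullity B′ R′ X′
  nullity-involution f f-cong f-f to from = nullity-iso record
    { to = f ; from = f ; to-cong = f-cong ; from-cong = f-cong ; to-∈ = to ; from-∈ = from
    ; to-from = λ {v} _ → f-f v ; from-to = λ {v} _ → f-f v }

  nullity-cong : ∀ {m s} {B B′ : Matrix₂ m} {R R′ : Fin m → Fin s → Bool} {X X′ : Matrix₂ s} →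
                 (∀ j k → B j k ≡ B′ j k) → (∀ j p → R j p ≡ R′ j p) → (∀ p q → X p q ≡ X′ p q) →
                 nullity B R X ≡ nullity B′ R′ X′
  nullity-cong {m} {s} B≗ R≗ X≗ = nullity-involution (λ v → v) (λ eq → eq) (λ v → Setoid.refl (Pair m s) {v})
    (go B≗ R≗ X≗) (go (λ j k → sym (B≗ j k)) (λ j p → sym (R≗ j p)) (λ p q → sym (X≗ p q)))
    where
    go : ∀ {B B′ : Matrix₂ m} {R R′ : Fin m → Fin s → Bool} {X X′ : Matrix₂ s} →
         (∀ j k → B j k ≡ B′ j k) → (∀ j p → R j p ≡ R′ j p) → (∀ p q → X p q ≡ X′ p q) →
         ∀ {v} → Kernel B R X v → Kernel B′ R′ X′ v
    go B≗ R≗ X≗ {v} u = kernel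
      (λ j → trans (cong₂ _xor_ (sum-cong-≗ (λ k → cong (_∧ proj₁ v k) (sym (B≗ j k))))
                                (sum-cong-≗ (λ p → cong (_∧ proj₂ v p) (sym (R≗ j p))))) (rest u j))
      (λ p → trans (cong₂ _xor_ (sum-cong-≗ (λ k → cong (_∧ proj₁ v k) (sym (R≗ k p))))
                                (sum-cong-≗ (λ q → cong (_∧ proj₂ v q) (sym (X≗ p q))))) (special u p))

  punchIn-elim : ∀ {ℓ n} (P : Fin (suc n) → Set ℓ) v → P v → (∀ j → P (punchIn v j)) → ∀ j → P j
  punchIn-elim P v pv pp j with v Fin.≟ j
  ... | yes refl = pv
  ... | no v≢j   = subst P (Fin.punchIn-punchOut v≢j) (pp (punchOut v≢j))

  module _ {m s} (B : Matrix₂ (suc m)) (R : Fin (suc m) → Fin s → Bool) (X : Matrix₂ s) (v : Fin (suc m)) where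

    private
      ι : Fin m → Fin (suc m)
      ι = punchIn v

      insert-cong : ∀ {w w′ : Vector Bool m} {b b′} → w ≗ w′ → b ≡ b′ → insertAtᶠ w v b ≗ insertAtᶠ w′ v b′
      insert-cong {w} {w′} {b} {b′} w≗ b≡ = punchIn-elim _ v
        (trans (Vectorᶠ.insertAt-lookup w v b) (trans b≡ (sym (Vectorᶠ.insertAt-lookup w′ v b′))))
        (λ j → trans (Vectorᶠ.insertAt-punchIn w v b j) (trans (w≗ j) (sym (Vectorᶠ.insertAt-punchIn w′ v b′ j))))

      insert-remove : ∀ {w : Vector Bool (suc m)} {b} → w v ≡ b → insertAtᶠ (w ∘ ι) v b ≗ w
      insert-remove {w} {b} eq = punchIn-elim _ v (trans (Vectorᶠ.insertAt-lookup (w ∘ ι) v b) (sym eq))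
        (Vectorᶠ.insertAt-punchIn (w ∘ ι) v b)

      row : ∀ (f w : Vector Bool (suc m)) → sum (λ k → f k ∧ w k) ≡ (f v ∧ w v) xor sum (λ k → f (ι k) ∧ w (ι k))
      row f w = sum-remove {i = v} (λ k → f k ∧ w k)

      row-insert : ∀ (f : Vector Bool (suc m)) w b →
                   sum (λ k → f k ∧ insertAtᶠ w v b k) ≡ (f v ∧ b) xor sum (λ k → f (ι k) ∧ w k)
      row-insert f w b = trans (row f (insertAtᶠ w v b)) (cong₂ _xor_
        (cong (f v ∧_) (Vectorᶠ.insertAt-lookup w v b))
        (sum-cong-≗ (λ k → cong (f (ι k) ∧_) (Vectorᶠ.insertAt-punchIn w v b k))))

      row-at : ∀ (f w : Vector Bool (suc m)) {b} → f v ≡ b →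
               sum (λ k → f k ∧ w k) ≡ (b ∧ w v) xor sum (λ k → f (ι k) ∧ w (ι k))
      row-at f w refl = row f w

      row-insert-at : ∀ (f : Vector Bool (suc m)) w {a} b → f v ≡ a →
                      sum (λ k → f k ∧ insertAtᶠ w v b k) ≡ (a ∧ b) xor sum (λ k → f (ι k) ∧ w k)
      row-insert-at f w b refl = row-insert f w b

    -- Schur complement of a diagonal entry 1.
    pivotB : Matrix₂ m
    pivotB j k = B (ι j) (ι k) xor (B v (ι j) ∧ B v (ι k))

    pivotR : Fin m → Fin s → Bool
    pivotR j p = R (ι j) p xor (B v (ι j) ∧ R v p)

    pivotX : Matrix₂ s
    pivotX p q = X p q xor (R v p ∧ R v q)

    -- As B v v = 1, the equation of row `v` expresses the coordinate at `v` by the others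
    -- (`solved`). Substituting it into the remaining rows adds the products of entries of row `v`.
    nullity-pivot : B v v ≡ true → (∀ j → B j v ≡ B v j) → nullity B R X ≡ nullity pivotB pivotR pivotX
    nullity-pivot Bvv B-sym = nullity-iso record
      { to        = λ (w , c) → (w ∘ ι) , c
      ; from      = λ (w , c) → insertAtᶠ w v (solved w c) , c
      ; to-cong   = λ (eq , eq′) → (eq ∘ ι) , eq′
      ; from-cong = λ (eq , eq′) → insert-cong eq (cong₂ _xor_
          (sum-cong-≗ (λ k → cong (B v (ι k) ∧_) (eq k))) (sum-cong-≗ (λ p → cong (R v p ∧_) (eq′ p)))) , eq′
      ; to-∈      = λ {(w , c)} u → kernel
          (λ j → trans (rest-row w c j (w v) (pivot-value u)) (trans
            (cong₂ _xor_ (sym (row-at (B (ι j)) w (B-sym (ι j)))) refl)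
            (rest u (ι j))))
          (λ p → trans (special-row w c p (w v) (pivot-value u)) (trans
            (cong₂ _xor_ (sym (row (λ k → R k p) w)) refl) (special u p)))
      ; from-∈    = λ {(w , c)} u → kernel
          (punchIn-elim _ v
            (trans (cong₂ _xor_ (row-insert-at (B v) w _ Bvv) refl)
              (solve₂ 2 (λ b r → (con₂ true ⊛ (b ⊹ r) ⊹ b) ⊹ r ⊜ con₂ false) refl
                 (sum (λ k → B v (ι k) ∧ w k)) (sum (λ p → R v p ∧ c p))))
            (λ j → trans (cong₂ _xor_ (row-insert-at (B (ι j)) w _ (B-sym (ι j))) refl)
              (trans (sym (rest-row′ w c j)) (rest u j))))
          (λ p → trans (cong₂ _xor_ (row-insert (λ k → R k p) w _) refl) (trans (sym (special-row′ w c p)) (special u p)))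
      ; to-from   = λ {(w , c)} _ → Vectorᶠ.insertAt-punchIn w v _ , λ _ → refl
      ; from-to   = λ {(w , c)} u → insert-remove (pivot-value u) , λ _ → refl
      }
      where
      solved : Vector Bool m → Vector Bool s → Bool
      solved w c = sum (λ k → B v (ι k) ∧ w k) xor sum (λ p → R v p ∧ c p)

      pivot-value : ∀ {w c} → Kernel B R X (w , c) → w v ≡ solved (w ∘ ι) c
      pivot-value {w} {c} u = xor≡false⇒≡ (trans (sym (Bool.xor-assoc (w v) _ _))
        (trans (cong₂ _xor_ (sym (row-at (B v) w Bvv)) refl) (rest u v)))

      rest-row′ : ∀ w c j → sum (λ k → pivotB j k ∧ w k) xor sum (λ p → pivotR j p ∧ c p) ≡
        ((B v (ι j) ∧ solved w c) xor sum (λ k → B (ι j) (ι k) ∧ w k)) xor sum (λ p → R (ι j) p ∧ c p)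
      rest-row′ w c j = trans
        (cong₂ _xor_ (xor-∧-sum (λ k → B (ι j) (ι k)) (B v ∘ ι) w (B v (ι j))) (xor-∧-sum (R (ι j)) (R v) c (B v (ι j))))
        (solve₂ 5 (λ b x y z t → (x ⊹ b ⊛ y) ⊹ (z ⊹ b ⊛ t) ⊜ (b ⊛ (y ⊹ t) ⊹ x) ⊹ z) refl (B v (ι j)) _ _ _ _)

      rest-row : ∀ (w : Vector Bool (suc m)) c j t → t ≡ solved (w ∘ ι) c →
        sum (λ k → pivotB j k ∧ w (ι k)) xor sum (λ p → pivotR j p ∧ c p) ≡
        ((B v (ι j) ∧ t) xor sum (λ k → B (ι j) (ι k) ∧ w (ι k))) xor sum (λ p → R (ι j) p ∧ c p)
      rest-row w c j t refl = rest-row′ (w ∘ ι) c j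

      special-row′ : ∀ w c p → sum (λ k → pivotR k p ∧ w k) xor sum (λ q → pivotX p q ∧ c q) ≡
        ((R v p ∧ solved w c) xor sum (λ k → R (ι k) p ∧ w k)) xor sum (λ q → X p q ∧ c q)
      special-row′ w c p = trans
        (cong₂ _xor_ (trans (sum-cong-≗ (λ k → cong (λ x → (R (ι k) p xor x) ∧ w k) (Bool.∧-comm (B v (ι k)) (R v p))))
                            (xor-∧-sum (λ k → R (ι k) p) (B v ∘ ι) w (R v p)))
                     (xor-∧-sum (X p) (R v) c (R v p)))
        (solve₂ 5 (λ b x y z t → (x ⊹ b ⊛ y) ⊹ (z ⊹ b ⊛ t) ⊜ (b ⊛ (y ⊹ t) ⊹ x) ⊹ z) refl (R v p) _ _ _ _)

      special-row : ∀ (w : Vector Bool (suc m)) c p t → t ≡ solved (w ∘ ι) c →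
        sum (λ k → pivotR k p ∧ w (ι k)) xor sum (λ q → pivotX p q ∧ c q) ≡
        ((R v p ∧ t) xor sum (λ k → R (ι k) p ∧ w (ι k))) xor sum (λ q → X p q ∧ c q)
      special-row w c p t refl = special-row′ (w ∘ ι) c p

    -- No equation involves the coordinate at `v`, which is thus a free bit.
    nullity-zero : (∀ k → B v k ≡ false) → (∀ k → B k v ≡ false) → (∀ p → R v p ≡ false) →
                   nullity B R X ≡ suc (nullity (λ j k → B (ι j) (ι k)) (λ j → R (ι j)) X)
    nullity-zero row₀ col₀ R₀ = dim-unique dim-Kernel (dim-suc {S = Pair m s} {T = Pair (suc m) s}
      (λ b (w , c) → insertAtᶠ w v b , c) (λ (w , c) → (w ∘ ι) , c) (λ (w , c) → w v)
      (λ b (eq , eq′) → insert-cong eq refl , eq′) (λ (eq , eq′) → (eq ∘ ι) , eq′) (λ (eq , _) → eq v)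
      (λ b {(w , c)} u → kernel
        (punchIn-elim _ v
          (cong₂ _xor_ (sum-false (λ k → cong (_∧ insertAtᶠ w v b k) (row₀ k))) (sum-false (λ p → cong (_∧ c p) (R₀ p))))
          (λ j → trans (cong₂ _xor_ (row-insert-at (B (ι j)) w b (col₀ (ι j))) refl) (rest u j)))
        (λ p → trans (cong₂ _xor_ (row-insert-at (λ k → R k p) w b (R₀ p)) refl) (special u p)))
      (λ {(w , c)} u → kernel
        (λ j → trans (cong₂ _xor_ (sym (row-at (B (ι j)) w (col₀ (ι j)))) refl) (rest u (ι j)))
        (λ p → trans (cong₂ _xor_ (sym (row-at (λ k → R k p) w (R₀ p))) refl) (special u p)))
      (λ b (w , c) → Vectorᶠ.insertAt-punchIn w v b , λ _ → refl)
      (λ b (w , c) → Vectorᶠ.insertAt-lookup w v b)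
      (λ (w , c) → insert-remove refl , λ _ → refl)
      dim-Kernel)

  sum-update : ∀ {n} (f w : Vector Bool n) j t →
               sum (λ k → f k ∧ (w k xor ((k == j) ∧ t))) ≡ sum (λ k → f k ∧ w k) xor (f j ∧ t)
  sum-update f w j t = begin
    sum (λ k → f k ∧ (w k xor ((k == j) ∧ t)))
      ≡⟨ sum-cong-≗ (λ k → solve₂ 4 (λ f w d t → f ⊛ (w ⊹ d ⊛ t) ⊜ f ⊛ w ⊹ t ⊛ (f ⊛ d)) refl (f k) (w k) (k == j) t) ⟩
    sum (λ k → (f k ∧ w k) xor (t ∧ (f k ∧ (k == j))))
      ≡⟨ ∑-distrib-+ (λ k → f k ∧ w k) (λ k → t ∧ (f k ∧ (k == j))) ⟩
    sum (λ k → f k ∧ w k) xor sum (λ k → t ∧ (f k ∧ (k == j)))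
      ≡⟨ cong (sum (λ k → f k ∧ w k) xor_) (∧-sum t (λ k → f k ∧ (k == j))) ⟨
    sum (λ k → f k ∧ w k) xor (t ∧ sum (λ k → f k ∧ (k == j)))
      ≡⟨ cong (λ x → sum (λ k → f k ∧ w k) xor (t ∧ x)) (sum-select f j) ⟩
    sum (λ k → f k ∧ w k) xor (t ∧ f j)
      ≡⟨ cong (sum (λ k → f k ∧ w k) xor_) (Bool.∧-comm t (f j)) ⟩
    sum (λ k → f k ∧ w k) xor (f j ∧ t) ∎
    where open ≡-Reasoning

  update-involutive : ∀ {n} (w : Vector Bool n) j {t t′} → t ≡ t′ → ∀ k →
                      (w k xor ((k == j) ∧ t)) xor ((k == j) ∧ t′) ≡ w k
  update-involutive w j {t} refl k =
    solve₂ 3 (λ w d t → (w ⊹ d ⊛ t) ⊹ d ⊛ t ⊜ w) refl (w k) (k == j) t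

  private
    xor-falseˡ : ∀ {x y} → x ≡ false → x xor y ≡ false → y ≡ false
    xor-falseˡ refl eq = eq

  -- A vertex j isolated from the rest can be added to special vertices, which
  -- changes X by multiples of R j.
  module _ {m s} {B : Matrix₂ m} {R : Fin m → Fin s → Bool} (j : Fin m)
           (row₀ : ∀ k → B j k ≡ false) (col₀ : ∀ k → B k j ≡ false) where

    isolated-equation : ∀ {X : Matrix₂ s} {v} → Kernel B R X v → sum (λ p → R j p ∧ proj₂ v p) ≡ false
    isolated-equation {v = v} u = xor-falseˡ (sum-false (λ k → cong (_∧ proj₁ v k) (row₀ k))) (rest u j)

    -- The row of `j` is the equation ∑ R j p · c p = 0. For such `c` the change from `X` to `X′`
    -- only has to be a multiple `τ c` of R j: the coordinate at `j`, which is absent from the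
    -- equations of the rest, takes it up.
    nullity-shift : {X X′ : Matrix₂ s} (τ : Vector Bool s → Bool) → (∀ {c c′} → c ≗ c′ → τ c ≡ τ c′) →
      (∀ c → sum (λ p → R j p ∧ c p) ≡ false →
         ∀ p → sum (λ q → X′ p q ∧ c q) ≡ sum (λ q → X p q ∧ c q) xor (R j p ∧ τ c)) →
      nullity B R X ≡ nullity B R X′
    nullity-shift {X} {X′} τ τ-cong X′≡ = nullity-involution
      (λ (w , c) → (λ k → w k xor ((k == j) ∧ τ c)) , c)
      (λ (eq , eq′) → (λ k → cong₂ (λ x t → x xor ((k == j) ∧ t)) (eq k) (τ-cong eq′)) , eq′)
      (λ (w , c) → update-involutive w j refl , λ _ → refl)
      (λ {(w , c)} u → kernel (rest-row u) (λ p → trans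
        (cong₂ _xor_ (sum-update (λ k → R k p) w j (τ c)) (X′≡ c (isolated-equation u) p))
        (trans (solve₂ 3 (λ x y t → (x ⊹ t) ⊹ (y ⊹ t) ⊜ x ⊹ y) refl (sum (λ k → R k p ∧ w k)) _ (R j p ∧ τ c)) (special u p))))
      (λ {(w , c)} u → kernel (rest-row u) (λ p → trans
        (cong₂ _xor_ (sum-update (λ k → R k p) w j (τ c)) refl)
        (trans (solve₂ 3 (λ x y t → (x ⊹ t) ⊹ y ⊜ x ⊹ (y ⊹ t)) refl (sum (λ k → R k p ∧ w k)) _ (R j p ∧ τ c))
               (trans (cong (sum (λ k → R k p ∧ w k) xor_) (sym (X′≡ c (isolated-equation u) p))) (special u p)))))
      where
      rest-row : ∀ {X w c} → Kernel B R X (w , c) → ∀ k →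
                 sum (λ i → B k i ∧ (w i xor ((i == j) ∧ τ c))) xor sum (λ p → R k p ∧ c p) ≡ false
      rest-row {w = w} {c} u k = trans (cong₂ _xor_ (trans (sum-update (B k) w j (τ c))
        (trans (cong (λ b → sum (λ i → B k i ∧ w i) xor (b ∧ τ c)) (col₀ k)) (Bool.xor-identityʳ (sum (λ i → B k i ∧ w i))))) refl) (rest u k)

  disconnected : ∀ {m} → Matrix₂ m
  disconnected _ _ = false

  module _ {m s} {R : Fin m → Fin s → Bool} {X : Matrix₂ s} where

    private
      disconnected-sum : ∀ (w : Vector Bool m) → sum (λ k → false ∧ w k) ≡ false
      disconnected-sum w = sum-false {f = λ k → false ∧ w k} (λ _ → refl)

    kernel₀ : ∀ {v} → (∀ k → sum (λ p → R k p ∧ proj₂ v p) ≡ false) →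
              (∀ p → sum (λ k → R k p ∧ proj₁ v k) xor sum (λ q → X p q ∧ proj₂ v q) ≡ false) →
              Kernel disconnected R X v
    kernel₀ {v} r = kernel (λ k → cong₂ _xor_ (disconnected-sum (proj₁ v)) (r k))

    rest₀ : ∀ {v} → Kernel disconnected R X v → ∀ k → sum (λ p → R k p ∧ proj₂ v p) ≡ false
    rest₀ {v} u k = xor-falseˡ (disconnected-sum (proj₁ v)) (rest u k)

  -- If vertex j is adjacent to every special vertex, the kernel lies over
  -- ∑ c = 0, so adding a common vector to all special rows does not matter.
  nullity-twist : ∀ {m s} {R : Fin m → Fin s → Bool} {X : Matrix₂ s} (j : Fin m) →
    (∀ p → R j p ≡ true) → (ζ : Fin m → Bool) → ζ j ≡ false →
    nullity disconnected R X ≡ nullity disconnected (λ k p → R k p xor ζ k) X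
  nullity-twist {m} {s} {R} {X} j Rj ζ ζj = nullity-involution
    (λ (w , c) → (λ k → w k xor ((k == j) ∧ τ w)) , c)
    (λ (eq , eq′) → (λ k → cong₂ (λ x t → x xor ((k == j) ∧ t)) (eq k) (τ-cong eq)) , eq′)
    (λ (w , c) → update-involutive w j (sym (τ-update w)) , λ _ → refl)
    (λ {(w , c)} u → let ∑c = trans (sum-cong-≗ (λ p → cong (_∧ c p) (sym (Rj p)))) (rest₀ u j) in kernel₀
      (λ k → trans (R′-sum k c ∑c) (rest₀ u k))
      (λ p → trans (cong₂ _xor_ (column p w) refl) (special u p)))
    (λ {(w , c)} u → let ∑c = trans (sum-cong-≗ (λ p → cong (_∧ c p) (sym (trans (cong₂ _xor_ (Rj p) ζj) refl))))
                                     (rest₀ u j) in kernel₀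
      (λ k → trans (sym (R′-sum k c ∑c)) (rest₀ u k))
      (λ p → trans (cong₂ _xor_ (trans (sum-update (λ k → R k p) w j (τ w)) (column′ p w)) refl) (special u p)))
    where
    τ : Vector Bool m → Bool
    τ w = sum (λ k → ζ k ∧ w k)
    τ-cong : ∀ {w w′} → w ≗ w′ → τ w ≡ τ w′
    τ-cong eq = sum-cong-≗ (λ k → cong (ζ k ∧_) (eq k))
    τ-update : ∀ w → τ (λ k → w k xor ((k == j) ∧ τ w)) ≡ τ w
    τ-update w = trans (sum-update ζ w j (τ w)) (trans (cong (λ b → τ w xor (b ∧ τ w)) ζj) (Bool.xor-identityʳ _))
    R′-sum : ∀ k c → sum c ≡ false → sum (λ p → (R k p xor ζ k) ∧ c p) ≡ sum (λ p → R k p ∧ c p)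
    R′-sum k c ∑c = begin
      sum (λ p → (R k p xor ζ k) ∧ c p)
        ≡⟨ sum-cong-≗ (λ p → cong (λ z → (R k p xor z) ∧ c p) (sym (Bool.∧-identityʳ (ζ k)))) ⟩
      sum (λ p → (R k p xor (ζ k ∧ true)) ∧ c p)       ≡⟨ xor-∧-sum (R k) (λ _ → true) c (ζ k) ⟩
      sum (λ p → R k p ∧ c p) xor (ζ k ∧ sum c)        ≡⟨ cong (λ z → sum (λ p → R k p ∧ c p) xor (ζ k ∧ z)) ∑c ⟩
      sum (λ p → R k p ∧ c p) xor (ζ k ∧ false)        ≡⟨ cong (sum (λ p → R k p ∧ c p) xor_) (Bool.∧-zeroʳ (ζ k)) ⟩
      sum (λ p → R k p ∧ c p) xor false                ≡⟨ Bool.xor-identityʳ _ ⟩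
      sum (λ p → R k p ∧ c p)                          ∎
      where open ≡-Reasoning
    split : ∀ p w → sum (λ k → (R k p xor ζ k) ∧ w k) ≡ sum (λ k → R k p ∧ w k) xor τ w
    split p w = xor-∧-sum (λ k → R k p) ζ w true
    column : ∀ p w → sum (λ k → (R k p xor ζ k) ∧ (w k xor ((k == j) ∧ τ w))) ≡ sum (λ k → R k p ∧ w k)
    column p w = begin
      sum (λ k → (R k p xor ζ k) ∧ (w k xor ((k == j) ∧ τ w)))
        ≡⟨ sum-update (λ k → R k p xor ζ k) w j (τ w) ⟩
      sum (λ k → (R k p xor ζ k) ∧ w k) xor ((R j p xor ζ j) ∧ τ w)
        ≡⟨ cong₂ _xor_ (split p w) (cong₂ (λ r z → (r xor z) ∧ τ w) (Rj p) ζj) ⟩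
      (sum (λ k → R k p ∧ w k) xor τ w) xor τ w
        ≡⟨ solve₂ 2 (λ x t → (x ⊹ t) ⊹ t ⊜ x) refl (sum (λ k → R k p ∧ w k)) (τ w) ⟩
      sum (λ k → R k p ∧ w k) ∎
      where open ≡-Reasoning
    column′ : ∀ p w → sum (λ k → R k p ∧ w k) xor (R j p ∧ τ w) ≡ sum (λ k → (R k p xor ζ k) ∧ w k)
    column′ p w = trans (cong (λ b → sum (λ k → R k p ∧ w k) xor (b ∧ τ w)) (Rj p)) (sym (split p w))

  -- Congruence by adding vertex 1 to vertex 0. The zero block of the rest is preserved, and on
  -- vectors the operation acts contragrediently: coordinate 0 is added to coordinate 1.
  nullity-add : ∀ {m s} {R : Fin (suc (suc m)) → Fin s → Bool} {X : Matrix₂ s} →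
    nullity disconnected R X ≡
    nullity disconnected (λ k p → R k p xor ((k == zero) ∧ R (suc zero) p)) X
  nullity-add {m} {s} {R} {X} = nullity-involution
    (λ (w , c) → (λ k → w k xor ((k == suc zero) ∧ w zero)) , c)
    (λ (eq , eq′) → (λ k → cong₂ (λ x t → x xor ((k == suc zero) ∧ t)) (eq k) (eq zero)) , eq′)
    (λ (w , c) → update-involutive w (suc zero) (sym (Bool.xor-identityʳ (w zero))) , λ _ → refl)
    (λ {(w , c)} u → kernel₀
      (λ k → (trans (R′-sum k c) (trans (cong₂ (λ x y → x xor ((k == zero) ∧ y)) (rest₀ u k) (rest₀ u (suc zero))) (Bool.∧-zeroʳ (k == zero)))))
      (λ p → trans (cong₂ _xor_ (column p w) refl) (special u p)))
    (λ {(w , c)} u → let second = trans (sym (trans (R′-sum (suc zero) c) (Bool.xor-identityʳ _))) (rest₀ u (suc zero)) in kernel₀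
      (λ k → (trans (sym (trans (R′-sum k c)
         (trans (cong (λ y → sum (λ p → R k p ∧ c p) xor ((k == zero) ∧ y)) second)
                (trans (cong (sum (λ p → R k p ∧ c p) xor_) (Bool.∧-zeroʳ (k == zero))) (Bool.xor-identityʳ _))))) (rest₀ u k)))
      (λ p → trans (cong₂ _xor_ (trans (sum-update (λ k → R k p) w (suc zero) (w zero)) (sym (split p w))) refl) (special u p)))
    where
    R′-sum : ∀ k c → sum (λ p → (R k p xor ((k == zero) ∧ R (suc zero) p)) ∧ c p) ≡
                     sum (λ p → R k p ∧ c p) xor ((k == zero) ∧ sum (λ p → R (suc zero) p ∧ c p))
    R′-sum k c = xor-∧-sum (R k) (R (suc zero)) c (k == zero)
    split : ∀ p w → sum (λ k → (R k p xor ((k == zero) ∧ R (suc zero) p)) ∧ w k) ≡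
                    sum (λ k → R k p ∧ w k) xor (R (suc zero) p ∧ w zero)
    split p w = begin
      sum (λ k → (R k p xor ((k == zero) ∧ R (suc zero) p)) ∧ w k)
        ≡⟨ sum-cong-≗ (λ k → Bool.∧-comm (R k p xor ((k == zero) ∧ R (suc zero) p)) (w k)) ⟩
      sum (λ k → w k ∧ (R k p xor ((k == zero) ∧ R (suc zero) p)))
        ≡⟨ sum-update w (λ k → R k p) zero (R (suc zero) p) ⟩
      sum (λ k → w k ∧ R k p) xor (w zero ∧ R (suc zero) p)
        ≡⟨ cong₂ _xor_ (sum-cong-≗ (λ k → Bool.∧-comm (w k) (R k p))) (Bool.∧-comm (w zero) _) ⟩
      sum (λ k → R k p ∧ w k) xor (R (suc zero) p ∧ w zero) ∎
      where open ≡-Reasoning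
    column : ∀ p w → sum (λ k → (R k p xor ((k == zero) ∧ R (suc zero) p)) ∧ (w k xor ((k == suc zero) ∧ w zero))) ≡
                     sum (λ k → R k p ∧ w k)
    column p w = begin
      sum (λ k → (R k p xor ((k == zero) ∧ R (suc zero) p)) ∧ (w k xor ((k == suc zero) ∧ w zero)))
        ≡⟨ sum-update (λ k → R k p xor ((k == zero) ∧ R (suc zero) p)) w (suc zero) (w zero) ⟩
      sum (λ k → (R k p xor ((k == zero) ∧ R (suc zero) p)) ∧ w k) xor ((R (suc zero) p xor false) ∧ w zero)
        ≡⟨ cong (_xor ((R (suc zero) p xor false) ∧ w zero)) (split p w) ⟩
      (sum (λ k → R k p ∧ w k) xor (R (suc zero) p ∧ w zero)) xor ((R (suc zero) p xor false) ∧ w zero)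
        ≡⟨ solve₂ 3 (λ x r w → (x ⊹ r ⊛ w) ⊹ (r ⊹ con₂ false) ⊛ w ⊜ x) refl (sum (λ k → R k p ∧ w k)) (R (suc zero) p) (w zero) ⟩
      sum (λ k → R k p ∧ w k) ∎
      where open ≡-Reasoning

  -- Coranks of bordered matrices

  ↑-elim : ∀ {ℓ s m} (P : Fin (s + m) → Set ℓ) → (∀ p → P (p ↑ˡ m)) → (∀ j → P (s ↑ʳ j)) → ∀ i → P i
  ↑-elim {s = s} {m} P l r i with splitAt s i | Fin.join-splitAt s m i
  ... | inj₁ p | refl = l p
  ... | inj₂ j | refl = r j

  cork-cong : ∀ {n} {A A′ : Matrix₂ n} → (∀ i j → A i j ≡ A′ i j) → cork A ≡ cork A′
  cork-cong {n} {A} {A′} A≗ = cork-iso {A = A} {A′} record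
    { to = λ v → v ; from = λ v → v ; to-cong = λ eq → eq ; from-cong = λ eq → eq
    ; to-∈ = λ {v} u i → trans (sum-cong-≗ (λ j → cong (_∧ v j) (sym (A≗ i j)))) (u i)
    ; from-∈ = λ {v} u i → trans (sum-cong-≗ (λ j → cong (_∧ v j) (A≗ i j))) (u i)
    ; to-from = λ _ _ → refl ; from-to = λ _ _ → refl }

  cork-permute : ∀ {m n} (A : Matrix₂ m) (A′ : Matrix₂ n) (π : Permutation m n) →
                 (∀ i j → A i j ≡ A′ (π ⟨$⟩ʳ i) (π ⟨$⟩ʳ j)) → cork A ≡ cork A′
  cork-permute A A′ π A≗ = cork-iso {A = A} {A′} record
    { to = λ v → v ∘ (π ⟨$⟩ˡ_) ; from = λ v → v ∘ (π ⟨$⟩ʳ_)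
    ; to-cong = λ eq i → eq (π ⟨$⟩ˡ i) ; from-cong = λ eq i → eq (π ⟨$⟩ʳ i)
    ; to-∈ = λ {v} u i → trans (sum-permute (λ j → A′ i j ∧ v (π ⟨$⟩ˡ j)) π) (trans
        (sum-cong-≗ (λ j → cong₂ _∧_ (trans (cong (λ x → A′ x (π ⟨$⟩ʳ j)) (sym (inverseʳ π))) (sym (A≗ (π ⟨$⟩ˡ i) j)))
                                     (cong v (inverseˡ π))))
        (u (π ⟨$⟩ˡ i)))
    ; from-∈ = λ {v} u i → trans (sum-cong-≗ (λ j → cong (_∧ v (π ⟨$⟩ʳ j)) (A≗ i j)))
        (trans (sym (sum-permute (λ j → A′ (π ⟨$⟩ʳ i) j ∧ v j) π)) (u (π ⟨$⟩ʳ i)))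
    ; to-from = λ {v} _ i → cong v (inverseʳ π) ; from-to = λ {v} _ i → cong v (inverseˡ π) }

  module _ {s m} {A : Matrix₂ (s + m)} {B : Matrix₂ m} {R : Fin m → Fin s → Bool} {X : Matrix₂ s}
           (A-rest : ∀ j k → A (s ↑ʳ j) (s ↑ʳ k) ≡ B j k) (A-mixed : ∀ j p → A (s ↑ʳ j) (p ↑ˡ m) ≡ R j p)
           (A-mixed′ : ∀ j p → A (p ↑ˡ m) (s ↑ʳ j) ≡ R j p) (A-special : ∀ p q → A (p ↑ˡ m) (q ↑ˡ m) ≡ X p q) where

    cork≡nullity : cork A ≡ nullity B R X
    cork≡nullity = dim-unique (dim-iso record
      { to        = λ v → (v ∘ (s ↑ʳ_)) , (v ∘ (_↑ˡ m))
      ; from      = joined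
      ; to-cong   = λ eq → (eq ∘ (s ↑ʳ_)) , (eq ∘ (_↑ˡ m))
      ; from-cong = λ {(w , c)} {(w′ , c′)} (eq , eq′) → ↑-elim _
          (λ p → trans (joined-special (w , c) p) (trans (eq′ p) (sym (joined-special (w′ , c′) p))))
          (λ j → trans (joined-rest (w , c) j) (trans (eq j) (sym (joined-rest (w′ , c′) j))))
      ; to-∈      = λ {v} u → kernel
          (λ j → trans (sym (rest-row v j)) (u (s ↑ʳ j)))
          (λ p → trans (sym (special-row v p)) (u (p ↑ˡ m)))
      ; from-∈    = λ {v} u → ↑-elim _
          (λ p → trans (special-row (joined v) p) (trans (cong₂ _xor_
            (sum-cong-≗ (λ k → cong (R k p ∧_) (joined-rest v k)))
            (sum-cong-≗ (λ q → cong (X p q ∧_) (joined-special v q)))) (special u p)))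
          (λ j → trans (rest-row (joined v) j) (trans (cong₂ _xor_
            (sum-cong-≗ (λ k → cong (B j k ∧_) (joined-rest v k)))
            (sum-cong-≗ (λ q → cong (R j q ∧_) (joined-special v q)))) (rest u j)))
      ; to-from   = λ {v} _ → joined-rest v , joined-special v
      ; from-to   = λ {v} _ → ↑-elim _
          (joined-special ((v ∘ (s ↑ʳ_)) , (v ∘ (_↑ˡ m)))) (joined-rest ((v ∘ (s ↑ʳ_)) , (v ∘ (_↑ˡ m))))
      } (dim-kernel A)) dim-Kernel
      where
      joined : Vector Bool m × Vector Bool s → Vector Bool (s + m)
      joined (w , c) i = [ c , w ]′ (splitAt s i)
      joined-special : ∀ v p → joined v (p ↑ˡ m) ≡ proj₂ v p
      joined-special (w , c) p = cong [ c , w ]′ (Fin.splitAt-↑ˡ s p m)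
      joined-rest : ∀ v j → joined v (s ↑ʳ j) ≡ proj₁ v j
      joined-rest (w , c) j = cong [ c , w ]′ (Fin.splitAt-↑ʳ s m j)
      rest-row : ∀ (v : Vector Bool (s + m)) j → sum (λ i → A (s ↑ʳ j) i ∧ v i) ≡
                 sum (λ k → B j k ∧ v (s ↑ʳ k)) xor sum (λ p → R j p ∧ v (p ↑ˡ m))
      rest-row v j = trans (sum-↑ s _) (trans (Bool.xor-comm (sum (λ p → A (s ↑ʳ j) (p ↑ˡ m) ∧ v (p ↑ˡ m))) _) (cong₂ _xor_
        (sum-cong-≗ (λ k → cong (_∧ v (s ↑ʳ k)) (A-rest j k)))
        (sum-cong-≗ (λ p → cong (_∧ v (p ↑ˡ m)) (A-mixed j p)))))
      special-row : ∀ (v : Vector Bool (s + m)) p → sum (λ i → A (p ↑ˡ m) i ∧ v i) ≡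
                    sum (λ k → R k p ∧ v (s ↑ʳ k)) xor sum (λ q → X p q ∧ v (q ↑ˡ m))
      special-row v p = trans (sum-↑ s _) (trans (Bool.xor-comm (sum (λ q → A (p ↑ˡ m) (q ↑ˡ m) ∧ v (q ↑ˡ m))) _) (cong₂ _xor_
        (sum-cong-≗ (λ k → cong (_∧ v (s ↑ʳ k)) (A-mixed′ k p)))
        (sum-cong-≗ (λ q → cong (_∧ v (q ↑ˡ m)) (A-special p q)))))

  bordered : ∀ {n} → Bool → Vector Bool n → Matrix₂ n → Matrix₂ (suc n)
  bordered α r A zero    zero    = α
  bordered α r A zero    (suc j) = r j
  bordered α r A (suc i) zero    = r i
  bordered α r A (suc i) (suc j) = A i j

  bordered-cong : ∀ {n α} {r r′ : Vector Bool n} {A A′ : Matrix₂ n} → r ≗ r′ → (∀ i j → A i j ≡ A′ i j) →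
                  ∀ i j → bordered α r A i j ≡ bordered α r′ A′ i j
  bordered-cong r≗ A≗ zero    zero    = refl
  bordered-cong r≗ A≗ zero    (suc j) = r≗ j
  bordered-cong r≗ A≗ (suc i) zero    = r≗ i
  bordered-cong r≗ A≗ (suc i) (suc j) = A≗ i j

  noR : ∀ {n} → Fin n → Fin 0 → Bool
  noR _ ()

  noX : Matrix₂ 0
  noX ()

  cork-nullity₀ : ∀ {n} (A : Matrix₂ n) → cork A ≡ nullity A noR noX
  cork-nullity₀ A = cork≡nullity {0} {A = A} {A} {noR} {noX} (λ _ _ → refl) (λ _ ()) (λ _ ()) (λ ())

  cork-pivot : ∀ {n} (r : Vector Bool n) (A : Matrix₂ n) →
               cork (bordered true r A) ≡ cork (λ i j → A i j xor (r i ∧ r j))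
  cork-pivot r A = begin
    cork (bordered true r A)
      ≡⟨ cork-nullity₀ (bordered true r A) ⟩
    nullity (bordered true r A) noR noX
      ≡⟨ nullity-pivot (bordered true r A) noR noX zero refl (λ { zero → refl ; (suc j) → refl }) ⟩
    nullity A′ _ _
      ≡⟨ nullity-cong {B = A′} {A′} (λ _ _ → refl) (λ _ ()) (λ ()) ⟩
    nullity A′ noR noX
      ≡⟨ cork-nullity₀ A′ ⟨
    cork A′ ∎
    where
    open ≡-Reasoning
    A′ = λ i j → A i j xor (r i ∧ r j)

  cork-isolated : ∀ {n} (r : Vector Bool n) (A : Matrix₂ n) → (∀ i → r i ≡ false) → cork (bordered false r A) ≡ suc (cork A)
  cork-isolated r A r₀ = begin
    cork (bordered false r A)
      ≡⟨ cork-nullity₀ (bordered false r A) ⟩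
    nullity (bordered false r A) noR noX
      ≡⟨ nullity-zero (bordered false r A) noR noX zero (λ { zero → refl ; (suc i) → r₀ i }) (λ { zero → refl ; (suc i) → r₀ i }) (λ ()) ⟩
    suc (nullity A _ noX)
      ≡⟨ cong suc (nullity-cong {B = A} {A} (λ _ _ → refl) (λ _ ()) (λ ())) ⟩
    suc (nullity A noR noX)
      ≡⟨ cong suc (cork-nullity₀ A) ⟨
    suc (cork A) ∎
    where open ≡-Reasoning

  -- The row of the leaf kills the coordinate of its neighbour, and the row of the neighbour then
  -- determines the coordinate of the leaf, for either framing β.
  cork-leaf : ∀ {n} β (r y : Vector Bool n) (A : Matrix₂ n) → (∀ i → r i ≡ false) →
              cork (bordered false (true ∷ᶠ r) (bordered β y A)) ≡ cork A
  cork-leaf {n} β r y A r₀ = cork-iso {A = bordered false (true ∷ᶠ r) (bordered β y A)} {A} record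
    { to        = λ v k → v (suc (suc k))
    ; from      = λ w → sum (λ k → y k ∧ w k) ∷ᶠ false ∷ᶠ w
    ; to-cong   = λ eq k → eq (suc (suc k))
    ; from-cong = λ eq → λ { zero → sum-cong-≗ (λ k → cong (y k ∧_) (eq k)) ; (suc zero) → refl ; (suc (suc k)) → eq k }
    ; to-∈      = λ {v} u i → trans (sym (trans (cong₂ (λ a b → (a ∧ v zero) xor ((y i ∧ b) xor sum (λ k → A i k ∧ v (suc (suc k))))) (r₀ i) (second {v} u))
        (cong (_xor sum (λ k → A i k ∧ v (suc (suc k)))) (Bool.∧-zeroʳ (y i))))) (u (suc (suc i)))
    ; from-∈    = λ {w} u → λ
        { zero → sum-false {f = λ k → r k ∧ w k} (λ k → cong (_∧ w k) (r₀ k))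
        ; (suc zero) → trans (cong (λ b → sum (λ k → y k ∧ w k) xor (b xor sum (λ k → y k ∧ w k))) (Bool.∧-zeroʳ β))
                             (Bool.xor-same (sum (λ k → y k ∧ w k)))
        ; (suc (suc i)) → trans (cong₂ (λ a b → (a ∧ sum (λ k → y k ∧ w k)) xor (b xor sum (λ k → A i k ∧ w k))) (r₀ i) (Bool.∧-zeroʳ (y i))) (u i) }
    ; to-from   = λ _ _ → refl
    ; from-to   = λ {v} u → λ
        { zero → sym (first {v} u) ; (suc zero) → sym (second {v} u) ; (suc (suc k)) → refl }
    }
    where
    second : ∀ {v} → InKernel (bordered false (true ∷ᶠ r) (bordered β y A)) v → v (suc zero) ≡ false
    second {v} u = trans (sym (trans (cong (v (suc zero) xor_) (sum-false {f = λ k → r k ∧ v (suc (suc k))} (λ k → cong (_∧ v (suc (suc k))) (r₀ k))))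
                               (Bool.xor-identityʳ _))) (u zero)
    first : ∀ {v} → InKernel (bordered false (true ∷ᶠ r) (bordered β y A)) v → v zero ≡ sum (λ k → y k ∧ v (suc (suc k)))
    first {v} u = xor≡false⇒≡ (trans (cong (v zero xor_) (sym (trans (cong (λ b → (β ∧ b) xor sum (λ k → y k ∧ v (suc (suc k)))) (second {v} u))
                                     (cong (_xor sum (λ k → y k ∧ v (suc (suc k)))) (Bool.∧-zeroʳ β))))) (u (suc zero)))

  -- Congruence by adding the second vertex to the first. The new framing is α + 2ε + β, in which ε
  -- cancels, and the new adjacency of the two is ε + β.
  cork-add : ∀ {n} α ε β (x y : Vector Bool n) (A : Matrix₂ n) →
             cork (bordered α (ε ∷ᶠ x) (bordered β y A)) ≡
             cork (bordered (α xor β) ((ε xor β) ∷ᶠ (λ k → x k xor y k)) (bordered β y A))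
  cork-add α ε β x y A = cork-iso
    {A = bordered α (ε ∷ᶠ x) (bordered β y A)} {bordered (α xor β) ((ε xor β) ∷ᶠ (λ k → x k xor y k)) (bordered β y A)} record
    { to        = f
    ; from      = f
    ; to-cong   = f-cong
    ; from-cong = f-cong
    ; to-∈      = λ {v} u → λ
        { zero → trans (cong (λ z → ((α xor β) ∧ v zero) xor (((ε xor β) ∧ (v (suc zero) xor v zero)) xor z)) (xor-sum v))
            (trans (solve₂ 7 (λ a b e p q s t → (a ⊹ b) ⊛ p ⊹ ((e ⊹ b) ⊛ (q ⊹ p) ⊹ (s ⊹ t)) ⊜ (a ⊛ p ⊹ (e ⊛ q ⊹ s)) ⊹ (e ⊛ p ⊹ (b ⊛ q ⊹ t)))
                      refl α β ε (v zero) (v (suc zero)) _ _)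
                   (cong₂ _xor_ (u zero) (u (suc zero))))
        ; (suc zero) → trans (solve₂ 5 (λ b e p q t → (e ⊹ b) ⊛ p ⊹ (b ⊛ (q ⊹ p) ⊹ t) ⊜ e ⊛ p ⊹ (b ⊛ q ⊹ t)) refl β ε (v zero) (v (suc zero)) _) (u (suc zero))
        ; (suc (suc k)) → trans (solve₂ 5 (λ x y p q t → (x ⊹ y) ⊛ p ⊹ (y ⊛ (q ⊹ p) ⊹ t) ⊜ x ⊛ p ⊹ (y ⊛ q ⊹ t)) refl (x k) (y k) (v zero) (v (suc zero)) _) (u (suc (suc k))) }
    ; from-∈    = λ {v} u → λ
        { zero → trans (solve₂ 7 (λ a b e p q s t → a ⊛ p ⊹ (e ⊛ (q ⊹ p) ⊹ s) ⊜ ((a ⊹ b) ⊛ p ⊹ ((e ⊹ b) ⊛ q ⊹ (s ⊹ t))) ⊹ ((e ⊹ b) ⊛ p ⊹ (b ⊛ q ⊹ t)))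
                      refl α β ε (v zero) (v (suc zero)) _ (sum (λ k → y k ∧ v (suc (suc k)))))
                   (cong₂ _xor_ (trans (cong (λ z → ((α xor β) ∧ v zero) xor (((ε xor β) ∧ v (suc zero)) xor z)) (sym (xor-sum v))) (u zero)) (u (suc zero)))
        ; (suc zero) → trans (solve₂ 5 (λ b e p q t → e ⊛ p ⊹ (b ⊛ (q ⊹ p) ⊹ t) ⊜ (e ⊹ b) ⊛ p ⊹ (b ⊛ q ⊹ t)) refl β ε (v zero) (v (suc zero)) _) (u (suc zero))
        ; (suc (suc k)) → trans (solve₂ 5 (λ x y p q t → x ⊛ p ⊹ (y ⊛ (q ⊹ p) ⊹ t) ⊜ (x ⊹ y) ⊛ p ⊹ (y ⊛ q ⊹ t)) refl (x k) (y k) (v zero) (v (suc zero)) _) (u (suc (suc k))) }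
    ; to-from   = λ {v} _ → f-f v
    ; from-to   = λ {v} _ → f-f v
    }
    where
    f : Vector Bool _ → Vector Bool _
    f v zero          = v zero
    f v (suc zero)    = v (suc zero) xor v zero
    f v (suc (suc k)) = v (suc (suc k))
    f-cong : ∀ {v w} → v ≗ w → f v ≗ f w
    f-cong eq zero          = eq zero
    f-cong eq (suc zero)    = cong₂ _xor_ (eq (suc zero)) (eq zero)
    f-cong eq (suc (suc k)) = eq (suc (suc k))
    f-f : ∀ v → f (f v) ≗ v
    f-f v zero          = refl
    f-f v (suc zero)    = solve₂ 2 (λ a b → (a ⊹ b) ⊹ b ⊜ a) refl (v (suc zero)) (v zero)
    f-f v (suc (suc k)) = refl
    xor-sum : ∀ (v : Vector Bool _) → sum (λ k → (x k xor y k) ∧ v (suc (suc k))) ≡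
              sum (λ k → x k ∧ v (suc (suc k))) xor sum (λ k → y k ∧ v (suc (suc k)))
    xor-sum v = xor-∧-sum x y (λ k → v (suc (suc k))) true

  -- Alternating sums over framings

  opaque
    Δ : (Bool → ℤ) → ℤ
    Δ f = f false - f true

    Δ-def : ∀ f → Δ f ≡ f false - f true
    Δ-def f = refl

    Δ-cong : ∀ {f g : Bool → ℤ} → f ≗ g → Δ f ≡ Δ g
    Δ-cong eq = cong₂ _-_ (eq false) (eq true)

    Δ-- : ∀ (f g : Bool → ℤ) → Δ f - Δ g ≡ Δ (λ α → f α - g α)
    Δ-- f g = solve 4 (λ a b c d → (a :- b) :- (c :- d) := (a :- c) :- (b :- d)) refl (f false) (f true) (g false) (g true)

    Δ-* : ∀ c (f : Bool → ℤ) → c *ℤ Δ f ≡ Δ (λ α → c *ℤ f α)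
    Δ-* c f = solve 3 (λ c a b → c :* (a :- b) := c :* a :- c :* b) refl c (f false) (f true)

    Δ-comm : ∀ (f : Bool → Bool → ℤ) → Δ (λ α → Δ (f α)) ≡ Δ (λ β → Δ (λ α → f α β))
    Δ-comm f = solve 4 (λ a b c d → (a :- b) :- (c :- d) := (a :- c) :- (b :- d)) refl
      (f false false) (f false true) (f true false) (f true true)

  Δ-def² : ∀ (f : Bool → Bool → ℤ) → Δ (λ α → Δ (f α)) ≡ (f false false - f false true) - (f true false - f true true)
  Δ-def² f = trans (Δ-def _) (cong₂ _-_ (Δ-def (f false)) (Δ-def (f true)))

  ∑± : ∀ n → (Subset n → ℤ) → ℤ
  ∑± zero    f = f []
  ∑± (suc n) f = Δ (λ α → ∑± n (f ∘ (α ∷_)))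

  ∑±-cong : ∀ n {f g : Subset n → ℤ} → f ≗ g → ∑± n f ≡ ∑± n g
  ∑±-cong zero    eq = eq []
  ∑±-cong (suc n) eq = Δ-cong (λ α → ∑±-cong n (eq ∘ (α ∷_)))

  ∑±-- : ∀ n (f g : Subset n → ℤ) → ∑± n f - ∑± n g ≡ ∑± n (λ V → f V - g V)
  ∑±-- zero    f g = refl
  ∑±-- (suc n) f g = trans (Δ-- _ _) (Δ-cong (λ α → ∑±-- n (f ∘ (α ∷_)) (g ∘ (α ∷_))))

  ∑±-* : ∀ n c (f : Subset n → ℤ) → c *ℤ ∑± n f ≡ ∑± n (λ V → c *ℤ f V)
  ∑±-* zero    c f = refl
  ∑±-* (suc n) c f = trans (Δ-* c _) (Δ-cong (λ α → ∑±-* n c (f ∘ (α ∷_))))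

  Δ-∑± : ∀ n (f : Bool → Subset n → ℤ) → Δ (λ α → ∑± n (f α)) ≡ ∑± n (λ V → Δ (λ α → f α V))
  Δ-∑± n f = trans (Δ-def _) (trans (∑±-- n (f false) (f true)) (∑±-cong n (λ V → sym (Δ-def (λ α → f α V)))))

  ∑±-insertAt : ∀ n (f : Subset (suc n) → ℤ) j → ∑± (suc n) f ≡ Δ (λ α → ∑± n (λ V → f (insertAt V j α)))
  ∑±-insertAt n       f zero    = refl
  ∑±-insertAt (suc n) f (suc j) = trans
    (Δ-cong (λ α → ∑±-insertAt n (f ∘ (α ∷_)) j))
    (Δ-comm (λ α β → ∑± n (λ V → f (α ∷ insertAt V j β))))

  ∑±-permute : ∀ {m n} (π : Permutation m n) {f : Subset m → ℤ} {g : Subset n → ℤ} →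
               (∀ V W → (∀ i → lookup V i ≡ lookup W (π ⟨$⟩ʳ i)) → f V ≡ g W) → ∑± m f ≡ ∑± n g
  ∑±-permute {zero}  {zero}  π eq = eq [] [] (λ ())
  ∑±-permute {zero}  {suc n} π eq = contradiction π (Perm.refute λ ())
  ∑±-permute {suc m} {zero}  π eq = contradiction π (Perm.refute λ ())
  ∑±-permute {suc m} {suc n} π {f} {g} eq = trans
    (Δ-cong (λ α → ∑±-permute (Perm.remove zero π) {f ∘ (α ∷_)} {λ W → g (insertAt W j α)}
      (λ V W V≗W → eq (α ∷ V) (insertAt W j α) (λ
        { zero    → sym (insertAt-lookup W j α)
        ; (suc i) → trans (V≗W i) (trans (sym (insertAt-punchIn W j α _))
                      (cong (lookup (insertAt W j α)) (sym (Perm.punchIn-permute π zero i)))) }))))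
    (sym (∑±-insertAt n g j))
    where j = π ⟨$⟩ʳ zero

  3^_ : ℕ → ℤ
  3^ d = + (3 ^ d)

  3^-suc : ∀ d → 3^ suc d ≡ + 3 *ℤ 3^ d
  3^-suc d = ℤ.pos-* 3 (3 ^ d)

  framed : ∀ {n} → Matrix₂ n → Subset n → Matrix₂ n
  framed A V i j = if i == j then lookup V i else A i j

  -- 2ⁿ ψ of the graph with adjacency matrix A; the diagonal of A is ignored.
  opaque
    Ψ : ∀ {n} → Matrix₂ n → ℤ
    Ψ {n} A = ∑± n (λ V → 3^ cork (framed A V))

  framed-permute : ∀ {m n} (A : Matrix₂ m) (A′ : Matrix₂ n) (π : Permutation m n) →
    (∀ i j → i ≢ j → A i j ≡ A′ (π ⟨$⟩ʳ i) (π ⟨$⟩ʳ j)) →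
    ∀ V W → (∀ i → lookup V i ≡ lookup W (π ⟨$⟩ʳ i)) →
    ∀ i j → framed A V i j ≡ framed A′ W (π ⟨$⟩ʳ i) (π ⟨$⟩ʳ j)
  framed-permute A A′ π A≗ V W V≗W i j with i Fin.≟ j
  ... | yes refl = trans (V≗W i) (cong (λ b → if b then lookup W (π ⟨$⟩ʳ i) else A′ (π ⟨$⟩ʳ i) (π ⟨$⟩ʳ i)) (sym (==-refl (π ⟨$⟩ʳ i))))
  ... | no i≢j   = trans (A≗ i j i≢j) (cong (λ b → if b then lookup W (π ⟨$⟩ʳ i) else A′ (π ⟨$⟩ʳ i) (π ⟨$⟩ʳ j))
                     (sym (==-false (λ eq → i≢j (trans (sym (inverseˡ π)) (trans (cong (π ⟨$⟩ˡ_) eq) (inverseˡ π)))))))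

  opaque
    unfolding Ψ

    Ψ-permute : ∀ {m n} {A : Matrix₂ m} {A′ : Matrix₂ n} (π : Permutation m n) →
                (∀ i j → i ≢ j → A i j ≡ A′ (π ⟨$⟩ʳ i) (π ⟨$⟩ʳ j)) → Ψ A ≡ Ψ A′
    Ψ-permute {A = A} {A′} π A≗ = ∑±-permute π (λ V W V≗W →
      cong 3^_ (cork-permute (framed A V) (framed A′ W) π (framed-permute A A′ π A≗ V W V≗W)))

  Ψ-cong : ∀ {n} {A A′ : Matrix₂ n} → (∀ i j → i ≢ j → A i j ≡ A′ i j) → Ψ A ≡ Ψ A′
  Ψ-cong = Ψ-permute Perm.id

  framed-bordered : ∀ {n} b (r : Vector Bool n) A α V i j →
                    framed (bordered b r A) (α ∷ V) i j ≡ bordered α r (framed A V) i j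
  framed-bordered b r A α V zero    zero    = refl
  framed-bordered b r A α V zero    (suc j) = refl
  framed-bordered b r A α V (suc i) zero    = refl
  framed-bordered b r A α V (suc i) (suc j) = refl

  border : ∀ {n} → Vector Bool n → Matrix₂ n → Matrix₂ (suc n)
  border = bordered false

  opaque
    unfolding Ψ

    Ψ-border : ∀ {n} (r : Vector Bool n) A →
               Ψ (border r A) ≡ ∑± n (λ V → Δ λ α → 3^ cork (bordered α r (framed A V)))
    Ψ-border {n} r A = trans
      (Δ-cong (λ α → ∑±-cong n (λ V → cong 3^_ (cork-cong (framed-bordered false r A α V)))))
      (Δ-∑± n (λ α V → 3^ cork (bordered α r (framed A V))))

  Ψ-border² : ∀ {n} (x : Vector Bool (suc n)) y A →
              Ψ (border x (border y A)) ≡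
              ∑± n (λ V → Δ λ α → Δ λ β → 3^ cork (bordered α x (bordered β y (framed A V))))
  Ψ-border² {n} x y A = trans (Ψ-border x (border y A)) (trans
    (Δ-cong (λ β → ∑±-cong n (λ V → Δ-cong (λ α → cong 3^_ (cork-cong
      (bordered-cong {α = α} {r = x} {x} (λ _ → refl) (framed-bordered false y A β V)))))))
    (trans (Δ-∑± n (λ β V → Δ λ α → f V α β)) (∑±-cong n (λ V → Δ-comm (λ β α → f V α β)))))
    where
    f : Subset n → Bool → Bool → ℤ
    f V α β = 3^ cork (bordered α x (bordered β y (framed A V)))

  opaque
    unfolding Ψ

    -- An isolated vertex raises the corank by 1 under framing 0 and leaves it unchanged under
    -- framing 1, so its two framings contribute 3 - 1 = 2.
    Ψ-isolated : ∀ {n} (r : Vector Bool n) A → (∀ i → r i ≡ false) → Ψ (border r A) ≡ + 2 *ℤ Ψ A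
    Ψ-isolated {n} r A r₀ = trans (Ψ-border r A) (trans (∑±-cong n local) (sym (∑±-* n (+ 2) _)))
      where
      pivot : ∀ V → cork (bordered true r (framed A V)) ≡ cork (framed A V)
      pivot V = trans (cork-pivot r (framed A V)) (cork-cong λ i j →
        trans (cong (λ b → framed A V i j xor (b ∧ r j)) (r₀ i)) (Bool.xor-identityʳ _))
      local : ∀ V → Δ (λ α → 3^ cork (bordered α r (framed A V))) ≡ + 2 *ℤ 3^ cork (framed A V)
      local V = begin
        Δ (λ α → 3^ cork (bordered α r (framed A V)))
          ≡⟨ Δ-def _ ⟩
        3^ cork (bordered false r (framed A V)) - 3^ cork (bordered true r (framed A V))
          ≡⟨ cong₂ _-_ (trans (cong 3^_ (cork-isolated r (framed A V) r₀)) (3^-suc (cork (framed A V)))) (cong 3^_ (pivot V)) ⟩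
        + 3 *ℤ 3^ cork (framed A V) - 3^ cork (framed A V)
          ≡⟨ solve 1 (λ a → con (+ 3) :* a :- a := con (+ 2) :* a) refl (3^ cork (framed A V)) ⟩
        + 2 *ℤ 3^ cork (framed A V) ∎
        where open ≡-Reasoning

  -- Under framing 0 of the leaf the corank is the same for both framings of its neighbour, and the
  -- two terms cancel. Under framing 1 the pivot toggles the framing of the neighbour; the resulting
  -- sign cancels the sign that belongs to framing 1.
  Ψ-leaf : ∀ {n} (r y : Vector Bool n) A → (∀ i → r i ≡ false) →
           Ψ (border (true ∷ᶠ r) (border y A)) ≡ Ψ (border y A)
  Ψ-leaf {n} r y A r₀ = trans (Ψ-border² (true ∷ᶠ r) y A) (trans (∑±-cong n (λ V → trans (trans (Δ-def² _)
    (cong₂ _-_ (cong₂ _-_ (leaf V false) (leaf V true)) (cong₂ _-_ (pivot V false) (pivot V true))))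
    (trans (solve 3 (λ a b c → (a :- a) :- (b :- c) := c :- b) refl (3^ cork (framed A V)) (f V true) (f V false)) (sym (Δ-def (f V))))))
    (sym (Ψ-border y A)))
    where
    f : Subset n → Bool → ℤ
    f V β = 3^ cork (bordered β y (framed A V))
    leaf : ∀ V β → 3^ cork (bordered false (true ∷ᶠ r) (bordered β y (framed A V))) ≡ 3^ cork (framed A V)
    leaf V β = cong 3^_ (cork-leaf β r y (framed A V) r₀)
    pivot : ∀ V β → 3^ cork (bordered true (true ∷ᶠ r) (bordered β y (framed A V))) ≡ f V (not β)
    pivot V β = cong 3^_ (trans (cork-pivot (true ∷ᶠ r) (bordered β y (framed A V))) (cork-cong λ
      { zero    zero    → Bool.xor-comm β true
      ; zero    (suc j) → trans (cong (y j xor_) (r₀ j)) (Bool.xor-identityʳ (y j))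
      ; (suc i) zero    → trans (cong (λ b → y i xor (b ∧ true)) (r₀ i)) (Bool.xor-identityʳ (y i))
      ; (suc i) (suc j) → trans (cong (λ b → framed A V i j xor (b ∧ r j)) (r₀ i)) (Bool.xor-identityʳ _) }))

  -- For fixed framings of the other vertices this is a reindexing of the four
  -- framings of a and b by the change of basis a ↦ a + b.
  Ψ-4T : ∀ {n} (x y : Vector Bool n) A →
    Ψ (border (true ∷ᶠ x) (border y A)) - Ψ (border (false ∷ᶠ x) (border y A)) ≡
    Ψ (border (true ∷ᶠ λ k → x k xor y k) (border y A)) - Ψ (border (false ∷ᶠ λ k → x k xor y k) (border y A))
  Ψ-4T {n} x y A = trans (difference x) (trans (∑±-cong n local) (sym (difference x+y)))
    where
    x+y : Vector Bool n
    x+y k = x k xor y k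
    f : Vector Bool n → Subset n → Bool → Bool → Bool → ℤ
    f x V α ε β = 3^ cork (bordered α (ε ∷ᶠ x) (bordered β y (framed A V)))
    g : Vector Bool n → Subset n → Bool → ℤ
    g x V ε = Δ λ α → Δ λ β → f x V α ε β
    difference : ∀ x → Ψ (border (true ∷ᶠ x) (border y A)) - Ψ (border (false ∷ᶠ x) (border y A)) ≡
                       ∑± n (λ V → g x V true - g x V false)
    difference x = trans (cong₂ _-_ (Ψ-border² (true ∷ᶠ x) y A) (Ψ-border² (false ∷ᶠ x) y A)) (∑±-- n _ _)
    local : ∀ V → g x V true - g x V false ≡ g x+y V true - g x+y V false
    -- For β = 1 the change of basis toggles both α and ε. The alternating sum over α and the
    -- difference in ε each change sign, and the two signs cancel.
    local V = trans (cong₂ _-_ (add true) (add false)) (trans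
      (solve 8 (λ a b c d e f g h →
         ((e :- d) :- (f :- c)) :- ((a :- h) :- (b :- g)) := ((e :- g) :- (f :- h)) :- ((a :- c) :- (b :- d))) refl
         (s false false false) (s true false false) (s false false true) (s true false true)
         (s false true false) (s true true false) (s false true true) (s true true true))
      (sym (cong₂ _-_ (Δ-def² (λ α → s α true)) (Δ-def² (λ α → s α false)))))
      where
      s = f x+y V
      add : ∀ ε → g x V ε ≡ (s false ε false - s true (ε xor true) true) - (s true ε false - s false (ε xor true) true)
      add ε = trans (Δ-cong λ α → Δ-cong λ β → cong 3^_ (cork-add α ε β x y (framed A V))) (trans (Δ-def² _)
        (cong (λ b → (s false b false - s true (ε xor true) true) - (s true b false - s false (ε xor true) true)) (Bool.xor-identityʳ ε)))

  -- Adding a vertex to its twin cancels their common neighbours: the four-term relation leads to a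
  -- leaf, worth Ψ, and to an isolated vertex, worth 2Ψ.
  Ψ-twin : ∀ {n} (y : Vector Bool n) A →
           Ψ (border (false ∷ᶠ y) (border y A)) - Ψ (border (true ∷ᶠ y) (border y A)) ≡ Ψ (border y A)
  Ψ-twin y A = begin
    t false - t true                 ≡⟨ solve 2 (λ a b → a :- b := :- (b :- a)) refl (t false) (t true) ⟩
    - (t true - t false)             ≡⟨ cong -_ (Ψ-4T y y A) ⟩
    - (t′ true - t′ false)           ≡⟨ cong -_ (cong₂ _-_ (Ψ-leaf _ y A (λ k → Bool.xor-same (y k)))
                                         (Ψ-isolated _ (border y A) (λ { zero → refl ; (suc k) → Bool.xor-same (y k) }))) ⟩
    - (Ψ (border y A) - + 2 *ℤ Ψ (border y A)) ≡⟨ solve 1 (λ a → :- (a :- con (+ 2) :* a) := a) refl (Ψ (border y A)) ⟩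
    Ψ (border y A) ∎
    where
    open ≡-Reasoning
    t t′ : Bool → ℤ
    t ε = Ψ (border (ε ∷ᶠ y) (border y A))
    t′ ε = Ψ (border (ε ∷ᶠ λ k → y k xor y k) (border y A))

  -- Reversing an arc of the circle

  infix 5 _<ᵇ_
  opaque
    _<ᵇ_ : ℕ → ℕ → Bool
    p <ᵇ q = does (p <? q)

    <ᵇ-true : ∀ {p q} → p < q → (p <ᵇ q) ≡ true
    <ᵇ-true {p} {q} = dec-true (p <? q)

    <ᵇ-false : ∀ {p q} → ¬ p < q → (p <ᵇ q) ≡ false
    <ᵇ-false {p} {q} = dec-false (p <? q)

    <ᵇ-cong : ∀ {p q p′ q′} → (p < q → p′ < q′) → (p′ < q′ → p < q) → (p <ᵇ q) ≡ (p′ <ᵇ q′)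
    <ᵇ-cong {p} {q} {p′} {q′} f g = does-⇔ (mk⇔ f g) (p <? q) (p′ <? q′)

  <ᵇ-flip : ∀ {p q} → p ≢ q → (q <ᵇ p) ≡ not (p <ᵇ q)
  <ᵇ-flip {p} {q} p≢q with ℕ.<-cmp p q
  ... | tri< p<q _ q≮p = trans (<ᵇ-false q≮p) (cong not (sym (<ᵇ-true p<q)))
  ... | tri≈ _ p≡q _   = contradiction p≡q p≢q
  ... | tri> p≮q _ q<p = trans (<ᵇ-true q<p) (cong not (sym (<ᵇ-false p≮q)))

  -- As a parity it is symmetric in `lo` and `hi`, so the endpoints of a chord need not be sorted,
  -- and intersection numbers are sums of such parities.
  between : (lo hi p : ℕ) → Bool
  between lo hi p = (lo <ᵇ p) xor (hi <ᵇ p)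

  between-comm : ∀ lo hi p → between lo hi p ≡ between hi lo p
  between-comm lo hi p = Bool.xor-comm (lo <ᵇ p) (hi <ᵇ p)

  reflect : (lo hi p : ℕ) → ℕ
  reflect lo hi p = if between lo hi p then (lo + hi) ∸ p else p

  reflect-comm : ∀ lo hi p → reflect lo hi p ≡ reflect hi lo p
  reflect-comm lo hi p = cong₂ (λ b N → if b then N ∸ p else p) (between-comm lo hi p) (ℕ.+-comm lo hi)

  data Location (lo hi p : ℕ) : Bool → Set where
    below  : p < lo → Location lo hi p false
    within : lo < p → p < hi → Location lo hi p true
    above  : hi < p → Location lo hi p false

  locate : ∀ {lo hi p} → lo < hi → p ≢ lo → p ≢ hi → Location lo hi p (between lo hi p)
  locate {lo} {hi} {p} lo<hi p≢lo p≢hi with ℕ.<-cmp lo p | ℕ.<-cmp hi p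
  ... | tri< lo<p _ _ | tri< hi<p _ _ = subst (Location lo hi p) (sym (cong₂ _xor_ (<ᵇ-true lo<p) (<ᵇ-true hi<p))) (above hi<p)
  ... | tri< lo<p _ _ | tri> hi≮p _ p<hi = subst (Location lo hi p) (sym (cong₂ _xor_ (<ᵇ-true lo<p) (<ᵇ-false hi≮p))) (within lo<p p<hi)
  ... | tri≈ _ refl _ | _ = contradiction refl p≢lo
  ... | _ | tri≈ _ refl _ = contradiction refl p≢hi
  ... | tri> lo≮p _ p<lo | tri< hi<p _ _ = contradiction (ℕ.<-trans hi<p p<lo) (ℕ.<-asym lo<hi)
  ... | tri> lo≮p _ p<lo | tri> hi≮p _ p<hi = subst (Location lo hi p) (sym (cong₂ _xor_ (<ᵇ-false lo≮p) (<ᵇ-false hi≮p))) (below p<lo)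

  module _ {lo hi p : ℕ} (lo<p : lo < p) (p<hi : p < hi) where

    reflect-< : (lo + hi) ∸ p < hi
    reflect-< = subst ((lo + hi) ∸ p <_) (ℕ.m+n∸m≡n lo hi)
      (ℕ.∸-monoʳ-< lo<p (ℕ.≤-trans (ℕ.<⇒≤ p<hi) (ℕ.m≤n+m hi lo)))

    reflect-> : lo < (lo + hi) ∸ p
    reflect-> = subst (_< (lo + hi) ∸ p) (ℕ.m+n∸n≡m lo hi) (ℕ.∸-monoʳ-< p<hi (ℕ.m≤n+m hi lo))

  -- Reflected points stay between `lo` and `hi`, so a point outside compares with them as before,
  -- whereas two points inside change their order.
  <ᵇ-reflect′ : ∀ {lo hi p q} → lo < hi → p ≢ lo → p ≢ hi → q ≢ lo → q ≢ hi → p ≢ q →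
                (reflect lo hi p <ᵇ reflect lo hi q) ≡ (p <ᵇ q) xor (between lo hi p ∧ between lo hi q)
  <ᵇ-reflect′ {lo} {hi} {p} {q} lo<hi p≢lo p≢hi q≢lo q≢hi p≢q
    with between lo hi p | between lo hi q | locate lo<hi p≢lo p≢hi | locate lo<hi q≢lo q≢hi
  ... | true | true | within lo<p p<hi | within lo<q q<hi = begin
    ((lo + hi) ∸ p <ᵇ (lo + hi) ∸ q)
      ≡⟨ <ᵇ-cong (λ lt → ℕ.≰⇒> (λ p≤q → ℕ.<⇒≱ lt (ℕ.∸-monoʳ-≤ (lo + hi) p≤q)))
                 (λ q<p → ℕ.∸-monoʳ-< q<p (ℕ.≤-trans (ℕ.<⇒≤ p<hi) (ℕ.m≤n+m hi lo))) ⟩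
    (q <ᵇ p)           ≡⟨ <ᵇ-flip p≢q ⟩
    not (p <ᵇ q)       ≡⟨ Bool.xor-comm true (p <ᵇ q) ⟩
    (p <ᵇ q) xor true  ∎
    where open ≡-Reasoning
  ... | true | false | within lo<p p<hi | below q<lo = trans
    (<ᵇ-cong (λ lt → contradiction (ℕ.<-trans (reflect-> lo<p p<hi) lt) (ℕ.<-asym q<lo))
             (λ p<q → contradiction (ℕ.<-trans lo<p p<q) (ℕ.<-asym q<lo))) (sym (Bool.xor-identityʳ (p <ᵇ q)))
  ... | true | false | within lo<p p<hi | above hi<q = trans
    (<ᵇ-cong (λ _ → ℕ.<-trans p<hi hi<q) (λ _ → ℕ.<-trans (reflect-< lo<p p<hi) hi<q)) (sym (Bool.xor-identityʳ (p <ᵇ q)))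
  ... | false | true | below p<lo | within lo<q q<hi = trans
    (<ᵇ-cong (λ _ → ℕ.<-trans p<lo lo<q) (λ _ → ℕ.<-trans p<lo (reflect-> lo<q q<hi))) (sym (Bool.xor-identityʳ (p <ᵇ q)))
  ... | false | true | above hi<p | within lo<q q<hi = trans
    (<ᵇ-cong (λ lt → contradiction (ℕ.<-trans lt (reflect-< lo<q q<hi)) (ℕ.<-asym hi<p))
             (λ p<q → contradiction (ℕ.<-trans p<q q<hi) (ℕ.<-asym hi<p))) (sym (Bool.xor-identityʳ (p <ᵇ q)))
  ... | false | false | _ | _ = sym (Bool.xor-identityʳ (p <ᵇ q))

  <ᵇ-separated′ : ∀ {lo hi p q r} → lo < hi → p ≢ lo → p ≢ hi → q ≢ lo → q ≢ hi → r ≢ lo → r ≢ hi →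
                  between lo hi p ≡ true → between lo hi q ≡ true → between lo hi r ≡ false → (p <ᵇ r) ≡ (q <ᵇ r)
  <ᵇ-separated′ {lo} {hi} {p} {q} {r} lo<hi p≢lo p≢hi q≢lo q≢hi r≢lo r≢hi p-in q-in r-out
    with between lo hi p | between lo hi q | between lo hi r
       | locate lo<hi p≢lo p≢hi | locate lo<hi q≢lo q≢hi | locate lo<hi r≢lo r≢hi
  <ᵇ-separated′ _ _ _ _ _ _ _ refl refl refl | true | true | false | within lo<p p<hi | within lo<q q<hi | below r<lo =
    <ᵇ-cong (λ p<r → contradiction (ℕ.<-trans lo<p p<r) (ℕ.<-asym r<lo)) (λ q<r → contradiction (ℕ.<-trans lo<q q<r) (ℕ.<-asym r<lo))
  <ᵇ-separated′ _ _ _ _ _ _ _ refl refl refl | true | true | false | within lo<p p<hi | within lo<q q<hi | above hi<r =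
    <ᵇ-cong (λ _ → ℕ.<-trans q<hi hi<r) (λ _ → ℕ.<-trans p<hi hi<r)

  module _ {lo hi p q : ℕ} (lo≢hi : lo ≢ hi) (p≢lo : p ≢ lo) (p≢hi : p ≢ hi) (q≢lo : q ≢ lo) (q≢hi : q ≢ hi) where

    <ᵇ-reflect : p ≢ q → (reflect lo hi p <ᵇ reflect lo hi q) ≡ (p <ᵇ q) xor (between lo hi p ∧ between lo hi q)
    <ᵇ-reflect p≢q with ℕ.<-cmp lo hi
    ... | tri< lo<hi _ _ = <ᵇ-reflect′ lo<hi p≢lo p≢hi q≢lo q≢hi p≢q
    ... | tri≈ _ lo≡hi _ = contradiction lo≡hi lo≢hi
    ... | tri> _ _ hi<lo = trans (cong₂ _<ᵇ_ (reflect-comm lo hi p) (reflect-comm lo hi q))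
      (trans (<ᵇ-reflect′ hi<lo p≢hi p≢lo q≢hi q≢lo p≢q)
             (cong₂ (λ a b → (p <ᵇ q) xor (a ∧ b)) (between-comm hi lo p) (between-comm hi lo q)))

  -- If the images coincided, neither would precede the other. Then `<ᵇ-reflect` would give `p <ᵇ q`
  -- and `q <ᵇ p` the same value, although p and q are distinct.
  reflect-injective : ∀ {lo hi p q} → lo ≢ hi → p ≢ lo → p ≢ hi → q ≢ lo → q ≢ hi → p ≢ q → reflect lo hi p ≢ reflect lo hi q
  reflect-injective {lo} {hi} {p} {q} lo≢hi p≢lo p≢hi q≢lo q≢hi p≢q eq = x≢not (p <ᵇ q)
    (trans (sym p<q) (trans (Bool.∧-comm (between lo hi p) (between lo hi q)) (trans q<p (<ᵇ-flip p≢q))))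
    where
    x≢not : ∀ x → x ≢ not x
    x≢not false ()
    x≢not true  ()
    xor-false : ∀ {x y z} → x ≡ false → x ≡ y xor z → z ≡ y
    xor-false refl eq = sym (xor≡false⇒≡ (sym eq))
    p<q : (between lo hi p ∧ between lo hi q) ≡ (p <ᵇ q)
    p<q = xor-false (<ᵇ-false (ℕ.<-irrefl eq)) (<ᵇ-reflect lo≢hi p≢lo p≢hi q≢lo q≢hi p≢q)
    q<p : (between lo hi q ∧ between lo hi p) ≡ (q <ᵇ p)
    q<p = xor-false (<ᵇ-false (ℕ.<-irrefl (sym eq))) (<ᵇ-reflect lo≢hi q≢lo q≢hi p≢lo p≢hi (p≢q ∘ sym))

  <ᵇ-separated : ∀ {lo hi p q r} → lo ≢ hi → p ≢ lo → p ≢ hi → q ≢ lo → q ≢ hi → r ≢ lo → r ≢ hi →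
                 between lo hi p ≡ true → between lo hi q ≡ true → between lo hi r ≡ false → (p <ᵇ r) ≡ (q <ᵇ r)
  <ᵇ-separated {lo} {hi} {p} {q} {r} lo≢hi p≢lo p≢hi q≢lo q≢hi r≢lo r≢hi p-in q-in r-out with ℕ.<-cmp lo hi
  ... | tri< lo<hi _ _ = <ᵇ-separated′ lo<hi p≢lo p≢hi q≢lo q≢hi r≢lo r≢hi p-in q-in r-out
  ... | tri≈ _ lo≡hi _ = contradiction lo≡hi lo≢hi
  ... | tri> _ _ hi<lo = <ᵇ-separated′ hi<lo p≢hi p≢lo q≢hi q≢lo r≢hi r≢lo
    (trans (between-comm hi lo p) p-in) (trans (between-comm hi lo q) q-in) (trans (between-comm hi lo r) r-out)

  -- The relation on second differences

  sgn : Bool → ℤ → ℤ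
  sgn false x = x
  sgn true  x = - x

  sgn-xor : ∀ a b x → sgn a (sgn b x) ≡ sgn (a xor b) x
  sgn-xor false b     x = refl
  sgn-xor true  false x = refl
  sgn-xor true  true  x = ℤ.neg-involutive x

  sgn-- : ∀ a x y → sgn a x - sgn a y ≡ sgn a (x - y)
  sgn-- false x y = refl
  sgn-- true  x y = solve 2 (λ x y → (:- x) :- (:- y) := :- (x :- y)) refl x y

  Δ-sgn : ∀ b (f : Bool → ℤ) → Δ (λ α → sgn b (f α)) ≡ sgn b (Δ f)
  Δ-sgn b f = trans (Δ-def _) (trans (sgn-- b (f false) (f true)) (cong (sgn b) (sym (Δ-def f))))

  Δ-translate : ∀ a (f : Bool → ℤ) → Δ (λ α → f (α xor a)) ≡ sgn a (Δ f)
  Δ-translate false f = trans (Δ-def _) (sym (Δ-def f))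
  Δ-translate true  f = trans (Δ-def _) (trans (solve 2 (λ x y → y :- x := :- (x :- y)) refl (f false) (f true)) (cong -_ (sym (Δ-def f))))

  Δ-shift : ∀ a {b} {f g : Bool → ℤ} → (∀ α → f α ≡ sgn b (g (α xor a))) → Δ f ≡ sgn (a xor b) (Δ g)
  Δ-shift a {b} {f} {g} eq = begin
    Δ f                              ≡⟨ Δ-cong eq ⟩
    Δ (λ α → sgn b (g (α xor a)))    ≡⟨ Δ-sgn b (λ α → g (α xor a)) ⟩
    sgn b (Δ (λ α → g (α xor a)))    ≡⟨ cong (sgn b) (Δ-translate a g) ⟩
    sgn b (sgn a (Δ g))              ≡⟨ sgn-xor b a (Δ g) ⟩
    sgn (b xor a) (Δ g)              ≡⟨ cong (λ c → sgn c (Δ g)) (Bool.xor-comm b a) ⟩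
    sgn (a xor b) (Δ g)              ∎
    where open ≡-Reasoning

  Δ-zero : ∀ {f : Bool → ℤ} → f false ≡ f true → Δ f ≡ + 0
  Δ-zero {f} eq = trans (Δ-def f) (trans (cong (_- f true) eq) (ℤ.+-inverseʳ (f true)))

  Δ-≡0 : ∀ {f : Bool → ℤ} → (∀ α → f α ≡ + 0) → Δ f ≡ + 0
  Δ-≡0 eq = Δ-zero (trans (eq false) (sym (eq true)))

  Δ-scale : ∀ c {f g : Bool → ℤ} → (∀ α → f α ≡ c *ℤ g α) → Δ f ≡ c *ℤ Δ g
  Δ-scale c {g = g} eq = trans (Δ-cong eq) (sym (Δ-* c g))

  sgn-* : ∀ b c x → sgn b (c *ℤ x) ≡ c *ℤ sgn b x
  sgn-* false c x = refl
  sgn-* true  c x = ℤ.neg-distribʳ-* c x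

  -- Functions of the symmetric matrices (α ε ε′ ; β e ; γ) and (α κ ; β).
  Fun₃ Fun₂ : Set
  Fun₃ = (α ε ε′ β e γ : Bool) → ℤ
  Fun₂ = (α κ β : Bool) → ℤ

  -- The alternating sum runs over the framings α, β, γ of the three chords and over the adjacencies
  -- ε, ε′ of (u, v) to the other two; the latter make up the second difference. The number `e`
  -- stays fixed.
  total₃ : Fun₃ → Bool → ℤ
  total₃ F e = Δ λ α → Δ λ ε → Δ λ ε′ → Δ λ β → Δ λ γ → F α ε ε′ β e γ

  total₂ : Fun₂ → Bool → ℤ
  total₂ F κ = Δ λ α → Δ λ β → F α κ β

  -- The three-row side carries the chords (u,v), (u,ū), (v,v̄), of which the
  -- last two have intersection number e; the two-row sides carry (u,v), (ū,v̄)
  -- with intersection number κ, respectively (u,v̄), (ū,v) with intersection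
  -- number 1 + e + κ.
  record Relation (e κ : Bool) (F : Fun₃) (P C : Fun₂) : Set where
    constructor relation
    field
      equation : sgn κ (total₃ F e) ≡ total₂ P κ - total₂ C (not (e xor κ))

  open Relation public

  total₃-cong : ∀ {F F′ : Fun₃} → (∀ α ε ε′ β e γ → F α ε ε′ β e γ ≡ F′ α ε ε′ β e γ) → ∀ e → total₃ F e ≡ total₃ F′ e
  total₃-cong eq e = Δ-cong λ α → Δ-cong λ ε → Δ-cong λ ε′ → Δ-cong λ β → Δ-cong λ γ → eq α ε ε′ β e γ

  total₂-cong : ∀ {F F′ : Fun₂} → (∀ α κ β → F α κ β ≡ F′ α κ β) → ∀ κ → total₂ F κ ≡ total₂ F′ κ
  total₂-cong eq κ = Δ-cong λ α → Δ-cong λ β → eq α κ β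

  Relation-cong : ∀ {e κ} {F F′ : Fun₃} {P P′ C C′ : Fun₂} →
    (∀ α ε ε′ β e γ → F α ε ε′ β e γ ≡ F′ α ε ε′ β e γ) → (∀ α κ β → P α κ β ≡ P′ α κ β) → (∀ α κ β → C α κ β ≡ C′ α κ β) →
    Relation e κ F′ P′ C′ → Relation e κ F P C
  Relation-cong {e} {κ} F≗ P≗ C≗ (relation r) = relation (trans (cong (sgn κ) (total₃-cong F≗ e)) (trans r
    (sym (cong₂ _-_ (total₂-cong P≗ κ) (total₂-cong C≗ (not (e xor κ)))))))

  -- The entries after a Schur complement with respect to a vertex of framing 1 and label (x , y ,
  -- z). The squares x ∧ x are kept so that the entries match `pivotX` literally.
  shift₃ : (x y z : Bool) → Fun₃ → Fun₃
  shift₃ x y z F α ε ε′ β e γ =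
    F (α xor (x ∧ x)) (ε xor (x ∧ y)) (ε′ xor (x ∧ z)) (β xor (y ∧ y)) (e xor (y ∧ z)) (γ xor (z ∧ z))

  shift₂ : (x y : Bool) → Fun₂ → Fun₂
  shift₂ x y F α κ β = F (α xor (x ∧ x)) (κ xor (x ∧ y)) (β xor (y ∧ y))

  total₃-shift : ∀ x y z F e → total₃ (shift₃ x y z F) e ≡
    sgn ((x ∧ x) xor ((x ∧ y) xor ((x ∧ z) xor ((y ∧ y) xor ((z ∧ z) xor false))))) (total₃ F (e xor (y ∧ z)))
  total₃-shift x y z F e = Δ-shift (x ∧ x) λ α → Δ-shift (x ∧ y) λ ε → Δ-shift (x ∧ z) λ ε′ →
    Δ-shift (y ∧ y) λ β → Δ-shift (z ∧ z) λ γ → refl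

  total₂-shift : ∀ x y F κ → total₂ (shift₂ x y F) κ ≡
    sgn ((x ∧ x) xor ((y ∧ y) xor false)) (total₂ F (κ xor (x ∧ y)))
  total₂-shift x y F κ = Δ-shift (x ∧ x) λ α → Δ-shift (y ∧ y) λ β → refl

  private
    module _ (x y z : Bool) where
      σ₃ σP σC : Bool
      σ₃ = (x ∧ x) xor ((x ∧ y) xor ((x ∧ z) xor ((y ∧ y) xor ((z ∧ z) xor false))))
      σP = (x ∧ x) xor (((x xor y xor z) ∧ (x xor y xor z)) xor false)
      σC = ((x xor z) ∧ (x xor z)) xor (((x xor y) ∧ (x xor y)) xor false)

    ∀Bool³ : ∀ {f g : Bool → Bool → Bool → Bool} → f false false false ≡ g false false false → f false false true ≡ g false false true →
           f false true false ≡ g false true false → f false true true ≡ g false true true → f true false false ≡ g true false false →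
           f true false true ≡ g true false true → f true true false ≡ g true true false → f true true true ≡ g true true true →
           ∀ x y z → f x y z ≡ g x y z
    ∀Bool³ a b c d e f g h false false false = a
    ∀Bool³ a b c d e f g h false false true  = b
    ∀Bool³ a b c d e f g h false true  false = c
    ∀Bool³ a b c d e f g h false true  true  = d
    ∀Bool³ a b c d e f g h true  false false = e
    ∀Bool³ a b c d e f g h true  false true  = f
    ∀Bool³ a b c d e f g h true  true  false = g
    ∀Bool³ a b c d e f g h true  true  true  = h

    signP : ∀ x y z → σP x y z ≡ (x ∧ (x xor y xor z)) xor σ₃ x y z
    signP = ∀Bool³ refl refl refl refl refl refl refl refl

    signC : ∀ x y z → σC x y z ≡ (x ∧ (x xor y xor z)) xor σ₃ x y z
    signC = ∀Bool³ refl refl refl refl refl refl refl refl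

    crossC : ∀ x y z → (y ∧ z) xor (x ∧ (x xor y xor z)) ≡ (x xor z) ∧ (x xor y)
    crossC = ∀Bool³ refl refl refl refl refl refl refl refl

  -- Translating a summation variable by 1 changes the sign of an alternating sum. Let τ = x(x + y +
  -- z) be the amount by which κ moves. By `signP` and `signC` both two-row sums acquire the sign of
  -- the three-row sum times that of τ, which is the change of `sgn κ`; by `crossC` the number 1 + e
  -- + κ moves as the crossed matrix requires.
  Relation-shift : ∀ x y z {e κ} {F P C} →
    Relation (e xor (y ∧ z)) (κ xor (x ∧ (x xor y xor z))) F P C →
    Relation e κ (shift₃ x y z F) (shift₂ x (x xor y xor z) P) (shift₂ (x xor z) (x xor y) C)
  Relation-shift x y z {e} {κ} {F} {P} {C} (relation r) = relation (begin
    sgn κ (total₃ (shift₃ x y z F) e)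
      ≡⟨ cong (sgn κ) (total₃-shift x y z F e) ⟩
    sgn κ (sgn (σ₃ x y z) (total₃ F (e xor (y ∧ z))))
      ≡⟨ sgn-xor κ (σ₃ x y z) _ ⟩
    sgn (κ xor σ₃ x y z) (total₃ F (e xor (y ∧ z)))
      ≡⟨ cong (λ s → sgn s (total₃ F (e xor (y ∧ z)))) (solve₂ 3 (λ k t s → k ⊹ s ⊜ (t ⊹ s) ⊹ (k ⊹ t)) refl κ τ (σ₃ x y z)) ⟩
    sgn ((τ xor σ₃ x y z) xor (κ xor τ)) (total₃ F (e xor (y ∧ z)))
      ≡⟨ sgn-xor (τ xor σ₃ x y z) (κ xor τ) _ ⟨
    sgn (τ xor σ₃ x y z) (sgn (κ xor τ) (total₃ F (e xor (y ∧ z))))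
      ≡⟨ cong (sgn (τ xor σ₃ x y z)) r ⟩
    sgn (τ xor σ₃ x y z) (total₂ P (κ xor τ) - total₂ C (not ((e xor (y ∧ z)) xor (κ xor τ))))
      ≡⟨ sgn-- (τ xor σ₃ x y z) _ _ ⟨
    sgn (τ xor σ₃ x y z) (total₂ P (κ xor τ)) - sgn (τ xor σ₃ x y z) (total₂ C (not ((e xor (y ∧ z)) xor (κ xor τ))))
      ≡⟨ cong₂ _-_
           (trans (cong (λ s → sgn s (total₂ P (κ xor τ))) (sym (signP x y z))) (sym (total₂-shift x (x xor y xor z) P κ)))
           (trans (cong₂ (λ s k → sgn s (total₂ C k)) (sym (signC x y z)) crossed-number)
                  (sym (total₂-shift (x xor z) (x xor y) C (not (e xor κ))))) ⟩
    total₂ (shift₂ x (x xor y xor z) P) κ - total₂ (shift₂ (x xor z) (x xor y) C) (not (e xor κ)) ∎)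
    where
    open ≡-Reasoning
    τ = x ∧ (x xor y xor z)
    crossed-number : not ((e xor (y ∧ z)) xor (κ xor τ)) ≡ not (e xor κ) xor ((x xor z) ∧ (x xor y))
    crossed-number = trans (solve₂ 4 (λ e k t s → con₂ true ⊹ ((e ⊹ s) ⊹ (k ⊹ t)) ⊜ (con₂ true ⊹ (e ⊹ k)) ⊹ (s ⊹ t)) refl e κ τ (y ∧ z))
                           (cong (not (e xor κ) xor_) (crossC x y z))

  Relation-* : ∀ c {e κ} {F P C} → Relation e κ F P C →
    Relation e κ (λ α ε ε′ β e γ → c *ℤ F α ε ε′ β e γ) (λ α κ β → c *ℤ P α κ β) (λ α κ β → c *ℤ C α κ β)
  Relation-* c {e} {κ} {F} {P} {C} (relation r) = relation (trans (cong (sgn κ) (scale₃ F e)) (trans (sgn-* κ c (total₃ F e)) (trans (cong (c *ℤ_) r)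
    (trans (solve 3 (λ c x y → c :* (x :- y) := c :* x :- c :* y) refl c (total₂ P κ) (total₂ C (not (e xor κ))))
           (sym (cong₂ _-_ (scale₂ P κ) (scale₂ C (not (e xor κ)))))))))
    where
    scale₂ : ∀ F κ → total₂ (λ α κ β → c *ℤ F α κ β) κ ≡ c *ℤ total₂ F κ
    scale₂ F κ = Δ-scale c λ α → Δ-scale c λ β → refl
    scale₃ : ∀ F e → total₃ (λ α ε ε′ β e γ → c *ℤ F α ε ε′ β e γ) e ≡ c *ℤ total₃ F e
    scale₃ F e = Δ-scale c λ α → Δ-scale c λ ε → Δ-scale c λ ε′ → Δ-scale c λ β → Δ-scale c λ γ → refl

  sym₂ : (α κ β : Bool) → Matrix₂ 2
  sym₂ α κ β = bordered α (κ ∷ᶠ []ᶠ) (bordered β []ᶠ noX)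

  sym₃ : (α ε ε′ β e γ : Bool) → Matrix₂ 3
  sym₃ α ε ε′ β e γ = bordered α (ε ∷ᶠ ε′ ∷ᶠ []ᶠ) (bordered β (e ∷ᶠ []ᶠ) (bordered γ []ᶠ noX))

  -- The intersection numbers of a chord with (u,v), (u,ū), (v,v̄).
  Label : Set
  Label = Bool × Bool × Bool

  row₃ : Label → Fin 3 → Bool
  row₃ (x , y , z) = x ∷ᶠ y ∷ᶠ z ∷ᶠ []ᶠ

  -- Intersection numbers mod 2 are additive along paths: going from ū to v̄ through u and v gives y
  -- + x + z. In the same way (u, v̄) yields x + z, and (ū, v) yields x + y.
  rowP rowC : Label → Fin 2 → Bool
  rowP (x , y , z) = x ∷ᶠ (x xor y xor z) ∷ᶠ []ᶠ
  rowC (x , y , z) = (x xor z) ∷ᶠ (x xor y) ∷ᶠ []ᶠ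

  module _ {m} (B : Matrix₂ m) (l : Fin m → Label) where

    fun₃ : Fun₃
    fun₃ α ε ε′ β e γ = 3^ nullity B (row₃ ∘ l) (sym₃ α ε ε′ β e γ)

    funP funC : Fun₂
    funP α κ β = 3^ nullity B (rowP ∘ l) (sym₂ α κ β)
    funC α κ β = 3^ nullity B (rowC ∘ l) (sym₂ α κ β)

    Crossing : (e κ : Bool) → Set
    Crossing e κ = Relation e κ fun₃ funP funC

  -- Disjoint remaining chords of framing 0

  3^nullity-zero : ∀ {m s} (R : Fin (suc m) → Fin s → Bool) X j → (∀ p → R j p ≡ false) →
                   3^ nullity disconnected R X ≡ + 3 *ℤ 3^ nullity disconnected (R ∘ punchIn j) X
  3^nullity-zero R X j R₀ = trans (cong 3^_ (nullity-zero disconnected R X j (λ _ → refl) (λ _ → refl) R₀))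
                                  (3^-suc (nullity disconnected (R ∘ punchIn j) X))

  row₃-zero : ∀ {l} → l ≡ (false , false , false) → ∀ p → row₃ l p ≡ false
  row₃-zero refl zero             = refl
  row₃-zero refl (suc zero)       = refl
  row₃-zero refl (suc (suc zero)) = refl

  rowP-zero : ∀ {l} → l ≡ (false , false , false) → ∀ p → rowP l p ≡ false
  rowP-zero refl zero       = refl
  rowP-zero refl (suc zero) = refl

  rowC-zero : ∀ {l} → l ≡ (false , false , false) → ∀ p → rowC l p ≡ false
  rowC-zero refl zero       = refl
  rowC-zero refl (suc zero) = refl

  -- A chord with label zero is an isolated vertex of all three matrices, so every term is
  -- multiplied by 3.
  crossing-free : ∀ {m} (l : Fin (suc m) → Label) j → l j ≡ (false , false , false) → ∀ {e κ} →
                  Crossing disconnected (l ∘ punchIn j) e κ → Crossing disconnected l e κ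
  crossing-free l j lj r = Relation-cong
    (λ α ε ε′ β e γ → 3^nullity-zero (row₃ ∘ l) (sym₃ α ε ε′ β e γ) j (row₃-zero lj))
    (λ α κ β → 3^nullity-zero (rowP ∘ l) (sym₂ α κ β) j (rowP-zero lj))
    (λ α κ β → 3^nullity-zero (rowC ∘ l) (sym₂ α κ β) j (rowC-zero lj))
    (Relation-* (+ 3) r)

  module _ {m s} {R : Fin m → Fin s → Bool} (j : Fin m) {X X′ : Matrix₂ s}
           (d : Vector Bool s → Fin s → Bool) (τ : Vector Bool s → Bool) (τ-cong : ∀ {c c′} → c ≗ c′ → τ c ≡ τ c′)
           (difference : ∀ c p → sum (λ q → X′ p q ∧ c q) ≡ sum (λ q → X p q ∧ c q) xor d c p)
           (absorbed : ∀ c → sum (λ p → R j p ∧ c p) ≡ false → ∀ p → d c p ≡ R j p ∧ τ c) where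

    3^nullity-shift : 3^ nullity disconnected R X ≡ 3^ nullity disconnected R X′
    3^nullity-shift = cong 3^_ (nullity-shift {B = disconnected} j (λ _ → refl) (λ _ → refl) τ τ-cong
      (λ c eq p → trans (difference c p) (cong (sum (λ q → X p q ∧ c q) xor_) (absorbed c eq p))))

  ε-difference : ∀ α ε′ β e γ (c : Vector Bool 3) p →
    sum (λ q → sym₃ α true ε′ β e γ p q ∧ c q) ≡
    sum (λ q → sym₃ α false ε′ β e γ p q ∧ c q) xor (c (suc zero) ∷ᶠ c zero ∷ᶠ false ∷ᶠ []ᶠ) p
  ε-difference α ε′ β e γ c zero = solve₂ 5 (λ α ε′ a b c → α ⊛ a ⊹ (b ⊹ (ε′ ⊛ c ⊹ con₂ false)) ⊜ (α ⊛ a ⊹ (con₂ false ⊹ (ε′ ⊛ c ⊹ con₂ false))) ⊹ b) refl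
    α ε′ (c zero) (c (suc zero)) (c (suc (suc zero)))
  ε-difference α ε′ β e γ c (suc zero) = solve₂ 5 (λ β e a b c → a ⊹ (β ⊛ b ⊹ (e ⊛ c ⊹ con₂ false)) ⊜ (con₂ false ⊹ (β ⊛ b ⊹ (e ⊛ c ⊹ con₂ false))) ⊹ a) refl
    β e (c zero) (c (suc zero)) (c (suc (suc zero)))
  ε-difference α ε′ β e γ c (suc (suc zero)) = sym (Bool.xor-identityʳ _)

  ε′-difference : ∀ α ε β e γ (c : Vector Bool 3) p →
    sum (λ q → sym₃ α ε true β e γ p q ∧ c q) ≡
    sum (λ q → sym₃ α ε false β e γ p q ∧ c q) xor (c (suc (suc zero)) ∷ᶠ false ∷ᶠ c zero ∷ᶠ []ᶠ) p
  ε′-difference α ε β e γ c zero = solve₂ 5 (λ α ε a b c → α ⊛ a ⊹ (ε ⊛ b ⊹ (c ⊹ con₂ false)) ⊜ (α ⊛ a ⊹ (ε ⊛ b ⊹ (con₂ false ⊹ con₂ false))) ⊹ c) refl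
    α ε (c zero) (c (suc zero)) (c (suc (suc zero)))
  ε′-difference α ε β e γ c (suc zero) = sym (Bool.xor-identityʳ _)
  ε′-difference α ε β e γ c (suc (suc zero)) = solve₂ 5 (λ γ e a b c → a ⊹ (e ⊛ b ⊹ (γ ⊛ c ⊹ con₂ false)) ⊜ (con₂ false ⊹ (e ⊛ b ⊹ (γ ⊛ c ⊹ con₂ false))) ⊹ a) refl
    γ e (c zero) (c (suc zero)) (c (suc (suc zero)))

  α-difference : ∀ κ β (c : Vector Bool 2) p →
    sum (λ q → sym₂ true κ β p q ∧ c q) ≡ sum (λ q → sym₂ false κ β p q ∧ c q) xor (c zero ∷ᶠ false ∷ᶠ []ᶠ) p
  α-difference κ β c zero = solve₂ 3 (λ κ a b → a ⊹ (κ ⊛ b ⊹ con₂ false) ⊜ (con₂ false ⊹ (κ ⊛ b ⊹ con₂ false)) ⊹ a) refl κ (c zero) (c (suc zero))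
  α-difference κ β c (suc zero) = sym (Bool.xor-identityʳ _)

  β-difference : ∀ α κ (c : Vector Bool 2) p →
    sum (λ q → sym₂ α κ true p q ∧ c q) ≡ sum (λ q → sym₂ α κ false p q ∧ c q) xor (false ∷ᶠ c (suc zero) ∷ᶠ []ᶠ) p
  β-difference α κ c zero = sym (Bool.xor-identityʳ _)
  β-difference α κ c (suc zero) = solve₂ 3 (λ κ a b → κ ⊛ a ⊹ (b ⊹ con₂ false) ⊜ (κ ⊛ a ⊹ (con₂ false ⊹ con₂ false)) ⊹ b) refl κ (c zero) (c (suc zero))

  κ-difference : ∀ α β (c : Vector Bool 2) p →
    sum (λ q → sym₂ α true β p q ∧ c q) ≡ sum (λ q → sym₂ α false β p q ∧ c q) xor (c (suc zero) ∷ᶠ c zero ∷ᶠ []ᶠ) p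
  κ-difference α β c zero = solve₂ 3 (λ α a b → α ⊛ a ⊹ (b ⊹ con₂ false) ⊜ (α ⊛ a ⊹ (con₂ false ⊹ con₂ false)) ⊹ b) refl α (c zero) (c (suc zero))
  κ-difference α β c (suc zero) = solve₂ 3 (λ β a b → a ⊹ (β ⊛ b ⊹ con₂ false) ⊜ (con₂ false ⊹ (β ⊛ b ⊹ con₂ false)) ⊹ a) refl β (c zero) (c (suc zero))

  module _ {m} (R : Fin m → Fin 3 → Bool) (j : Fin m) where

    private
      F : Fun₃
      F α ε ε′ β e γ = 3^ nullity disconnected R (sym₃ α ε ε′ β e γ)

    module _ (τ : Vector Bool 3 → Bool) (τ-cong : ∀ {c c′} → c ≗ c′ → τ c ≡ τ c′) where

      -- If row `j` absorbs the effect of toggling ε, the corank does not depend on ε, and the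
      -- alternating sum over ε vanishes.
      total₃-ε : (∀ c → sum (λ p → R j p ∧ c p) ≡ false → ∀ p → (c (suc zero) ∷ᶠ c zero ∷ᶠ false ∷ᶠ []ᶠ) p ≡ R j p ∧ τ c) →
                 ∀ e → total₃ F e ≡ + 0
      total₃-ε absorbed e = Δ-≡0 λ α → Δ-zero (Δ-cong λ ε′ → Δ-cong λ β → Δ-cong λ γ →
        3^nullity-shift j {sym₃ α false ε′ β e γ} {sym₃ α true ε′ β e γ} (λ c → c (suc zero) ∷ᶠ c zero ∷ᶠ false ∷ᶠ []ᶠ) τ τ-cong (ε-difference α ε′ β e γ) absorbed)

      total₃-ε′ : (∀ c → sum (λ p → R j p ∧ c p) ≡ false → ∀ p → (c (suc (suc zero)) ∷ᶠ false ∷ᶠ c zero ∷ᶠ []ᶠ) p ≡ R j p ∧ τ c) →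
                  ∀ e → total₃ F e ≡ + 0
      total₃-ε′ absorbed e = Δ-≡0 λ α → Δ-≡0 λ ε → Δ-zero (Δ-cong λ β → Δ-cong λ γ →
        3^nullity-shift j {sym₃ α ε false β e γ} {sym₃ α ε true β e γ} (λ c → c (suc (suc zero)) ∷ᶠ false ∷ᶠ c zero ∷ᶠ []ᶠ) τ τ-cong (ε′-difference α ε β e γ) absorbed)

  module _ {m} (R : Fin m → Fin 2 → Bool) (j : Fin m) where

    private
      F : Fun₂
      F α κ β = 3^ nullity disconnected R (sym₂ α κ β)

    -- The row (1 , 0) of `j` forces the first coordinate to vanish, so the framing α acts on
    -- nothing.
    total₂-α : R j zero ≡ true → R j (suc zero) ≡ false → ∀ κ → total₂ F κ ≡ + 0
    total₂-α r r′ κ = Δ-zero (Δ-cong λ β → 3^nullity-shift j {sym₂ false κ β} {sym₂ true κ β} (λ c → c zero ∷ᶠ false ∷ᶠ []ᶠ) (λ _ → false) (λ _ → refl)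
      (α-difference κ β) (λ c eq → λ { zero → trans (value c eq) (sym (Bool.∧-zeroʳ _)) ; (suc zero) → sym (Bool.∧-zeroʳ _) }))
      where
      value : ∀ c → sum (λ p → R j p ∧ c p) ≡ false → c zero ≡ false
      value c eq = trans (sym (Bool.xor-identityʳ _)) (trans (sym (cong₂ (λ a b → (a ∧ c zero) xor ((b ∧ c (suc zero)) xor false)) r r′)) eq)

    total₂-β : R j zero ≡ false → R j (suc zero) ≡ true → ∀ κ → total₂ F κ ≡ + 0
    total₂-β r r′ κ = Δ-≡0 λ α → Δ-zero (3^nullity-shift j {sym₂ α κ false} {sym₂ α κ true} (λ c → false ∷ᶠ c (suc zero) ∷ᶠ []ᶠ) (λ _ → false) (λ _ → refl)
      (β-difference α κ) (λ c eq → λ { zero → sym (Bool.∧-zeroʳ _) ; (suc zero) → trans (value c eq) (sym (Bool.∧-zeroʳ _)) }))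
      where
      value : ∀ c → sum (λ p → R j p ∧ c p) ≡ false → c (suc zero) ≡ false
      value c eq = trans (sym (Bool.xor-identityʳ _)) (trans (sym (cong₂ (λ a b → (a ∧ c zero) xor ((b ∧ c (suc zero)) xor false)) r r′)) eq)

    -- The row (1 , 1) of `j` forces equal coordinates; toggling κ then adds a multiple of that same
    -- row.
    total₂-κ : R j zero ≡ true → R j (suc zero) ≡ true → ∀ κ → total₂ F κ ≡ total₂ F false
    total₂-κ r r′ false = refl
    total₂-κ r r′ true  = Δ-cong λ α → Δ-cong λ β → sym (3^nullity-shift j {sym₂ α false β} {sym₂ α true β} (λ c → c (suc zero) ∷ᶠ c zero ∷ᶠ []ᶠ) (λ c → c zero) (λ eq → eq zero)
      (κ-difference α β) (λ c eq → λ { zero → trans (value c eq) (sym (cong (_∧ c zero) r)) ; (suc zero) → sym (cong (_∧ c zero) r′) }))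
      where
      value : ∀ c → sum (λ p → R j p ∧ c p) ≡ false → c (suc zero) ≡ c zero
      value c eq = sym (xor≡false⇒≡ (trans (cong (c zero xor_) (sym (Bool.xor-identityʳ _))) (trans (sym (cong₂ (λ a b → (a ∧ c zero) xor ((b ∧ c (suc zero)) xor false)) r r′)) eq)))

  sgn-0 : ∀ b → sgn b (+ 0) ≡ + 0
  sgn-0 false = refl
  sgn-0 true  = refl

  relation-balanced : ∀ {e κ F P C} → total₃ F e ≡ + 0 → total₂ P κ ≡ total₂ C (not (e xor κ)) → Relation e κ F P C
  relation-balanced {e} {κ} {F} {P} {C} F₀ P≡C = relation (trans (cong (sgn κ) F₀) (trans (sgn-0 κ)
    (sym (trans (cong (_- total₂ C (not (e xor κ))) P≡C) (ℤ.+-inverseʳ (total₂ C (not (e xor κ))))))))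

  -- Opposite labels belong to chords that separate u from ū and v from v̄. Five labels are generic:
  -- the non-zero ones with y = 0 or z = 0.
  isZero isOpposite isGeneric : Label → Bool
  isZero (false , false , false) = true
  isZero _                       = false
  isOpposite (_ , true , true) = true
  isOpposite _                 = false
  isGeneric l = not (isZero l) ∧ not (isOpposite l)

  -- The three-row sum always vanishes, because row `j` absorbs ε or ε′. For four of the labels a
  -- framing is absorbed in each two-row sum as well. For (1 , 0 , 0) the chord meets both chords of
  -- either two-row side: the intersection numbers may be set to 0 there, and `nullity-twist` by z
  -- carries `rowP` into `rowC`.
  crossing-generic : ∀ {m} (l : Fin m → Label) j → isGeneric (l j) ≡ true → ∀ e κ → Crossing disconnected l e κ
  crossing-generic {m} l j = generic (l j) refl
    where
    row : ∀ {r} → l j ≡ r → (d : Vector Bool 3 → Fin 3 → Bool) (τ : Vector Bool 3 → Bool) →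
          (∀ c → sum (λ p → row₃ r p ∧ c p) ≡ false → ∀ p → d c p ≡ row₃ r p ∧ τ c) →
          (∀ c → sum (λ p → row₃ (l j) p ∧ c p) ≡ false → ∀ p → d c p ≡ row₃ (l j) p ∧ τ c)
    row lj d τ = subst (λ r → ∀ c → sum (λ p → row₃ r p ∧ c p) ≡ false → ∀ p → d c p ≡ row₃ r p ∧ τ c) (sym lj)

    dε dε′ : Vector Bool 3 → Fin 3 → Bool
    dε  c = c (suc zero) ∷ᶠ c zero ∷ᶠ false ∷ᶠ []ᶠ
    dε′ c = c (suc (suc zero)) ∷ᶠ false ∷ᶠ c zero ∷ᶠ []ᶠ

    drop-false : ∀ {x} → x xor false ≡ false → x ≡ false
    drop-false = trans (sym (Bool.xor-identityʳ _))

    equal : ∀ {x y} → x xor (y xor false) ≡ false → y ≡ x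
    equal {x} eq = sym (xor≡false⇒≡ (trans (cong (x xor_) (sym (Bool.xor-identityʳ _))) eq))

    P-at : ∀ {r} → l j ≡ r → ∀ p → rowP (l j) p ≡ rowP r p
    P-at eq p = cong (λ r → rowP r p) eq
    C-at : ∀ {r} → l j ≡ r → ∀ p → rowC (l j) p ≡ rowC r p
    C-at eq p = cong (λ r → rowC r p) eq

    vanish : ∀ {e κ} → total₃ (fun₃ disconnected l) e ≡ + 0 → total₂ (funP disconnected l) κ ≡ + 0 →
             total₂ (funC disconnected l) (not (e xor κ)) ≡ + 0 → Crossing disconnected l e κ
    vanish F₀ P₀ C₀ = relation-balanced F₀ (trans P₀ (sym C₀))

    twist : l j ≡ (true , false , false) → ∀ κ → total₂ (funP disconnected l) κ ≡ total₂ (funC disconnected l) κ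
    twist lj = total₂-cong (λ α κ β → cong 3^_ (trans
      (nullity-twist {R = rowP ∘ l} {sym₂ α κ β} j (λ { zero → P-at lj zero ; (suc zero) → P-at lj (suc zero) })
         (λ k → proj₂ (proj₂ (l k))) (cong (proj₂ ∘ proj₂) lj))
      (nullity-cong {B = disconnected} {disconnected} (λ _ _ → refl) (λ k → λ
         { zero → refl
         ; (suc zero) → solve₂ 3 (λ x y z → (x ⊹ (y ⊹ z)) ⊹ z ⊜ x ⊹ y) refl (proj₁ (l k)) (proj₁ (proj₂ (l k))) (proj₂ (proj₂ (l k))) })
         (λ _ _ → refl))))

    generic : ∀ r → l j ≡ r → isGeneric r ≡ true → ∀ e κ → Crossing disconnected l e κ
    generic (false , true , false) lj _ e κ = vanish
      (total₃-ε (row₃ ∘ l) j (λ c → c zero) (λ eq → eq zero) (row lj dε (λ c → c zero) λ c eq → λ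
        { zero → drop-false eq ; (suc zero) → refl ; (suc (suc zero)) → refl }) e)
      (total₂-β (rowP ∘ l) j (P-at lj zero) (P-at lj (suc zero)) κ)
      (total₂-β (rowC ∘ l) j (C-at lj zero) (C-at lj (suc zero)) (not (e xor κ)))
    generic (false , false , true) lj _ e κ = vanish
      (total₃-ε′ (row₃ ∘ l) j (λ c → c zero) (λ eq → eq zero) (row lj dε′ (λ c → c zero) λ c eq → λ
        { zero → drop-false eq ; (suc zero) → refl ; (suc (suc zero)) → refl }) e)
      (total₂-β (rowP ∘ l) j (P-at lj zero) (P-at lj (suc zero)) κ)
      (total₂-α (rowC ∘ l) j (C-at lj zero) (C-at lj (suc zero)) (not (e xor κ)))
    generic (true , true , false) lj _ e κ = vanish
      (total₃-ε (row₃ ∘ l) j (λ c → c zero) (λ eq → eq zero) (row lj dε (λ c → c zero) λ c eq → λ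
        { zero → equal eq ; (suc zero) → refl ; (suc (suc zero)) → refl }) e)
      (total₂-α (rowP ∘ l) j (P-at lj zero) (P-at lj (suc zero)) κ)
      (total₂-α (rowC ∘ l) j (C-at lj zero) (C-at lj (suc zero)) (not (e xor κ)))
    generic (true , false , true) lj _ e κ = vanish
      (total₃-ε′ (row₃ ∘ l) j (λ c → c zero) (λ eq → eq zero) (row lj dε′ (λ c → c zero) λ c eq → λ
        { zero → equal eq ; (suc zero) → refl ; (suc (suc zero)) → refl }) e)
      (total₂-α (rowP ∘ l) j (P-at lj zero) (P-at lj (suc zero)) κ)
      (total₂-β (rowC ∘ l) j (C-at lj zero) (C-at lj (suc zero)) (not (e xor κ)))
    generic (true , false , false) lj _ e κ = relation-balanced
      (total₃-ε (row₃ ∘ l) j (λ c → c (suc zero)) (λ eq → eq (suc zero)) (row lj dε (λ c → c (suc zero)) λ c eq → λ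
        { zero → refl ; (suc zero) → drop-false eq ; (suc (suc zero)) → refl }) e)
      (trans (total₂-κ (rowP ∘ l) j (P-at lj zero) (P-at lj (suc zero)) κ) (trans (twist lj false)
        (sym (total₂-κ (rowC ∘ l) j (C-at lj zero) (C-at lj (suc zero)) (not (e xor κ))))))

  infixl 6 _⊕_
  _⊕_ : Label → Label → Label
  (x , y , z) ⊕ (x′ , y′ , z′) = (x xor x′) , (y xor y′) , (z xor z′)

  addSecond : ∀ {m} → (Fin (suc (suc m)) → Label) → Fin (suc (suc m)) → Label
  addSecond l zero    = l zero ⊕ l (suc zero)
  addSecond l (suc k) = l (suc k)

  -- All three rows are linear in the label, so the same congruence acts on the three matrices at
  -- once.
  crossing-add : ∀ {m} (l : Fin (suc (suc m)) → Label) {e κ} → Crossing disconnected (addSecond l) e κ → Crossing disconnected l e κ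
  crossing-add {m} l = Relation-cong
    (λ α ε ε′ β e γ → add row₃ (λ { (x , y , z) (x′ , y′ , z′) zero → refl ; (x , y , z) (x′ , y′ , z′) (suc zero) → refl
                                  ; (x , y , z) (x′ , y′ , z′) (suc (suc zero)) → refl }) (sym₃ α ε ε′ β e γ))
    (λ α κ β → add rowP (λ { (x , y , z) (x′ , y′ , z′) zero → refl
                           ; (x , y , z) (x′ , y′ , z′) (suc zero) → solve₂ 6 (λ x y z x′ y′ z′ →
                                (x ⊹ (y ⊹ z)) ⊹ (x′ ⊹ (y′ ⊹ z′)) ⊜ (x ⊹ x′) ⊹ ((y ⊹ y′) ⊹ (z ⊹ z′))) refl x y z x′ y′ z′ }) (sym₂ α κ β))
    (λ α κ β → add rowC (λ { (x , y , z) (x′ , y′ , z′) zero → solve₂ 4 (λ x z x′ z′ → (x ⊹ z) ⊹ (x′ ⊹ z′) ⊜ (x ⊹ x′) ⊹ (z ⊹ z′)) refl x z x′ z′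
                           ; (x , y , z) (x′ , y′ , z′) (suc zero) → solve₂ 4 (λ x z x′ z′ → (x ⊹ z) ⊹ (x′ ⊹ z′) ⊜ (x ⊹ x′) ⊹ (z ⊹ z′)) refl x y x′ y′ }) (sym₂ α κ β))
    where
    add : ∀ {s} (row : Label → Fin s → Bool) → (∀ l l′ p → row l p xor row l′ p ≡ row (l ⊕ l′) p) → ∀ X →
          3^ nullity disconnected (row ∘ l) X ≡ 3^ nullity disconnected (row ∘ addSecond l) X
    add row linear X = cong 3^_ (trans (nullity-add {R = row ∘ l} {X}) (nullity-cong {B = disconnected} {disconnected} (λ _ _ → refl)
      (λ { zero p → linear (l zero) (l (suc zero)) p ; (suc k) p → Bool.xor-identityʳ _ }) (λ _ _ → refl)))

  -- `opposite false` separates {u, v} from {ū, v̄}, and `opposite true` separates {u, v̄} from {ū,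
  -- v}.
  opposite : Bool → Label
  opposite x = x , true , true

  opaque
    unfolding cork nullity Δ

    -- By evaluation, for each e and κ, of 32 coranks on the left and of 4 in each sum on the right.
    crossing-empty : ∀ e κ → Crossing {0} disconnected (λ ()) e κ
    crossing-empty false false = relation refl
    crossing-empty false true  = relation refl
    crossing-empty true  false = relation refl
    crossing-empty true  true  = relation refl

    crossing-parallel : ∀ e → Crossing {1} disconnected (λ _ → opposite false) e false
    crossing-parallel false = relation refl
    crossing-parallel true  = relation refl

    crossing-crossed : ∀ κ → Crossing {1} disconnected (λ _ → opposite true) (not κ) κ
    crossing-crossed false = relation refl
    crossing-crossed true  = relation refl

  crossing-cong : ∀ {m} {B B′ : Matrix₂ m} {l l′ : Fin m → Label} {e e′ κ κ′} → (∀ j k → B j k ≡ B′ j k) → (∀ j → l j ≡ l′ j) →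
                  e ≡ e′ → κ ≡ κ′ → Crossing B′ l′ e′ κ′ → Crossing B l e κ
  crossing-cong B≗ l≗ refl refl = Relation-cong
    (λ α ε ε′ β e γ → cong 3^_ (nullity-cong {X = sym₃ α ε ε′ β e γ} B≗ (λ j p → cong (λ r → row₃ r p) (l≗ j)) (λ _ _ → refl)))
    (λ α κ β → cong 3^_ (nullity-cong {X = sym₂ α κ β} B≗ (λ j p → cong (λ r → rowP r p) (l≗ j)) (λ _ _ → refl)))
    (λ α κ β → cong 3^_ (nullity-cong {X = sym₂ α κ β} B≗ (λ j p → cong (λ r → rowC r p) (l≗ j)) (λ _ _ → refl)))

  isZero⇒≡ : ∀ l → isZero l ≡ true → l ≡ (false , false , false)
  isZero⇒≡ (false , false , false) _ = refl

  -- The exceptions are the chords separating {u,v} from {ū,v̄} although (u,v)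
  -- and (ū,v̄) intersect, and those separating {u,v̄} from {ū,v} although
  -- (u,v̄) and (ū,v) intersect.
  crossing-disconnected : ∀ m (l : Fin m → Label) {e κ} → (∀ j → l j ≡ opposite false → κ ≡ false) →
                          (∀ j → l j ≡ opposite true → e ≡ not κ) → Crossing disconnected l e κ
  crossing-disconnected zero l {e} {κ} _ _ =
    crossing-cong {l = l} (λ _ _ → refl) (λ ()) refl refl (crossing-empty e κ)
  crossing-disconnected (suc m) l {e} {κ} parallel crossed with Fin.any? (λ j → isZero (l j) Bool.≟ true)
  ... | yes (j , z) = crossing-free l j (isZero⇒≡ (l j) z)
    (crossing-disconnected m (l ∘ punchIn j) (parallel ∘ punchIn j) (crossed ∘ punchIn j))
  ... | no ∄zero with Fin.any? (λ j → isGeneric (l j) Bool.≟ true)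
  ... | yes (j , g) = crossing-generic l j g e κ
  ... | no ∄generic = step m l parallel crossed opposites
    where
    opposites : ∀ j → isOpposite (l j) ≡ true
    opposites j with isZero (l j) in z | isOpposite (l j) in o
    ... | true  | _     = contradiction (j , z) ∄zero
    ... | false | true  = refl
    ... | false | false = contradiction (j , cong₂ (λ a b → not a ∧ not b) z o) ∄generic

    opposite⇒≡ : ∀ r → isOpposite r ≡ true → r ≡ opposite (proj₁ r)
    opposite⇒≡ (x , true , true) _ = refl

    sum-label : ∀ r r′ → isOpposite r ≡ true → isOpposite r′ ≡ true → (r ⊕ r′ ≡ (false , false , false)) ⊎ isGeneric (r ⊕ r′) ≡ true
    sum-label (false , true , true) (false , true , true) _ _ = inj₁ refl
    sum-label (false , true , true) (true  , true , true) _ _ = inj₂ refl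
    sum-label (true  , true , true) (false , true , true) _ _ = inj₂ refl
    sum-label (true  , true , true) (true  , true , true) _ _ = inj₁ refl

    step : ∀ m (l : Fin (suc m) → Label) → (∀ j → l j ≡ opposite false → κ ≡ false) → (∀ j → l j ≡ opposite true → e ≡ not κ) →
           (∀ j → isOpposite (l j) ≡ true) → Crossing disconnected l e κ
    step zero l parallel crossed opp with l zero in eq | opposite⇒≡ (l zero) (opp zero)
    ... | false , _ | refl = crossing-cong {l = l} {l′ = λ _ → opposite false} (λ _ _ → refl) (λ { zero → eq }) refl (parallel zero eq) (crossing-parallel e)
    ... | true  , _ | refl = crossing-cong {l = l} {l′ = λ _ → opposite true} (λ _ _ → refl) (λ { zero → eq }) (crossed zero eq) refl (crossing-crossed κ)
    -- Two opposite labels add up to zero or to (1 , 0 , 0). After the congruence the first chord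
    -- can therefore be dropped, or it is generic and settles the relation.
    step (suc m) l parallel crossed opp = crossing-add l ([ zero-case , (λ g → crossing-generic (addSecond l) zero g e κ) ]′
      (sum-label (l zero) (l (suc zero)) (opp zero) (opp (suc zero))))
      where
      zero-case : l zero ⊕ l (suc zero) ≡ (false , false , false) → Crossing disconnected (addSecond l) e κ
      zero-case eq = crossing-free (addSecond l) zero eq (step m (l ∘ suc) (parallel ∘ suc) (crossed ∘ suc) (opp ∘ suc))

  -- Chord diagrams with two distinguished chords (u, ū) and (v, v̄)

  Segment : ℕ → Set
  Segment n = Endpoint n × Endpoint n

  chord : ∀ {n} → Fin n → Segment n
  chord k = (k , false) , (k , true)

  module _ {n} (D : ChordDiagram n) where

    precedes : Endpoint n → Endpoint n → Bool
    precedes x y = position D x <ᵇ position D y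

    precedes-flip : ∀ {x y} → x ≢ y → precedes y x ≡ not (precedes x y)
    precedes-flip x≢y = <ᵇ-flip (x≢y ∘ position-injective D)

    -- The intersection number of two segments without common endpoint.
    link : Segment n → Segment n → Bool
    link (x , x′) (y , y′) = (precedes x y xor precedes x y′) xor (precedes x′ y xor precedes x′ y′)

    link-sym : ∀ {x x′ y y′} → x ≢ y → x ≢ y′ → x′ ≢ y → x′ ≢ y′ → link (x , x′) (y , y′) ≡ link (y , y′) (x , x′)
    link-sym {x} {x′} {y} {y′} xy xy′ x′y x′y′ = sym (trans
      (cong₂ _xor_ (cong₂ _xor_ (precedes-flip xy) (precedes-flip x′y)) (cong₂ _xor_ (precedes-flip xy′) (precedes-flip x′y′)))
      (solve₂ 4 (λ a b c d → ((con₂ true ⊹ a) ⊹ (con₂ true ⊹ c)) ⊹ ((con₂ true ⊹ b) ⊹ (con₂ true ⊹ d)) ⊜ (a ⊹ b) ⊹ (c ⊹ d)) refl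
        (precedes x y) (precedes x y′) (precedes x′ y) (precedes x′ y′)))

  pattern u  = zero , false
  pattern u* = zero , true
  pattern v  = suc zero , false
  pattern v* = suc zero , true

  other : ∀ {m} → Fin m → Segment (suc (suc m))
  other j = chord (suc (suc j))

  module _ {m} (D : ChordDiagram (suc (suc m))) where

    label : Fin m → Label
    label j = link D (other j) (u , v) , link D (other j) (u , u*) , link D (other j) (v , v*)

    others : (Fin m → Bool) → Matrix₂ m
    others V j k = if j == k then V j else link D (other j) (other k)

    record CrossingAt (V : Fin m → Bool) : Set where
      constructor crossingAt
      field
        crossing : Crossing (others V) label (link D (u , u*) (v , v*)) (link D (u , v) (u* , v*))

    others-diagonal : ∀ V j → others V j j ≡ V j
    others-diagonal V j = cong (λ b → if b then V j else link D (other j) (other j)) (==-refl j)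

    others-off : ∀ V {j k} → j ≢ k → others V j k ≡ link D (other j) (other k)
    others-off V {j} {k} j≢k = cong (λ b → if b then V j else link D (other j) (other k)) (==-false j≢k)

    other-sym : ∀ {j k} → j ≢ k → link D (other j) (other k) ≡ link D (other k) (other j)
    other-sym j≢k = link-sym D (j≢k ∘ index) (j≢k ∘ index) (j≢k ∘ index) (j≢k ∘ index)
      where
      index : ∀ {j k : Fin m} {s t : Bool} → _≡_ {A = Endpoint (suc (suc m))} (suc (suc j) , s) (suc (suc k) , t) → j ≡ k
      index refl = refl

    others-sym : ∀ V j k → others V j k ≡ others V k j
    others-sym V j k with j Fin.≟ k
    ... | yes refl = sym (others-diagonal V j)
    ... | no j≢k   = trans (other-sym j≢k) (sym (others-off V (j≢k ∘ sym)))

  open CrossingAt public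

  scale : Bool → Label → Label
  scale c (x , y , z) = (c ∧ x) , (c ∧ y) , (c ∧ z)

  row₃-scale : ∀ l c l′ p → row₃ (l ⊕ scale c l′) p ≡ row₃ l p xor (c ∧ row₃ l′ p)
  row₃-scale l c l′ zero             = refl
  row₃-scale l c l′ (suc zero)       = refl
  row₃-scale l c l′ (suc (suc zero)) = refl

  rowP-scale : ∀ l c l′ p → rowP (l ⊕ scale c l′) p ≡ rowP l p xor (c ∧ rowP l′ p)
  rowP-scale l c l′ zero = refl
  rowP-scale (x , y , z) c (x′ , y′ , z′) (suc zero) = solve₂ 7 (λ c x y z x′ y′ z′ →
    (x ⊹ c ⊛ x′) ⊹ ((y ⊹ c ⊛ y′) ⊹ (z ⊹ c ⊛ z′)) ⊜ (x ⊹ (y ⊹ z)) ⊹ c ⊛ (x′ ⊹ (y′ ⊹ z′))) refl c x y z x′ y′ z′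

  rowC-scale : ∀ l c l′ p → rowC (l ⊕ scale c l′) p ≡ rowC l p xor (c ∧ rowC l′ p)
  rowC-scale (x , y , z) c (x′ , y′ , z′) zero =
    solve₂ 5 (λ c x z x′ z′ → (x ⊹ c ⊛ x′) ⊹ (z ⊹ c ⊛ z′) ⊜ (x ⊹ z) ⊹ c ⊛ (x′ ⊹ z′)) refl c x z x′ z′
  rowC-scale (x , y , z) c (x′ , y′ , z′) (suc zero) =
    solve₂ 5 (λ c x z x′ z′ → (x ⊹ c ⊛ x′) ⊹ (z ⊹ c ⊛ z′) ⊜ (x ⊹ z) ⊹ c ⊛ (x′ ⊹ z′)) refl c x y x′ y′

  sym₃-shift : ∀ x y z α ε ε′ β e γ p q → sym₃ α ε ε′ β e γ p q xor (row₃ (x , y , z) p ∧ row₃ (x , y , z) q) ≡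
    sym₃ (α xor (x ∧ x)) (ε xor (x ∧ y)) (ε′ xor (x ∧ z)) (β xor (y ∧ y)) (e xor (y ∧ z)) (γ xor (z ∧ z)) p q
  sym₃-shift x y z α ε ε′ β e γ zero             zero             = refl
  sym₃-shift x y z α ε ε′ β e γ zero             (suc zero)       = refl
  sym₃-shift x y z α ε ε′ β e γ zero             (suc (suc zero)) = refl
  sym₃-shift x y z α ε ε′ β e γ (suc zero)       zero             = cong (ε xor_) (Bool.∧-comm y x)
  sym₃-shift x y z α ε ε′ β e γ (suc zero)       (suc zero)       = refl
  sym₃-shift x y z α ε ε′ β e γ (suc zero)       (suc (suc zero)) = refl
  sym₃-shift x y z α ε ε′ β e γ (suc (suc zero)) zero             = cong (ε′ xor_) (Bool.∧-comm z x)
  sym₃-shift x y z α ε ε′ β e γ (suc (suc zero)) (suc zero)       = cong (e xor_) (Bool.∧-comm z y)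
  sym₃-shift x y z α ε ε′ β e γ (suc (suc zero)) (suc (suc zero)) = refl

  sym₂-shift : ∀ x y α κ β p q → sym₂ α κ β p q xor ((x ∷ᶠ y ∷ᶠ []ᶠ) p ∧ (x ∷ᶠ y ∷ᶠ []ᶠ) q) ≡
    sym₂ (α xor (x ∧ x)) (κ xor (x ∧ y)) (β xor (y ∧ y)) p q
  sym₂-shift x y α κ β zero       zero       = refl
  sym₂-shift x y α κ β zero       (suc zero) = refl
  sym₂-shift x y α κ β (suc zero) zero       = cong (κ xor_) (Bool.∧-comm y x)
  sym₂-shift x y α κ β (suc zero) (suc zero) = refl

  -- Eliminating a chord b of framing 1 amounts to cutting the circle at the
  -- endpoints of b and regluing the arc between them in the opposite direction.
  module Reflection {m} (D : ChordDiagram (suc (suc (suc m)))) (b : Fin (suc m)) where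

    ι : Endpoint (suc (suc m)) → Endpoint (suc (suc (suc m)))
    ι = map₁ (punchIn (suc (suc b)))

    lo hi : ℕ
    lo = position D (suc (suc b) , false)
    hi = position D (suc (suc b) , true)

    ι-injective : ∀ {x y} → ι x ≡ ι y → x ≡ y
    ι-injective eq = cong₂ _,_ (Fin.punchIn-injective (suc (suc b)) _ _ (cong proj₁ eq)) (cong proj₂ eq)

    at : Endpoint (suc (suc m)) → ℕ
    at x = position D (ι x)

    at≢ : ∀ x s → at x ≢ position D (suc (suc b) , s)
    at≢ x s eq = Fin.punchInᵢ≢i (suc (suc b)) (proj₁ x) (cong proj₁ (position-injective D eq))

    lo≢hi : lo ≢ hi
    lo≢hi eq with () ← position-injective D eq

    inside : Endpoint (suc (suc m)) → Bool
    inside x = between lo hi (at x)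

    reflected : ChordDiagram (suc (suc m))
    reflected = record
      { position           = λ x → reflect lo hi (at x)
      ; position-injective = λ {x} {y} eq → distinct x y eq
      }
      where
      distinct : ∀ x y → reflect lo hi (at x) ≡ reflect lo hi (at y) → x ≡ y
      distinct x y eq with x ≟ᴱ y
      ... | yes x≡y = x≡y
      ... | no x≢y  = contradiction eq (reflect-injective lo≢hi (at≢ x false) (at≢ x true) (at≢ y false) (at≢ y true)
                        (x≢y ∘ ι-injective ∘ position-injective D))

    precedes-reflected : ∀ {x y} → x ≢ y → precedes reflected x y ≡ precedes D (ι x) (ι y) xor (inside x ∧ inside y)
    precedes-reflected {x} {y} x≢y = <ᵇ-reflect lo≢hi (at≢ x false) (at≢ x true) (at≢ y false) (at≢ y true)
      (x≢y ∘ ι-injective ∘ position-injective D)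

    insideₛ : Segment (suc (suc m)) → Bool
    insideₛ (x , x′) = inside x xor inside x′

    link-chord : ∀ x x′ → link D (other b) (ι x , ι x′) ≡ inside x xor inside x′
    link-chord x x′ = solve₂ 4 (λ p q r s → (p ⊹ q) ⊹ (r ⊹ s) ⊜ (p ⊹ r) ⊹ (q ⊹ s)) refl
      (precedes D (suc (suc b) , false) (ι x)) (precedes D (suc (suc b) , false) (ι x′))
      (precedes D (suc (suc b) , true) (ι x)) (precedes D (suc (suc b) , true) (ι x′))

    -- The corrections of the four comparisons factor as (inside x + inside x′)(inside y + inside
    -- y′), a product of intersection numbers with `b`. This is the correction term of the Schur
    -- complement.
    link-reflected : ∀ {x x′ y y′} → x ≢ y → x ≢ y′ → x′ ≢ y → x′ ≢ y′ →
      link reflected (x , x′) (y , y′) ≡ link D (ι x , ι x′) (ι y , ι y′) xor ((inside x xor inside x′) ∧ (inside y xor inside y′))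
    link-reflected {x} {x′} {y} {y′} xy xy′ x′y x′y′ = trans
      (cong₂ _xor_ (cong₂ _xor_ (precedes-reflected xy) (precedes-reflected xy′))
                   (cong₂ _xor_ (precedes-reflected x′y) (precedes-reflected x′y′)))
      (solve₂ 8 (λ p q r s a b c d → ((p ⊹ a ⊛ c) ⊹ (q ⊹ a ⊛ d)) ⊹ ((r ⊹ b ⊛ c) ⊹ (s ⊹ b ⊛ d)) ⊜
                                     ((p ⊹ q) ⊹ (r ⊹ s)) ⊹ (a ⊹ b) ⊛ (c ⊹ d)) refl
        (precedes D (ι x) (ι y)) (precedes D (ι x) (ι y′)) (precedes D (ι x′) (ι y)) (precedes D (ι x′) (ι y′))
        (inside x) (inside x′) (inside y) (inside y′))

    lx ly lz : Bool
    lx = proj₁ (label D b)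
    ly = proj₁ (proj₂ (label D b))
    lz = proj₂ (proj₂ (label D b))

    adjacent : Fin m → Bool
    adjacent j = link D (other b) (other (punchIn b j))

    adjacent-inside : ∀ j → adjacent j ≡ insideₛ (other j)
    adjacent-inside j = link-chord (suc (suc j) , false) (suc (suc j) , true)

    label-reflected : ∀ j → label reflected j ≡ label D (punchIn b j) ⊕ scale (adjacent j) (label D b)
    label-reflected j = cong₂ _,_ (component u v (λ ()) (λ ()) (λ ()) (λ ()))
      (cong₂ _,_ (component u u* (λ ()) (λ ()) (λ ()) (λ ())) (component v v* (λ ()) (λ ()) (λ ()) (λ ())))
      where
      component : ∀ x x′ → (suc (suc j) , false) ≢ x → (suc (suc j) , false) ≢ x′ → (suc (suc j) , true) ≢ x → (suc (suc j) , true) ≢ x′ →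
        link reflected (other j) (x , x′) ≡ link D (other (punchIn b j)) (ι x , ι x′) xor (adjacent j ∧ link D (other b) (ι x , ι x′))
      component x x′ p q r s = trans (link-reflected p q r s)
        (cong₂ (λ a c → link D (other (punchIn b j)) (ι x , ι x′) xor (a ∧ c)) (sym (adjacent-inside j)) (sym (link-chord x x′)))

    e-reflected : link reflected (u , u*) (v , v*) ≡ link D (u , u*) (v , v*) xor (ly ∧ lz)
    e-reflected = trans (link-reflected {u} {u*} {v} {v*} (λ ()) (λ ()) (λ ()) (λ ()))
      (cong₂ (λ a c → link D (u , u*) (v , v*) xor (a ∧ c)) (sym (link-chord u u*)) (sym (link-chord v v*)))

    κ-reflected : link reflected (u , v) (u* , v*) ≡ link D (u , v) (u* , v*) xor (lx ∧ (lx xor ly xor lz))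
    κ-reflected = trans (link-reflected {u} {v} {u*} {v*} (λ ()) (λ ()) (λ ()) (λ ()))
      (cong₂ (λ a c → link D (u , v) (u* , v*) xor (a ∧ c)) (sym (link-chord u v))
        (trans (solve₂ 4 (λ a b c d → b ⊹ d ⊜ (a ⊹ c) ⊹ ((a ⊹ b) ⊹ (c ⊹ d))) refl (inside u) (inside u*) (inside v) (inside v*))
               (sym (cong₂ _xor_ (link-chord u v) (cong₂ _xor_ (link-chord u u*) (link-chord v v*))))))

    module _ (V : Fin (suc m) → Bool) (framed-b : V b ≡ true) where

      -- The diagonal of the Schur complement: the square of an entry is the entry itself, so
      -- exactly the chords meeting `b` change their framing.
      reframed : Fin m → Bool
      reframed j = V (punchIn b j) xor adjacent j

      private
        others-b : ∀ j → others D V b (punchIn b j) ≡ adjacent j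
        others-b j = others-off D V (Fin.punchInᵢ≢i b j ∘ sym)

        others-reflected : ∀ j k → (others D V (punchIn b j) (punchIn b k) xor (others D V b (punchIn b j) ∧ others D V b (punchIn b k))) ≡
                           others reflected reframed j k
        others-reflected j k with j Fin.≟ k
        ... | yes refl = cong₂ _xor_ (others-diagonal D V (punchIn b j)) (trans (cong₂ _∧_ (others-b j) (others-b j)) (Bool.∧-idem (adjacent j)))
        ... | no j≢k   = trans (cong₂ _xor_ (others-off D V (j≢k ∘ Fin.punchIn-injective b j k)) (cong₂ _∧_ (others-b j) (others-b k)))
          (sym (trans (link-reflected (j≢k ∘ index) (j≢k ∘ index) (j≢k ∘ index) (j≢k ∘ index))
            (cong₂ (λ a c → link D (other (punchIn b j)) (other (punchIn b k)) xor (a ∧ c)) (sym (adjacent-inside j)) (sym (adjacent-inside k)))))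
          where
          index : ∀ {j k : Fin m} {s t : Bool} → _≡_ {A = Endpoint (suc (suc m))} (suc (suc j) , s) (suc (suc k) , t) → j ≡ k
          index refl = refl

        pivot : ∀ {s} (row : Label → Fin s → Bool) → (∀ l c l′ p → row (l ⊕ scale c l′) p ≡ row l p xor (c ∧ row l′ p)) →
                ∀ {X X′ : Matrix₂ s} → (∀ p q → X p q xor (row (label D b) p ∧ row (label D b) q) ≡ X′ p q) →
                3^ nullity (others D V) (row ∘ label D) X ≡ 3^ nullity (others reflected reframed) (row ∘ label reflected) X′
        pivot row linear {X} {X′} X≗ = cong 3^_ (trans
          (nullity-pivot (others D V) (row ∘ label D) X b (trans (others-diagonal D V b) framed-b) (λ j → others-sym D V j b))
          (nullity-cong others-reflected
            (λ j p → trans (cong (λ a → row (label D (punchIn b j)) p xor (a ∧ row (label D b) p)) (others-b j))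
                    (trans (sym (linear (label D (punchIn b j)) (adjacent j) (label D b) p)) (cong (λ r → row r p) (sym (label-reflected j)))))
            X≗))

        F : Fun₃
        F = fun₃ (others D V) (label D)
        F′ : Fun₃
        F′ = fun₃ (others reflected reframed) (label reflected)
        P Q P′ Q′ : Fun₂
        P = funP (others D V) (label D)
        Q = funC (others D V) (label D)
        P′ = funP (others reflected reframed) (label reflected)
        Q′ = funC (others reflected reframed) (label reflected)

        F≗ : ∀ α ε ε′ β e γ → F α ε ε′ β e γ ≡ shift₃ lx ly lz F′ α ε ε′ β e γ
        F≗ α ε ε′ β e γ = pivot row₃ row₃-scale (sym₃-shift lx ly lz α ε ε′ β e γ)
        P≗ : ∀ α κ β → P α κ β ≡ shift₂ lx (lx xor ly xor lz) P′ α κ β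
        P≗ α κ β = pivot rowP rowP-scale (sym₂-shift lx (lx xor ly xor lz) α κ β)
        Q≗ : ∀ α κ β → Q α κ β ≡ shift₂ (lx xor lz) (lx xor ly) Q′ α κ β
        Q≗ α κ β = pivot rowC rowC-scale (sym₂-shift (lx xor lz) (lx xor ly) α κ β)

      crossing-reflect : CrossingAt reflected reframed → CrossingAt D V
      crossing-reflect (crossingAt r) = crossingAt (Relation-cong F≗ P≗ Q≗
        (Relation-shift lx ly lz (subst₂ (λ e κ → Relation e κ F′ P′ Q′) e-reflected κ-reflected r)))

      -- The shift by the label is an involution, so the relation can be carried over to the
      -- reflected diagram as well. The insertion uses this direction, the given diagram being there
      -- the reflected one.
      crossing-unreflect : CrossingAt D V → CrossingAt reflected reframed
      crossing-unreflect (crossingAt r) = crossingAt (Relation-cong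
        (λ α ε ε′ β e γ → trans (sym (six F′ (back α _) (back ε _) (back ε′ _) (back β _) (back e _) (back γ _))) (sym (F≗ _ _ _ _ _ _)))
        (λ α κ β → trans (sym (three P′ (back α _) (back κ _) (back β _))) (sym (P≗ _ _ _)))
        (λ α κ β → trans (sym (three Q′ (back α _) (back κ _) (back β _))) (sym (Q≗ _ _ _)))
        (Relation-shift lx ly lz (subst₂ (λ e κ → Relation e κ F P Q)
          (sym (trans (cong (_xor (ly ∧ lz)) e-reflected) (back _ _)))
          (sym (trans (cong (_xor (lx ∧ (lx xor ly xor lz))) κ-reflected) (back _ _))) r)))
        where
        back : ∀ a s → (a xor s) xor s ≡ a
        back a s = solve₂ 2 (λ a s → (a ⊹ s) ⊹ s ⊜ a) refl a s
        six : ∀ (f : Fun₃) {a a′ b b′ c c′ d d′ e e′ g g′} → a ≡ a′ → b ≡ b′ → c ≡ c′ → d ≡ d′ → e ≡ e′ → g ≡ g′ →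
              f a b c d e g ≡ f a′ b′ c′ d′ e′ g′
        six f refl refl refl refl refl refl = refl
        three : ∀ (f : Fun₂) {a a′ b b′ c c′} → a ≡ a′ → b ≡ b′ → c ≡ c′ → f a b c ≡ f a′ b′ c′
        three f refl refl refl = refl

  -- Chords separating four points

  module _ {n} (D : ChordDiagram n) (k : Fin n) where

    private
      inside : Endpoint n → Bool
      inside x = precedes D (k , false) x xor precedes D (k , true) x

      at≢ : ∀ {x s} → x ≢ (k , s) → position D x ≢ position D (k , s)
      at≢ x≢ = x≢ ∘ position-injective D

      separated-inside : ∀ {p q r s} → (∀ t → p ≢ (k , t)) → (∀ t → q ≢ (k , t)) → (∀ t → r ≢ (k , t)) → (∀ t → s ≢ (k , t)) →
        inside p ≡ true → inside q ≡ true → inside r ≡ false → inside s ≡ false → link D (p , q) (r , s) ≡ false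
      separated-inside {p} {q} {r} {s} p≢ q≢ r≢ s≢ p-in q-in r-out s-out =
        ≡⇒xor≡false (cong₂ _xor_ (compare r≢ r-out) (compare s≢ s-out))
        where
        compare : ∀ {r} → (∀ t → r ≢ (k , t)) → inside r ≡ false → precedes D p r ≡ precedes D q r
        compare r≢ r-out = <ᵇ-separated (λ eq → contradiction (position-injective D eq) (λ ()))
          (at≢ (p≢ false)) (at≢ (p≢ true)) (at≢ (q≢ false)) (at≢ (q≢ true)) (at≢ (r≢ false)) (at≢ (r≢ true)) p-in q-in r-out

    link-inside : ∀ x x′ → link D (chord k) (x , x′) ≡ inside x xor inside x′
    link-inside x x′ = solve₂ 4 (λ p q r s → (p ⊹ q) ⊹ (r ⊹ s) ⊜ (p ⊹ r) ⊹ (q ⊹ s)) refl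
      (precedes D (k , false) x) (precedes D (k , false) x′) (precedes D (k , true) x) (precedes D (k , true) x′)

    -- The chord `k` has `p` and `q` on one side and `r` and `s` on the other, and segments on
    -- different sides of a chord do not cross.
    link-separated : ∀ {p q r s} → (∀ t → p ≢ (k , t)) → (∀ t → q ≢ (k , t)) → (∀ t → r ≢ (k , t)) → (∀ t → s ≢ (k , t)) →
      p ≢ r → p ≢ s → q ≢ r → q ≢ s →
      link D (chord k) (p , q) ≡ false → link D (chord k) (p , r) ≡ true → link D (chord k) (q , s) ≡ true →
      link D (p , q) (r , s) ≡ false
    link-separated {p} {q} {r} {s} p≢ q≢ r≢ s≢ pr ps qr qs p~q p≁r q≁s =
      sides (inside p) (inside q) (inside r) (inside s) refl refl refl refl
        (trans (sym (link-inside p q)) p~q) (trans (sym (link-inside p r)) p≁r) (trans (sym (link-inside q s)) q≁s)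
      where
      sides : ∀ a b c d → inside p ≡ a → inside q ≡ b → inside r ≡ c → inside s ≡ d →
              a xor b ≡ false → a xor c ≡ true → b xor d ≡ true → link D (p , q) (r , s) ≡ false
      sides true  true  false false P Q R S _ _ _ = separated-inside p≢ q≢ r≢ s≢ P Q R S
      sides false false true  true  P Q R S _ _ _ = trans (link-sym D pr ps qr qs) (separated-inside r≢ s≢ p≢ q≢ R S P Q)

  module _ {m} (D : ChordDiagram (suc (suc m))) where

    -- Of the three pairings of four points on a circle exactly one is crossing.
    link-pairings : link D (u , v*) (u* , v) ≡ not (link D (u , u*) (v , v*) xor link D (u , v) (u* , v*))
    link-pairings = trans
      (cong₂ (λ a b → (precedes D u u* xor precedes D u v) xor (a xor b)) (precedes-flip D {u*} {v*} (λ ())) (precedes-flip D {v} {v*} (λ ())))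
      (trans (solve₂ 7 (λ a b c d d′ f g → (b ⊹ a) ⊹ ((con₂ true ⊹ g) ⊹ (con₂ true ⊹ f)) ⊜
                        con₂ true ⊹ (((a ⊹ c) ⊹ ((con₂ true ⊹ d) ⊹ g)) ⊹ ((b ⊹ c) ⊹ (d ⊹ f)))) refl
                (precedes D u v) (precedes D u u*) (precedes D u v*) (precedes D v u*) (precedes D u* v) (precedes D v v*) (precedes D u* v*))
             (cong (λ a → not (((precedes D u v xor precedes D u v*) xor (a xor precedes D u* v*)) xor link D (u , v) (u* , v*)))
                   (sym (precedes-flip D {v} {u*} (λ ())))))

    -- Here the circle enters. A chord with an opposite label separates two of the points u, ū, v,
    -- v̄ from the other two, so the segments joining these pairs do not cross. This excludes the
    -- exceptions of `crossing-disconnected`.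
    crossing-disjoint : ∀ V → (∀ j k → others D V j k ≡ false) → CrossingAt D V
    crossing-disjoint V disjoint = crossingAt (crossing-cong disjoint (λ _ → refl) refl refl
      (crossing-disconnected m (label D) parallel-κ crossed-κ))
      where
      parallel-κ : ∀ j → label D j ≡ opposite false → link D (u , v) (u* , v*) ≡ false
      parallel-κ j eq = link-separated D (suc (suc j)) (λ _ ()) (λ _ ()) (λ _ ()) (λ _ ()) (λ ()) (λ ()) (λ ()) (λ ())
        (cong proj₁ eq) (cong (proj₁ ∘ proj₂) eq) (cong (proj₂ ∘ proj₂) eq)

      crossed-κ : ∀ j → label D j ≡ opposite true → link D (u , u*) (v , v*) ≡ not (link D (u , v) (u* , v*))
      -- The separation shows that (u, v̄) and (ū, v) do not cross; `link-pairings` turns this into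
      -- a relation between e and κ.
      crossed-κ j eq = not-xor (trans (sym link-pairings) (link-separated D (suc (suc j)) (λ _ ()) (λ _ ()) (λ _ ()) (λ _ ()) (λ ()) (λ ()) (λ ()) (λ ())
        (trans (split u v v*) (cong₂ _xor_ (cong proj₁ eq) (cong (proj₂ ∘ proj₂) eq))) (cong (proj₁ ∘ proj₂) eq)
        (trans (swap v* v) (cong (proj₂ ∘ proj₂) eq))))
        where
        c = chord {suc (suc m)} (suc (suc j))
        not-xor : ∀ {a b} → not (a xor b) ≡ false → a ≡ not b
        not-xor {false} {true}  _ = refl
        not-xor {true}  {false} _ = refl
        split : ∀ x y z → link D c (x , z) ≡ link D c (x , y) xor link D c (y , z)
        split x y z = trans (link-inside D (suc (suc j)) x z) (trans
          (solve₂ 3 (λ a b c → a ⊹ c ⊜ (a ⊹ b) ⊹ (b ⊹ c)) refl (i x) (i y) (i z))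
          (sym (cong₂ _xor_ (link-inside D (suc (suc j)) x y) (link-inside D (suc (suc j)) y z))))
          where
          i : Endpoint (suc (suc m)) → Bool
          i x = precedes D (suc (suc j) , false) x xor precedes D (suc (suc j) , true) x
        swap : ∀ x y → link D c (x , y) ≡ link D c (y , x)
        swap x y = solve₂ 4 (λ a b c d → (a ⊹ b) ⊹ (c ⊹ d) ⊜ (b ⊹ a) ⊹ (d ⊹ c)) refl
          (precedes D (suc (suc j) , false) x) (precedes D (suc (suc j) , false) y) (precedes D (suc (suc j) , true) x) (precedes D (suc (suc j) , true) y)

  crossingAt-cong : ∀ {m} {D D′ : ChordDiagram (suc (suc m))} {V V′ : Fin m → Bool} → (∀ x y → precedes D x y ≡ precedes D′ x y) →
                    V ≗ V′ → CrossingAt D′ V′ → CrossingAt D V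
  crossingAt-cong {D = D} {D′} {V} {V′} D≗ V≗ (crossingAt r) = crossingAt (crossing-cong
    (λ j k → cong₂ (λ a b → if j == k then a else b) (V≗ j) (link≗ _ _))
    (λ j → cong₂ _,_ (link≗ _ _) (cong₂ _,_ (link≗ _ _) (link≗ _ _)))
    (link≗ _ _) (link≗ _ _) r)
    where
    link≗ : ∀ a b → link D a b ≡ link D′ a b
    link≗ (x , x′) (y , y′) = cong₂ _xor_ (cong₂ _xor_ (D≗ x y) (D≗ x y′)) (cong₂ _xor_ (D≗ x′ y) (D≗ x′ y′))

  -- Insertion of a tiny chord

  place : ℕ → Fin 3 → ℕ
  place p r = toℕ r + p * 3

  place-injective : ∀ {p q r s} → place p r ≡ place q s → p ≡ q × r ≡ s
  place-injective {p} {q} {r} {s} eq = ℕ.*-cancelʳ-≡ p q 3 (ℕ.+-cancelˡ-≡ (toℕ r) _ _ (trans eq (cong (λ t → toℕ t + q * 3) (sym r≡s)))) , r≡s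
    where
    remainder : ∀ p r → place p r % 3 ≡ toℕ r
    remainder p r = trans (ℕ.[m+kn]%n≡m%n (toℕ r) p 3) (ℕ.m<n⇒m%n≡m (Fin.toℕ<n r))
    r≡s : r ≡ s
    r≡s = Fin.toℕ-injective (trans (sym (remainder p r)) (trans (cong (_% 3) eq) (remainder q s)))

  place-< : ∀ {p q r s} → p < q → place p r < place q s
  place-< {p} {q} {r} {s} p<q = ℕ.<-≤-trans (ℕ.+-monoˡ-< (p * 3) (Fin.toℕ<n r)) (ℕ.≤-trans (ℕ.*-monoˡ-≤ 3 p<q) (ℕ.m≤n+m (q * 3) (toℕ s)))

  one two : Fin 3
  one = suc zero
  two = suc (suc zero)

  place-one : ∀ p q → (place p one <ᵇ place q one) ≡ (p <ᵇ q)
  place-one p q = <ᵇ-cong (λ lt → ℕ.*-cancelʳ-< 3 p q (ℕ.+-cancelˡ-< 1 _ _ lt)) (place-< {r = one} {one})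

  -- `place` splits every position into three slots, the middle one being meant for the old
  -- endpoints. The outer slots of `p` enclose no other middle slot than that of `p`.
  between-tiny : ∀ p q → between (place p zero) (place p two) (place q one) ≡ does (q ℕ.≟ p)
  between-tiny p q with ℕ.<-cmp p q
  ... | tri< p<q p≢q _ = trans (cong₂ _xor_ (<ᵇ-true (place-< {r = zero} {one} p<q)) (<ᵇ-true (place-< {r = two} {one} p<q)))
                               (sym (dec-false (q ℕ.≟ p) (p≢q ∘ sym)))
  ... | tri≈ _ refl _  = trans (cong₂ _xor_ (<ᵇ-true (ℕ.n<1+n (p * 3))) (<ᵇ-false (ℕ.<-asym (ℕ.n<1+n (1 + p * 3)))))
                               (sym (dec-true (p ℕ.≟ p) refl))
  ... | tri> _ p≢q q<p = trans (cong₂ _xor_ (<ᵇ-false (ℕ.<-asym (place-< {r = one} {zero} q<p))) (<ᵇ-false (ℕ.<-asym (place-< {r = one} {two} q<p))))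
                               (sym (dec-false (q ℕ.≟ p) (p≢q ∘ sym)))

  -- The middle slot is the centre of the reflected interval, so the reversal moves no old endpoint.
  reflect-tiny : ∀ p q → reflect (place p zero) (place p two) (place q one) ≡ place q one
  reflect-tiny p q = trans (cong (λ b → if b then (place p zero + place p two) ∸ place q one else place q one) (between-tiny p q)) (cases (q ℕ.≟ p))
    where
    cases : (d : Dec (q ≡ p)) → (if does d then (place p zero + place p two) ∸ place q one else place q one) ≡ place q one
    cases (yes refl) = trans (cong (_∸ (1 + p * 3)) (ℕ.+-suc (p * 3) (1 + p * 3))) (ℕ.m+n∸m≡n (1 + p * 3) (1 + p * 3))
    cases (no _)     = refl

  -- A tiny chord of framing 1 around the first endpoint of b: its elimination
  -- changes the framing of b and nothing else.
  module Insertion {m} (D : ChordDiagram (suc (suc m))) (b : Fin m) where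

    p₀ : ℕ
    p₀ = position D (suc (suc b) , false)

    spot : Endpoint (suc (suc (suc m))) → ℕ × Fin 3
    spot (zero , s)              = position D (zero , s) , one
    spot (suc zero , s)          = position D (suc zero , s) , one
    spot (suc (suc zero) , s)    = p₀ , (if s then two else zero)
    spot (suc (suc (suc j)) , s) = position D (suc (suc j) , s) , one

    ι : Endpoint (suc (suc m)) → Endpoint (suc (suc (suc m)))
    ι = map₁ (punchIn (suc (suc zero)))

    spot-ι : ∀ x → spot (ι x) ≡ (position D x , one)
    spot-ι (zero , s)        = refl
    spot-ι (suc zero , s)    = refl
    spot-ι (suc (suc j) , s) = refl

    spot-injective : ∀ x y → proj₁ (spot x) ≡ proj₁ (spot y) → proj₂ (spot x) ≡ proj₂ (spot y) → x ≡ y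
    spot-injective x y = cover x y
      where
      data Cover : Endpoint (suc (suc (suc m))) → Set where
        old : ∀ x → Cover (ι x)
        new : ∀ s → Cover (suc (suc zero) , s)
      covering : ∀ x → Cover x
      covering (zero , s)              = old (zero , s)
      covering (suc zero , s)          = old (suc zero , s)
      covering (suc (suc zero) , s)    = new s
      covering (suc (suc (suc j)) , s) = old (suc (suc j) , s)
      cover : ∀ x y → proj₁ (spot x) ≡ proj₁ (spot y) → proj₂ (spot x) ≡ proj₂ (spot y) → x ≡ y
      cover x y p r with covering x | covering y
      ... | old x′ | old y′ = cong ι (position-injective D (trans (sym (cong proj₁ (spot-ι x′))) (trans p (cong proj₁ (spot-ι y′)))))
      ... | new false | new false = refl
      ... | new true  | new true  = refl
      ... | old x′ | new false with () ← trans (sym (cong proj₂ (spot-ι x′))) r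
      ... | old x′ | new true  with () ← trans (sym (cong proj₂ (spot-ι x′))) r
      ... | new false | old y′ with () ← trans r (cong proj₂ (spot-ι y′))
      ... | new true  | old y′ with () ← trans r (cong proj₂ (spot-ι y′))
      ... | new false | new true with () ← r
      ... | new true | new false with () ← r

    inserted : ChordDiagram (suc (suc (suc m)))
    inserted = record
      { position           = λ x → place (proj₁ (spot x)) (proj₂ (spot x))
      ; position-injective = λ {x} {y} eq → let p , r = place-injective {proj₁ (spot x)} eq in spot-injective x y p r
      }

    position-ι : ∀ x → position inserted (ι x) ≡ place (position D x) one
    position-ι x = cong (λ (p , r) → place p r) (spot-ι x)

    precedes-ι : ∀ x y → precedes inserted (ι x) (ι y) ≡ precedes D x y
    precedes-ι x y = trans (cong₂ _<ᵇ_ (position-ι x) (position-ι y)) (place-one (position D x) (position D y))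

    -- The framing of `b` is toggled in advance, because eliminating the tiny chord toggles it back.
    mark : (Fin m → Bool) → Fin (suc m) → Bool
    mark V zero    = true
    mark V (suc j) = V j xor (j == b)

    private
      module R = Reflection inserted zero

    position-reflected : ∀ x → position R.reflected x ≡ place (position D x) one
    position-reflected x = trans (cong (reflect (place p₀ zero) (place p₀ two)) (position-ι x)) (reflect-tiny p₀ (position D x))

    inside-ι : ∀ x → R.inside x ≡ does (position D x ℕ.≟ p₀)
    inside-ι x = trans (cong (between (place p₀ zero) (place p₀ two)) (position-ι x)) (between-tiny p₀ (position D x))

    adjacent-inserted : ∀ j → R.adjacent j ≡ (j == b)
    adjacent-inserted j = trans (R.adjacent-inside j) (trans (cong₂ _xor_ (trans (inside-ι (suc (suc j) , false)) first) (trans (inside-ι (suc (suc j) , true)) second))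
      (Bool.xor-identityʳ (j == b)))
      where
      first : does (position D (suc (suc j) , false) ℕ.≟ p₀) ≡ (j == b)
      first = does-⇔ (mk⇔ (λ eq → Fin.suc-injective (Fin.suc-injective (cong proj₁ (position-injective D eq)))) (cong (λ j → position D (suc (suc j) , false))))
        (position D (suc (suc j) , false) ℕ.≟ p₀) (j Fin.≟ b)
      second : does (position D (suc (suc j) , true) ℕ.≟ p₀) ≡ false
      second = dec-false (position D (suc (suc j) , true) ℕ.≟ p₀) (λ eq → contradiction (cong proj₂ (position-injective D eq)) (λ ()))

    crossing-insert : ∀ V → CrossingAt inserted (mark V) → CrossingAt D V
    crossing-insert V r = crossingAt-cong {D = D} {R.reflected} {V} {R.reframed (mark V) refl}
      (λ x y → sym (trans (cong₂ _<ᵇ_ (position-reflected x) (position-reflected y)) (place-one (position D x) (position D y))))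
      (λ j → sym (trans (cong ((V j xor (j == b)) xor_) (adjacent-inserted j)) (solve₂ 2 (λ x y → (x ⊹ y) ⊹ y ⊜ x) refl (V j) (j == b))))
      (R.crossing-unreflect (mark V) refl r)

  opaque
    -- Opaque and existential, so that reflected diagrams are not unfolded when steps are combined;
    -- the induction works with the implication and the new framings.
    reflect-step : ∀ {m} (D : ChordDiagram (suc (suc (suc m)))) V b → V b ≡ true →
      ∃ λ (D′ : ChordDiagram (suc (suc m))) → ∃ λ V′ → (CrossingAt D′ V′ → CrossingAt D V) ×
        (∀ j → V′ j ≡ V (punchIn b j) xor link D (other b) (other (punchIn b j)))
    reflect-step D V b Vb = R.reflected , R.reframed V Vb , R.crossing-reflect V Vb , λ _ → refl
      where module R = Reflection D b

    insert-step : ∀ {m} (D : ChordDiagram (suc (suc m))) V b →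
      ∃ λ (D′ : ChordDiagram (suc (suc (suc m)))) → ∃ λ V′ → (CrossingAt D′ V′ → CrossingAt D V) ×
        (∀ j → V′ (suc j) ≡ V j xor (j == b)) × (∀ j k → link D′ (other (suc j)) (other (suc k)) ≡ link D (other j) (other k))
    insert-step D V b = inserted , mark V , crossing-insert V , (λ _ → refl) , λ j k →
      cong₂ _xor_ (cong₂ _xor_ (precedes-ι _ _) (precedes-ι _ _)) (cong₂ _xor_ (precedes-ι _ _) (precedes-ι _ _))
      where open Insertion D b

  -- Two intersecting chords b, c of framing 0: after the insertion both are
  -- eliminated as chords of framing 1, b first.
  eliminate-pair : ∀ {m} (D : ChordDiagram (suc (suc (suc (suc m))))) V {b c} → b ≢ c → V b ≡ false → V c ≡ false →
    link D (other b) (other c) ≡ true →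
    (∀ (D′ : ChordDiagram (suc (suc (suc m)))) V′ → CrossingAt D′ V′) → CrossingAt D V
  eliminate-pair {m} D V {b} {c} b≢c Vb Vc linked rec with insert-step D V b
  ... | D₁ , V₁ , to-D , V₁≡ , link₁ with reflect-step D₁ V₁ (suc b) (trans (V₁≡ b) (cong₂ _xor_ Vb (==-refl b)))
  -- Eliminating `b` has toggled the framing of `c`, since the two intersect; so `c` now has framing
  -- 1 and can be eliminated too.
  ... | D₂ , V₂ , to-D₁ , V₂≡ with reflect-step D₂ V₂ (suc (punchOut b≢c)) (trans (V₂≡ (suc (punchOut b≢c)))
      (trans (cong (λ k → V₁ (suc k) xor link D₁ (other (suc b)) (other (suc k))) (Fin.punchIn-punchOut b≢c))
             (cong₂ _xor_ (trans (V₁≡ c) (cong₂ _xor_ Vc (==-false (b≢c ∘ sym)))) (trans (link₁ b c) linked))))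
  ... | D₃ , V₃ , to-D₂ , _ = to-D (to-D₁ (to-D₂ (rec D₃ V₃)))

  -- Induction on the number of remaining chords, for all framings at once, since eliminations
  -- change them. A chord of framing 1 leaves one chord fewer; so does an intersecting pair, as one
  -- chord is inserted and two are eliminated.
  crossing-chords : ∀ m (D : ChordDiagram (suc (suc m))) V → CrossingAt D V
  crossing-chords zero    D V = crossing-disjoint D V (λ ())
  crossing-chords (suc m) D V with Fin.any? (λ j → V j Bool.≟ true)
  ... | yes (b , Vb) with D′ , V′ , to-D , _ ← reflect-step D V b Vb = to-D (crossing-chords m D′ V′)
  ... | no unframed with Fin.any? (λ b → Fin.any? (λ c → others D V b c Bool.≟ true))
  ... | no disjoint = crossing-disjoint D V (λ j k → Bool.¬-not (λ eq → disjoint (j , k , eq)))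
  ... | yes (b , c , linked) = pair m D V b c b≢c (V₀ b) (V₀ c) (trans (sym (others-off D V b≢c)) linked) (crossing-chords m)
    where
    V₀ : ∀ j → V j ≡ false
    V₀ j = Bool.¬-not (λ eq → unframed (j , eq))
    b≢c : b ≢ c
    b≢c refl = contradiction (trans (sym linked) (trans (others-diagonal D V b) (V₀ b))) (λ ())
    pair : ∀ m (D : ChordDiagram (suc (suc (suc m)))) V b c → b ≢ c → V b ≡ false → V c ≡ false →
           link D (other b) (other c) ≡ true → (∀ (D′ : ChordDiagram (suc (suc m))) V′ → CrossingAt D′ V′) → CrossingAt D V
    pair zero    D V zero zero b≢c _ _ _ _ = contradiction refl b≢c
    pair (suc m) D V b c b≢c Vb Vc linked rec = eliminate-pair D V b≢c Vb Vc linked rec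

  -- Summation over the framings of the remaining chords

  ∑±-sgn : ∀ n b (f : Subset n → ℤ) → sgn b (∑± n f) ≡ ∑± n (sgn b ∘ f)
  ∑±-sgn zero    b f = refl
  ∑±-sgn (suc n) b f = trans (sym (Δ-sgn b _)) (Δ-cong (λ α → ∑±-sgn n b (f ∘ (α ∷_))))

  Ψ-border³ : ∀ {n} (x : Vector Bool (suc (suc n))) y z A →
    Ψ (border x (border y (border z A))) ≡
    ∑± n (λ V → Δ λ α → Δ λ β → Δ λ γ → 3^ cork (bordered α x (bordered β y (bordered γ z (framed A V)))))
  Ψ-border³ {n} x y z A = trans (Ψ-border² x y (border z A)) (trans
    (Δ-cong λ γ → ∑±-cong n λ V → Δ-cong λ α → Δ-cong λ β → cong 3^_ (cork-cong
      (bordered-cong {α = α} {r = x} {x} (λ _ → refl) (bordered-cong {α = β} {r = y} {y} (λ _ → refl) (framed-bordered false z A γ V)))))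
    (trans (Δ-∑± n (λ γ V → Δ λ α → Δ λ β → f V α β γ))
           (∑±-cong n λ V → trans (Δ-comm (λ γ α → Δ λ β → f V α β γ)) (Δ-cong λ α → Δ-comm (λ γ β → f V α β γ)))))
    where
    f : Subset n → Bool → Bool → Bool → ℤ
    f V α β γ = 3^ cork (bordered α x (bordered β y (bordered γ z (framed A V))))

  -- The second difference of Ψ in the adjacencies of a vertex (u, v) to the
  -- vertices (u, ū) and (v, v̄) resolves into the two other ways of joining the
  -- points u, ū, v, v̄.
  module Ψ-crossing {m} (D : ChordDiagram (suc (suc m))) where

    private
      M : Matrix₂ m
      M j k = link D (other j) (other k)
      e κ : Bool
      e = link D (u , u*) (v , v*)
      κ = link D (u , v) (u* , v*)

    x y z : Vector Bool m
    x j = proj₁ (label D j)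
    y j = proj₁ (proj₂ (label D j))
    z j = proj₂ (proj₂ (label D j))

    private
      three : ∀ V α ε ε′ β γ → 3^ cork (bordered α (ε ∷ᶠ ε′ ∷ᶠ x) (bordered β (e ∷ᶠ y) (bordered γ z (framed M V)))) ≡
                               fun₃ (others D (lookup V)) (label D) α ε ε′ β e γ
      three V α ε ε′ β γ = cong 3^_ (cork≡nullity {3} {A = bordered α (ε ∷ᶠ ε′ ∷ᶠ x) (bordered β (e ∷ᶠ y) (bordered γ z (framed M V)))}
        {framed M V} {row₃ ∘ label D} {sym₃ α ε ε′ β e γ} (λ _ _ → refl)
        (λ j → λ { zero → refl ; (suc zero) → refl ; (suc (suc zero)) → refl })
        (λ j → λ { zero → refl ; (suc zero) → refl ; (suc (suc zero)) → refl })
        (λ { zero zero → refl ; zero (suc zero) → refl ; zero (suc (suc zero)) → refl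
           ; (suc zero) zero → refl ; (suc zero) (suc zero) → refl ; (suc zero) (suc (suc zero)) → refl
           ; (suc (suc zero)) zero → refl ; (suc (suc zero)) (suc zero) → refl ; (suc (suc zero)) (suc (suc zero)) → refl }))

      two-rows : ∀ (row : Label → Fin 2 → Bool) V α κ β →
        3^ cork (bordered α (κ ∷ᶠ λ j → row (label D j) zero) (bordered β (λ j → row (label D j) (suc zero)) (framed M V))) ≡
        3^ nullity (others D (lookup V)) (row ∘ label D) (sym₂ α κ β)
      two-rows row V α κ β = cong 3^_ (cork≡nullity {2} {A = bordered α (κ ∷ᶠ λ j → row (label D j) zero) (bordered β (λ j → row (label D j) (suc zero)) (framed M V))}
        {framed M V} {row ∘ label D} {sym₂ α κ β} (λ _ _ → refl)
        (λ j → λ { zero → refl ; (suc zero) → refl }) (λ j → λ { zero → refl ; (suc zero) → refl })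
        (λ { zero zero → refl ; zero (suc zero) → refl ; (suc zero) zero → refl ; (suc zero) (suc zero) → refl }))

    resolved : (Label → Fin 2 → Bool) → Bool → ℤ
    resolved row κ = Ψ (border (κ ∷ᶠ λ j → row (label D j) zero) (border (λ j → row (label D j) (suc zero)) M))

    private
      resolved-total : ∀ row κ → resolved row κ ≡ ∑± m (λ V → total₂ (λ α κ β → 3^ nullity (others D (lookup V)) (row ∘ label D) (sym₂ α κ β)) κ)
      resolved-total row κ = trans (Ψ-border² _ _ M) (∑±-cong m λ V → Δ-cong λ α → Δ-cong λ β → two-rows row V α κ β)

    Ψ-crossing : sgn κ (Δ λ ε → Δ λ ε′ → Ψ (border (ε ∷ᶠ ε′ ∷ᶠ x) (border (e ∷ᶠ y) (border z M)))) ≡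
                 resolved rowP κ - resolved rowC (not (e xor κ))
    Ψ-crossing = begin
      sgn κ (Δ λ ε → Δ λ ε′ → Ψ (border (ε ∷ᶠ ε′ ∷ᶠ x) (border (e ∷ᶠ y) (border z M))))
        ≡⟨ cong (sgn κ) (Δ-cong λ ε → Δ-cong λ ε′ → trans (Ψ-border³ _ _ _ M) (∑±-cong m λ V → Δ-cong λ α → Δ-cong λ β → Δ-cong λ γ → three V α ε ε′ β γ)) ⟩
      sgn κ (Δ λ ε → Δ λ ε′ → ∑± m λ V → Δ λ α → F V α ε ε′)
        ≡⟨ cong (sgn κ) (trans (Δ-cong λ ε → Δ-∑± m (λ ε′ V → Δ λ α → F V α ε ε′)) (Δ-∑± m (λ ε V → Δ λ ε′ → Δ λ α → F V α ε ε′))) ⟩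
      sgn κ (∑± m λ V → Δ λ ε → Δ λ ε′ → Δ λ α → F V α ε ε′)
        ≡⟨ cong (sgn κ) (∑±-cong m λ V → trans (Δ-cong λ ε → Δ-comm (λ ε′ α → F V α ε ε′)) (Δ-comm (λ ε α → Δ λ ε′ → F V α ε ε′))) ⟩
      sgn κ (∑± m λ V → total₃ (fun₃ (others D (lookup V)) (label D)) e)
        ≡⟨ ∑±-sgn m κ _ ⟩
      (∑± m λ V → sgn κ (total₃ (fun₃ (others D (lookup V)) (label D)) e))
        ≡⟨ ∑±-cong m (λ V → equation (crossing (crossing-chords m D (lookup V)))) ⟩
      (∑± m λ V → total₂ (funP (others D (lookup V)) (label D)) κ - total₂ (funC (others D (lookup V)) (label D)) (not (e xor κ)))
        ≡⟨ ∑±-- m _ _ ⟨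
      ∑± m (λ V → total₂ (funP (others D (lookup V)) (label D)) κ) - ∑± m (λ V → total₂ (funC (others D (lookup V)) (label D)) (not (e xor κ)))
        ≡⟨ cong₂ _-_ (resolved-total rowP κ) (resolved-total rowC (not (e xor κ))) ⟨
      resolved rowP κ - resolved rowC (not (e xor κ)) ∎
      where
      open ≡-Reasoning
      F : Subset m → Bool → Bool → Bool → ℤ
      F V α ε ε′ = Δ λ β → Δ λ γ → fun₃ (others D (lookup V)) (label D) α ε ε′ β e γ

  links : ∀ {n} → ChordDiagram n → Matrix₂ n
  links D k l = link D (chord k) (chord l)

  chord-≢ : ∀ {n} {k l : Fin n} {s t} → k ≢ l → _≢_ {A = Endpoint n} (k , s) (l , t)
  chord-≢ k≢l = k≢l ∘ cong proj₁

  links-sym : ∀ {n} (D : ChordDiagram n) {k l} → k ≢ l → links D k l ≡ links D l k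
  links-sym D k≢l = link-sym D (chord-≢ k≢l) (chord-≢ k≢l) (chord-≢ k≢l) (chord-≢ k≢l)

  link-cong : ∀ {m n} {D : ChordDiagram m} {E : ChordDiagram n} {x x′ y y′ z z′ w w′} →
    precedes D x y ≡ precedes E z w → precedes D x y′ ≡ precedes E z w′ → precedes D x′ y ≡ precedes E z′ w → precedes D x′ y′ ≡ precedes E z′ w′ →
    link D (x , x′) (y , y′) ≡ link E (z , z′) (w , w′)
  link-cong p q r s = cong₂ _xor_ (cong₂ _xor_ p q) (cong₂ _xor_ r s)

  link-positions : ∀ {m n} (D : ChordDiagram m) (E : ChordDiagram n) (f : Endpoint m → Endpoint n) →
    (∀ x → position D x ≡ position E (f x)) → ∀ x x′ y y′ → link D (x , x′) (y , y′) ≡ link E (f x , f x′) (f y , f y′)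
  link-positions D E f eq x x′ y y′ = link-cong {D = D} {E} (p x y) (p x y′) (p x′ y) (p x′ y′)
    where
    p : ∀ x y → precedes D x y ≡ precedes E (f x) (f y)
    p x y = cong₂ _<ᵇ_ (eq x) (eq y)

  module _ {n} (D : ChordDiagram n) where

    link-swapˡ : ∀ x x′ y y′ → link D (x′ , x) (y , y′) ≡ link D (x , x′) (y , y′)
    link-swapˡ x x′ y y′ = Bool.xor-comm (precedes D x′ y xor precedes D x′ y′) _

    link-swapʳ : ∀ x x′ y y′ → link D (x , x′) (y′ , y) ≡ link D (x , x′) (y , y′)
    link-swapʳ x x′ y y′ = cong₂ _xor_ (Bool.xor-comm (precedes D x y′) _) (Bool.xor-comm (precedes D x′ y′) _)

    link-+ʳ : ∀ a x y z → link D a (x , z) ≡ link D a (x , y) xor link D a (y , z)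
    link-+ʳ (a , a′) x y z = solve₂ 6 (λ p q r s t v → (p ⊹ r) ⊹ (s ⊹ v) ⊜ ((p ⊹ q) ⊹ (s ⊹ t)) ⊹ ((q ⊹ r) ⊹ (t ⊹ v))) refl
      (precedes D a x) (precedes D a y) (precedes D a z) (precedes D a′ x) (precedes D a′ y) (precedes D a′ z)

  transpose-natural : ∀ {m n} (f : Endpoint m → Endpoint n) → Injective _≡_ _≡_ f →
                      ∀ a b x → transposeᴱ (f a) (f b) (f x) ≡ f (transposeᴱ a b x)
  transpose-natural f f-injective a b x with x ≟ᴱ a | x ≟ᴱ b | f x ≟ᴱ f a | f x ≟ᴱ f b
  ... | yes _   | _        | yes _ | _     = refl
  ... | yes x≡a | _        | no ¬p | _     = contradiction (cong f x≡a) ¬p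
  ... | no x≢a  | _        | yes p | _     = contradiction (f-injective p) x≢a
  ... | no _    | yes _    | no _  | yes _ = refl
  ... | no _    | yes x≡b  | no _  | no ¬p = contradiction (cong f x≡b) ¬p
  ... | no _    | no x≢b   | no _  | yes p = contradiction (f-injective p) x≢b
  ... | no _    | no _     | no _  | no _  = refl

  -- Sliding the endpoints of a chord
  module _ {n} (D : ChordDiagram n) where

    before : ℕ → Endpoint n → Bool
    before t x = position D x <ᵇ t

    -- The parity of the number of endpoints of a chord in [s, t).
    row : (s t : ℕ) → Fin n → Bool
    row s t k = (before s (k , false) xor before s (k , true)) xor (before t (k , false) xor before t (k , true))

    -- Ψ of D together with a chord whose endpoints are placed just before s and t.
    extended : (s t : ℕ) → ℤ
    extended s t = Ψ (border (row s t) (links D))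

    -- Ψ of D after its chords through x and y are joined differently, to (x , y)
    -- and (partner x , partner y).
    rejoined : (x y : Endpoint n) → ℤ
    rejoined x y = Ψ (links (exchange (partner x) y D))

    -- Minus the mixed difference of `extended`: with this sign, a quadratic form in T - S yields
    -- plus twice its bilinear form at the increments of S and T.
    secondDifference : (s t : ℕ) → ℤ
    secondDifference s t = (extended s (suc t) - extended (suc s) (suc t)) - (extended s t - extended (suc s) t)

  -- Relabelling, which brings given endpoints to the front

  module Relabel {m n} (D : ChordDiagram n) (π : Permutation m n) (flip : Fin m → Bool) where

    ρ : Endpoint m → Endpoint n
    ρ (k , s) = (π ⟨$⟩ʳ k) , (s xor flip k)

    π-injective : ∀ {k l} → π ⟨$⟩ʳ k ≡ π ⟨$⟩ʳ l → k ≡ l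
    π-injective eq = trans (sym (inverseˡ π)) (trans (cong (π ⟨$⟩ˡ_) eq) (inverseˡ π))

    ρ-injective : ∀ {x y} → ρ x ≡ ρ y → x ≡ y
    ρ-injective {k , s} {l , t} eq with refl ← π-injective {k} {l} (cong proj₁ eq) = cong (k ,_) (xor-cancelʳ (cong proj₂ eq))
      where
      xor-cancelʳ : ∀ {s t f} → s xor f ≡ t xor f → s ≡ t
      xor-cancelʳ {s} {t} {f} eq = trans (solve₂ 2 (λ s f → s ⊜ (s ⊹ f) ⊹ f) refl s f)
        (trans (cong (_xor f) eq) (solve₂ 2 (λ s f → (s ⊹ f) ⊹ f ⊜ s) refl t f))

    relabelled : ChordDiagram m
    relabelled = record { position = position D ∘ ρ ; position-injective = ρ-injective ∘ position-injective D }

    ρ-partner : ∀ x → partner (ρ x) ≡ ρ (partner x)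
    ρ-partner (k , false) = refl
    ρ-partner (k , true)  = cong ((π ⟨$⟩ʳ k) ,_) (Bool.not-involutive (flip k))

  module _ {m n} (π : Permutation m n) (flip : Fin m → Bool) where

    links-relabelled : ∀ (D : ChordDiagram n) k l →
      links (Relabel.relabelled D π flip) k l ≡ links D (π ⟨$⟩ʳ k) (π ⟨$⟩ʳ l)
    links-relabelled D k l = go (flip k) (flip l)
      where
      p q : Bool → Endpoint n
      p s = (π ⟨$⟩ʳ k) , s
      q s = (π ⟨$⟩ʳ l) , s
      go : ∀ a b → link D (p (false xor a) , p (true xor a)) (q (false xor b) , q (true xor b)) ≡ link D (p false , p true) (q false , q true)
      go false false = refl
      go true  false = link-swapˡ D (p false) (p true) (q false) (q true)
      go false true  = link-swapʳ D (p false) (p true) (q false) (q true)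
      go true  true  = trans (link-swapˡ D (p false) (p true) (q true) (q false)) (link-swapʳ D (p false) (p true) (q false) (q true))

    module _ (D : ChordDiagram n) where
      open Relabel D π flip

      Ψ-relabelled : Ψ (links relabelled) ≡ Ψ (links D)
      Ψ-relabelled = Ψ-permute π (λ k l _ → links-relabelled D k l)

      row-relabelled : ∀ s t k → row relabelled s t k ≡ row D s t (π ⟨$⟩ʳ k)
      row-relabelled s t k = cong₂ _xor_ (go s (flip k)) (go t (flip k))
        where
        p : Bool → Endpoint n
        p a = (π ⟨$⟩ʳ k) , a
        go : ∀ t a → before D t (p (false xor a)) xor before D t (p (true xor a)) ≡ before D t (p false) xor before D t (p true)
        go t false = refl
        go t true  = Bool.xor-comm (before D t (p true)) _

      extended-relabelled : ∀ s t → extended relabelled s t ≡ extended D s t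
      extended-relabelled s t = Ψ-permute (Perm.lift₀ π) λ
        { zero    zero    z≢z → contradiction refl z≢z
        ; zero    (suc l) _   → row-relabelled s t l
        ; (suc k) zero    _   → row-relabelled s t k
        ; (suc k) (suc l) _   → links-relabelled D k l }

      rejoined-relabelled : ∀ x y → rejoined relabelled x y ≡ rejoined D (ρ x) (ρ y)
      rejoined-relabelled x y = Ψ-permute π λ k l _ → trans
        (link-positions (exchange (partner x) y relabelled) (Relabel.relabelled (exchange (partner (ρ x)) (ρ y) D) π flip) (λ w → w)
          (λ w → cong (position D) (trans (sym (transpose-natural ρ ρ-injective (partner x) y w)) (cong (λ a → transposeᴱ a (ρ y) (ρ w)) (sym (ρ-partner x))))) _ _ _ _)
        (links-relabelled (exchange (partner (ρ x)) (ρ y) D) k l)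

  front₁ : ∀ {n} (i : Fin (suc n)) → ∃ λ (π : Permutation (suc n) (suc n)) → π ⟨$⟩ʳ zero ≡ i
  front₁ i = Perm.insert zero i Perm.id , refl

  front₂ : ∀ {n} {i j : Fin n} → i ≢ j → ∃ λ m → ∃ λ (π : Permutation (suc (suc m)) n) → π ⟨$⟩ʳ zero ≡ i × π ⟨$⟩ʳ suc zero ≡ j
  front₂ {suc zero}    {zero} {zero} i≢j = contradiction refl i≢j
  front₂ {suc (suc n)} {i}    {j}    i≢j = n , Perm.insert zero i π , refl ,
    trans (Perm.insert-punchIn zero i π zero) (Fin.punchIn-punchOut i≢j)
    where π = Perm.insert zero (punchOut i≢j) Perm.id

  module _ {n} (D : ChordDiagram n) where

    before-self : ∀ x → before D (position D x) x ≡ false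
    before-self x = <ᵇ-false (ℕ.<-irrefl refl)

    before-suc-self : ∀ x → before D (suc (position D x)) x ≡ true
    before-suc-self x = <ᵇ-true ℕ.≤-refl

    before-suc : ∀ {t} x → position D x ≢ t → before D (suc t) x ≡ before D t x
    before-suc x x≢t = <ᵇ-cong (λ { (s≤s x≤t) → ℕ.≤∧≢⇒< x≤t x≢t }) ℕ.m≤n⇒m≤1+n

    before-suc-other : ∀ {x y} → y ≢ x → before D (suc (position D x)) y ≡ precedes D y x
    before-suc-other {y = y} y≢x = before-suc y (y≢x ∘ position-injective D)

  bump : Bool → ℕ → ℕ
  bump false s = s
  bump true  s = suc s

  module _ {n} (D : ChordDiagram n) where

    before-bump : ∀ a {x y} → y ≢ x → before D (bump a (position D x)) y ≡ precedes D y x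
    before-bump false _   = refl
    before-bump true  y≢x = before-suc-other D y≢x

    before-bump-self : ∀ a x → before D (bump a (position D x)) x ≡ a
    before-bump-self false x = before-self D x
    before-bump-self true  x = before-suc-self D x

    -- A chord through neither `x` nor `y` does not notice whether the ends lie just before or just
    -- after these endpoints, so the four corners of a second difference share its adjacency.
    row-bump : ∀ a b {x y} k → k ≢ proj₁ x → k ≢ proj₁ y →
               row D (bump a (position D x)) (bump b (position D y)) k ≡ link D (chord k) (x , y)
    row-bump a b {x} {y} k k≢x k≢y = trans
      (cong₂ _xor_ (cong₂ _xor_ (before-bump a (k≢x ∘ cong proj₁)) (before-bump a (k≢x ∘ cong proj₁)))
                   (cong₂ _xor_ (before-bump b (k≢y ∘ cong proj₁)) (before-bump b (k≢y ∘ cong proj₁))))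
      (solve₂ 4 (λ p q r s → (p ⊹ q) ⊹ (r ⊹ s) ⊜ (p ⊹ r) ⊹ (q ⊹ s)) refl
        (precedes D (k , false) x) (precedes D (k , true) x) (precedes D (k , false) y) (precedes D (k , true) y))

    extended-diagonal : ∀ s → extended D s s ≡ + 2 *ℤ Ψ (links D)
    extended-diagonal s = Ψ-isolated (row D s s) (links D) (λ k → Bool.xor-same (before D s (k , false) xor before D s (k , true)))

    row-suc₀ : ∀ {s} → (∀ x → position D x ≢ s) → ∀ t k → row D (suc s) t k ≡ row D s t k
    row-suc₀ none t k = cong₂ (λ a b → (a xor b) xor _) (before-suc D (k , false) (none _)) (before-suc D (k , true) (none _))

    row-suc₁ : ∀ {t} → (∀ x → position D x ≢ t) → ∀ s k → row D s (suc t) k ≡ row D s t k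
    row-suc₁ none s k = cong₂ (λ a b → (before D s (k , false) xor before D s (k , true)) xor (a xor b))
      (before-suc D (k , false) (none _)) (before-suc D (k , true) (none _))

    extended-cong : ∀ {s s′ t t′} → (∀ k → row D s t k ≡ row D s′ t′ k) → extended D s t ≡ extended D s′ t′
    extended-cong eq = Ψ-cong λ
      { zero    zero    z≢z → contradiction refl z≢z
      ; zero    (suc k) _   → eq k
      ; (suc k) zero    _   → eq k
      ; (suc k) (suc l) _   → refl }

  Ψ-links₁ : ∀ {m} (E : ChordDiagram (suc m)) {r : Fin m → Bool} {M : Matrix₂ m} →
             (∀ k → links E zero (suc k) ≡ r k) → (∀ k l → k ≢ l → links E (suc k) (suc l) ≡ M k l) →
             Ψ (links E) ≡ Ψ (border r M)
  Ψ-links₁ E r≗ M≗ = Ψ-cong λ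
    { zero    zero    z≢z → contradiction refl z≢z
    ; zero    (suc k) _   → r≗ k
    ; (suc k) zero    k≢z → trans (links-sym E k≢z) (r≗ k)
    ; (suc k) (suc l) k≢l → M≗ k l (k≢l ∘ cong suc) }

  Ψ-links₂ : ∀ {m} (E : ChordDiagram (suc (suc m))) {r₀ : Fin (suc m) → Bool} {r₁ : Fin m → Bool} {M : Matrix₂ m} →
             (∀ k → links E zero (suc k) ≡ r₀ k) → (∀ k → links E (suc zero) (suc (suc k)) ≡ r₁ k) →
             (∀ k l → k ≢ l → links E (suc (suc k)) (suc (suc l)) ≡ M k l) → Ψ (links E) ≡ Ψ (border r₀ (border r₁ M))
  Ψ-links₂ E r₀≗ r₁≗ M≗ = Ψ-links₁ E r₀≗ λ
    { zero    zero    z≢z → contradiction refl z≢z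
    ; zero    (suc k) _   → r₁≗ k
    ; (suc k) zero    _   → trans (links-sym E (λ ())) (r₁≗ k)
    ; (suc k) (suc l) k≢l → M≗ k l (k≢l ∘ cong suc) }

  extended-border : ∀ {m} (D : ChordDiagram (suc m)) s t {a} {x : Fin m → Bool} → row D s t zero ≡ a → (∀ k → row D s t (suc k) ≡ x k) →
    extended D s t ≡ Ψ (border (a ∷ᶠ x) (border (λ k → links D zero (suc k)) (λ k l → links D (suc k) (suc l))))
  extended-border D s t a≡ x≗ = Ψ-cong λ
    { zero          zero          z≢z → contradiction refl z≢z
    ; zero          (suc zero)    _   → a≡
    ; zero          (suc (suc k)) _   → x≗ k
    ; (suc zero)    zero          _   → a≡
    ; (suc (suc k)) zero          _   → x≗ k
    ; (suc zero)    (suc zero)    z≢z → contradiction refl z≢z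
    ; (suc zero)    (suc (suc k)) _   → refl
    ; (suc (suc k)) (suc zero)    _   → links-sym D (λ ())
    ; (suc (suc k)) (suc (suc l)) _   → refl }

  module _ {m} (D : ChordDiagram (suc m)) where

    private
      x y : Endpoint (suc m)
      x = zero , false
      y = zero , true
      r : Fin m → Bool
      r k = links D zero (suc k)
      M : Matrix₂ m
      M k l = links D (suc k) (suc l)
      G : Bool → ℤ
      G a = Ψ (border (a ∷ᶠ r) (border r M))

    -- The added chord encloses the single endpoint `x`, so it is a leaf attached to the chord of
    -- `x`.
    extended-suc-front : extended D (position D x) (suc (position D x)) ≡ Ψ (links D)
    extended-suc-front = begin
      extended D s (suc s)
        ≡⟨ extended-border D s (suc s) {true} {λ _ → false}
             (trans (cong₂ (λ a b → (a xor before D s y) xor (b xor before D (suc s) y)) (before-self D x) (before-suc-self D x))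
                    (trans (cong (λ b → before D s y xor (true xor b)) (before-suc-other D {x} {y} (λ ())))
                           (solve₂ 1 (λ a → a ⊹ (con₂ true ⊹ a) ⊜ con₂ true) refl (before D s y))))
             (λ k → trans (cong₂ (λ a b → (before D s (suc k , false) xor before D s (suc k , true)) xor (a xor b))
                                  (before-suc-other D {x} {suc k , false} (λ ())) (before-suc-other D {x} {suc k , true} (λ ())))
                           (Bool.xor-same (before D s (suc k , false) xor before D s (suc k , true)))) ⟩
      Ψ (border (true ∷ᶠ λ _ → false) (border r M))
        ≡⟨ Ψ-leaf (λ _ → false) r M (λ _ → refl) ⟩
      Ψ (border r M)
        ≡⟨ Ψ-links₁ D (λ _ → refl) (λ _ _ _ → refl) ⟨
      Ψ (links D) ∎
      where
      open ≡-Reasoning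
      s = position D x

    -- At all four corners the added chord runs alongside the chord from `x` to `y` and is a twin of
    -- it; moving one end across an endpoint toggles just the adjacency of the two. Each inner
    -- difference is `Ψ-twin` up to sign.
    secondDifference-same-front : position D x < position D y →
      secondDifference D (position D x) (position D y) ≡ + 2 *ℤ Ψ (links D)
    secondDifference-same-front s<t = begin
      (extended D s (suc t) - extended D (suc s) (suc t)) - (extended D s t - extended D (suc s) t)
        ≡⟨ cong₂ _-_ (cong₂ _-_ (corner false true) (corner true true)) (cong₂ _-_ (corner false false) (corner true false)) ⟩
      (G false - G true) - (G true - G false)
        ≡⟨ solve 2 (λ a b → (a :- b) :- (b :- a) := con (+ 2) :* (a :- b)) refl (G false) (G true) ⟩
      + 2 *ℤ (G false - G true)
        ≡⟨ cong (+ 2 *ℤ_) (trans (Ψ-twin r M) (sym (Ψ-links₁ D (λ _ → refl) (λ _ _ _ → refl)))) ⟩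
      + 2 *ℤ Ψ (links D) ∎
      where
      open ≡-Reasoning
      s = position D x
      t = position D y
      corner : ∀ a b → extended D (bump a s) (bump b t) ≡ G (not (a xor b))
      corner a b = extended-border D (bump a s) (bump b t)
        (trans (cong₂ _xor_ (cong₂ _xor_ (before-bump-self D a x) (trans (before-bump D a {x} {y} (λ ())) (<ᵇ-false (ℕ.<-asym s<t))))
                            (cong₂ _xor_ (trans (before-bump D b {y} {x} (λ ())) (<ᵇ-true s<t)) (before-bump-self D b y)))
               (solve₂ 2 (λ a b → (a ⊹ con₂ false) ⊹ (con₂ true ⊹ b) ⊜ con₂ true ⊹ (a ⊹ b)) refl a b))
        (λ k → trans (row-bump D a b (suc k) (λ ()) (λ ())) (links-sym D (λ ())))

  module _ {m} (D : ChordDiagram (suc (suc m))) where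

    open Ψ-crossing D

    private
      M : Matrix₂ m
      M j k = link D (other j) (other k)
      e κ : Bool
      e = link D (u , u*) (v , v*)
      κ = link D (u , v) (u* , v*)

    -- After ū and v are exchanged the two chords are (u, v) and (ū, v̄), those of `rowP`.
    rejoined-P : rejoined D u v ≡ resolved rowP κ
    rejoined-P = Ψ-links₂ (exchange u* v D)
      (λ { zero → refl ; (suc k) → link-sym D (λ ()) (λ ()) (λ ()) (λ ()) })
      (λ k → trans (link-sym D (λ ()) (λ ()) (λ ()) (λ ()))
        (trans (link-+ʳ D (other k) u* u v*) (trans (cong₂ _xor_ (link-swapʳ D _ _ u u*) (trans (link-+ʳ D (other k) u v v*) refl))
          (solve₂ 3 (λ x y z → y ⊹ (x ⊹ z) ⊜ x ⊹ (y ⊹ z)) refl (x k) (y k) (z k)))))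
      (λ _ _ _ → refl)

    rejoined-C : rejoined D u v* ≡ resolved rowC (not (e xor κ))
    rejoined-C = Ψ-links₂ (exchange u* v* D)
      (λ { zero → trans (link-swapʳ D u v* u* v) (link-pairings D)
         ; (suc k) → trans (link-sym D (λ ()) (λ ()) (λ ()) (λ ())) (link-+ʳ D (other k) u v v*) })
      (λ k → trans (link-sym D (λ ()) (λ ()) (λ ()) (λ ())) (trans (link-+ʳ D (other k) v u u*)
        (cong (_xor y k) (link-swapʳ D _ _ u v))))
      (λ _ _ _ → refl)

    secondDifference-front : position D u < position D v →
      secondDifference D (position D u) (position D v) ≡ rejoined D u v - rejoined D u v*
    secondDifference-front s<t = begin
      (extended D s (suc t) - extended D (suc s) (suc t)) - (extended D s t - extended D (suc s) t)
        ≡⟨ cong₂ _-_ (cong₂ _-_ (corner false true) (corner true true)) (cong₂ _-_ (corner false false) (corner true false)) ⟩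
      (G τ₀ (true xor τ₁) - G (true xor τ₀) (true xor τ₁)) - (G τ₀ τ₁ - G (true xor τ₀) τ₁)
        ≡⟨ solve 4 (λ a b c d → (a :- b) :- (c :- d) := :- ((c :- a) :- (d :- b))) refl
             (G τ₀ (true xor τ₁)) (G (true xor τ₀) (true xor τ₁)) (G τ₀ τ₁) (G (true xor τ₀) τ₁) ⟩
      - ((G τ₀ τ₁ - G τ₀ (true xor τ₁)) - (G (true xor τ₀) τ₁ - G (true xor τ₀) (true xor τ₁)))
        ≡⟨ cong -_ (sym (Δ-def² (λ a b → G (a xor τ₀) (b xor τ₁)))) ⟩
      - (Δ λ a → Δ λ b → G (a xor τ₀) (b xor τ₁))
        ≡⟨ cong -_ (Δ-shift τ₀ λ a → Δ-shift τ₁ {b = false} λ b → refl) ⟩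
      - sgn (τ₀ xor (τ₁ xor false)) (Δ λ a → Δ λ b → G a b)
        ≡⟨ sgn-xor true (τ₀ xor (τ₁ xor false)) _ ⟩
      sgn (true xor (τ₀ xor (τ₁ xor false))) (Δ λ a → Δ λ b → G a b)
        -- The origin of `sgn κ` in `Relation`: the minus sign and the translation by the
        -- adjacencies (τ₀, τ₁) at the corner (s, t) combine to κ = 1 + τ₀ + τ₁.
        ≡⟨ cong (λ b → sgn b (Δ λ a → Δ λ b → G a b)) κ≡ ⟩
      sgn κ (Δ λ a → Δ λ b → G a b)
        ≡⟨ Ψ-crossing ⟩
      resolved rowP κ - resolved rowC (not (e xor κ))
        ≡⟨ cong₂ _-_ rejoined-P rejoined-C ⟨
      rejoined D u v - rejoined D u v* ∎
      where
      open ≡-Reasoning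
      s = position D u
      t = position D v
      G : Bool → Bool → ℤ
      G ε ε′ = Ψ (border (ε ∷ᶠ ε′ ∷ᶠ x) (border (e ∷ᶠ y) (border z M)))
      τ₀ τ₁ : Bool
      τ₀ = precedes D u* u xor (true xor precedes D u* v)
      τ₁ = precedes D v* u xor precedes D v* v
      κ≡ : true xor (τ₀ xor (τ₁ xor false)) ≡ κ
      κ≡ = sym (trans (cong₂ _xor_ (cong₂ _xor_ (precedes-flip D {u*} {u} (λ ())) (precedes-flip D {v*} {u} (λ ())))
                                   (cong₂ _xor_ (precedes-flip D {u*} {v} (λ ())) (precedes-flip D {v*} {v} (λ ()))))
        (solve₂ 4 (λ a b c d → ((con₂ true ⊹ a) ⊹ (con₂ true ⊹ b)) ⊹ ((con₂ true ⊹ c) ⊹ (con₂ true ⊹ d)) ⊜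
           con₂ true ⊹ ((a ⊹ (con₂ true ⊹ c)) ⊹ ((b ⊹ d) ⊹ con₂ false))) refl
          (precedes D u* u) (precedes D v* u) (precedes D u* v) (precedes D v* v)))
      corner : ∀ a b → extended D (bump a s) (bump b t) ≡ G (a xor τ₀) (b xor τ₁)
      corner a b = trans (extended-border D (bump a s) (bump b t) {a xor τ₀} {(b xor τ₁) ∷ᶠ x}
          (trans (cong₂ _xor_ (cong₂ _xor_ (before-bump-self D a u) (before-bump D a {u} {u*} (λ ())))
                              (cong₂ _xor_ (trans (before-bump D b {v} {u} (λ ())) (<ᵇ-true s<t)) (before-bump D b {v} {u*} (λ ()))))
                 (Bool.xor-assoc a (precedes D u* u) _))
          (λ { zero → trans (cong₂ _xor_ (cong₂ _xor_ (trans (before-bump D a {u} {v} (λ ())) (<ᵇ-false (ℕ.<-asym s<t))) (before-bump D a {u} {v*} (λ ())))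
                              (cong₂ _xor_ (before-bump-self D b v) (before-bump D b {v} {v*} (λ ()))))
                        (solve₂ 3 (λ b p q → (con₂ false ⊹ p) ⊹ (b ⊹ q) ⊜ b ⊹ (p ⊹ q)) refl b (precedes D v* u) (precedes D v* v))
             ; (suc k) → row-bump D a b (suc (suc k)) (λ ()) (λ ()) }))
        (Ψ-cong λ
          { zero zero _ → refl
          ; zero (suc _) _ → refl
          ; (suc _) zero _ → refl
          ; (suc zero) (suc zero) z≢z → contradiction refl z≢z
          ; (suc zero) (suc (suc zero)) _ → refl
          ; (suc zero) (suc (suc (suc k))) _ → links-sym D (λ ())
          ; (suc (suc zero)) (suc zero) _ → refl
          ; (suc (suc zero)) (suc (suc zero)) z≢z → contradiction refl z≢z
          ; (suc (suc zero)) (suc (suc (suc k))) _ → links-sym D (λ ())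
          ; (suc (suc (suc k))) (suc zero) _ → links-sym D (λ ())
          ; (suc (suc (suc k))) (suc (suc zero)) _ → refl
          ; (suc (suc (suc k))) (suc (suc (suc l))) _ → refl })

  -- Both sides join the same four points in the same way; only the names of the two new chords are
  -- exchanged.
  rejoined-flip-front : ∀ {m} (D : ChordDiagram (suc (suc m))) → rejoined D u* v* ≡ rejoined D u v
  rejoined-flip-front D = Ψ-permute (Perm.swap Perm.id) λ
    { zero          zero          z≢z → contradiction refl z≢z
    ; zero          (suc zero)    _   → trans (link-swapˡ D u* v* v u) (link-swapʳ D u* v* u v)
    ; zero          (suc (suc l)) _   → link-swapˡ D u* v* _ _
    ; (suc zero)    zero          _   → trans (link-swapˡ D u v v* u*) (link-swapʳ D u v u* v*)
    ; (suc zero)    (suc zero)    z≢z → contradiction refl z≢z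
    ; (suc zero)    (suc (suc l)) _   → link-swapˡ D u v _ _
    ; (suc (suc k)) zero          _   → link-swapʳ D _ _ u* v*
    ; (suc (suc k)) (suc zero)    _   → link-swapʳ D _ _ u v
    ; (suc (suc k)) (suc (suc l)) _   → refl }

  secondDifference-relabelled : ∀ {m n} (π : Permutation m n) flip (D : ChordDiagram n) s t →
    secondDifference (Relabel.relabelled D π flip) s t ≡ secondDifference D s t
  secondDifference-relabelled π flip D s t = cong₂ _-_
    (cong₂ _-_ (extended-relabelled π flip D s (suc t)) (extended-relabelled π flip D (suc s) (suc t)))
    (cong₂ _-_ (extended-relabelled π flip D s t) (extended-relabelled π flip D (suc s) t))

  module _ {n} (D : ChordDiagram n) where

    secondDifference-distinct : ∀ x y → proj₁ x ≢ proj₁ y → position D x < position D y →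
      secondDifference D (position D x) (position D y) ≡ rejoined D x y - rejoined D x (partner y)
    secondDifference-distinct (i , b) (j , c) i≢j = go (front₂ i≢j)
      where
      go : (∃ λ m → ∃ λ (π : Permutation (suc (suc m)) n) → π ⟨$⟩ʳ zero ≡ i × π ⟨$⟩ʳ suc zero ≡ j) →
           position D (i , b) < position D (j , c) →
           secondDifference D (position D (i , b)) (position D (j , c)) ≡ rejoined D (i , b) (j , c) - rejoined D (i , b) (j , not c)
      go (m , π , refl , refl) lt = trans (sym (secondDifference-relabelled π flip D _ _))
        (trans (secondDifference-front (Relabel.relabelled D π flip) lt)
               (cong₂ _-_ (rejoined-relabelled π flip D u v) (rejoined-relabelled π flip D u v*)))
        where
        flip : Fin (suc (suc m)) → Bool
        flip = b ∷ᶠ c ∷ᶠ (λ _ → false)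

    rejoined-flip : ∀ x y → proj₁ x ≢ proj₁ y → rejoined D (partner x) (partner y) ≡ rejoined D x y
    rejoined-flip (i , b) (j , c) i≢j = go (front₂ i≢j)
      where
      go : (∃ λ m → ∃ λ (π : Permutation (suc (suc m)) n) → π ⟨$⟩ʳ zero ≡ i × π ⟨$⟩ʳ suc zero ≡ j) →
           rejoined D (i , not b) (j , not c) ≡ rejoined D (i , b) (j , c)
      go (m , π , refl , refl) = trans (sym (rejoined-relabelled π flip D u* v*))
        (trans (rejoined-flip-front (Relabel.relabelled D π flip)) (rejoined-relabelled π flip D u v))
        where
        flip : Fin (suc (suc m)) → Bool
        flip = b ∷ᶠ c ∷ᶠ (λ _ → false)

    transpose-comm : ∀ (a b x : Endpoint n) → transposeᴱ a b x ≡ transposeᴱ b a x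
    transpose-comm a b x with x ≟ᴱ a | x ≟ᴱ b
    ... | yes x≡a | yes x≡b = trans (sym x≡b) x≡a
    ... | yes _   | no _    = refl
    ... | no _    | yes _   = refl
    ... | no _    | no _    = refl

    partner-involutive : ∀ (x : Endpoint n) → partner (partner x) ≡ x
    partner-involutive (i , b) = cong (i ,_) (Bool.not-involutive b)

    rejoined-comm : ∀ x y → proj₁ x ≢ proj₁ y → rejoined D y x ≡ rejoined D x y
    rejoined-comm x y x≢y = trans
      (Ψ-cong λ k l _ → link-positions (exchange (partner y) x D) (exchange (partner (partner x)) (partner y) D) (λ w → w)
        (λ w → cong (position D) (trans (transpose-comm (partner y) x w) (cong (λ a → transposeᴱ a (partner y) w) (sym (partner-involutive x))))) _ _ _ _)
      (rejoined-flip x y x≢y)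

  module _ {n} (D : ChordDiagram (suc n)) where

    secondDifference-same : ∀ x → position D x < position D (partner x) →
      secondDifference D (position D x) (position D (partner x)) ≡ + 2 *ℤ Ψ (links D)
    secondDifference-same (i , b) = go (front₁ i)
      where
      go : (∃ λ (π : Permutation (suc n) (suc n)) → π ⟨$⟩ʳ zero ≡ i) → position D (i , b) < position D (i , not b) →
           secondDifference D (position D (i , b)) (position D (i , not b)) ≡ + 2 *ℤ Ψ (links D)
      go (π , refl) lt = trans (sym (secondDifference-relabelled π flip D _ _))
        (trans (secondDifference-same-front (Relabel.relabelled D π flip) lt) (cong (+ 2 *ℤ_) (Ψ-relabelled π flip D)))
        where
        flip : Fin (suc n) → Bool
        flip = b ∷ᶠ (λ _ → false)

    extended-suc : ∀ x → extended D (position D x) (suc (position D x)) ≡ Ψ (links D)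
    extended-suc (i , b) = go (front₁ i)
      where
      go : (∃ λ (π : Permutation (suc n) (suc n)) → π ⟨$⟩ʳ zero ≡ i) →
           extended D (position D (i , b)) (suc (position D (i , b))) ≡ Ψ (links D)
      go (π , refl) = trans (sym (extended-relabelled π flip D _ _))
        (trans (extended-suc-front (Relabel.relabelled D π flip)) (Ψ-relabelled π flip D))
        where
        flip : Fin (suc n) → Bool
        flip = b ∷ᶠ (λ _ → false)

  -- Second differences of a quadratic form

  [_] : Bool → ℤ
  [ false ] = + 0
  [ true  ] = + 1

  ∑-zero : ∀ {n} {f : Fin n → ℤ} → (∀ i → f i ≡ + 0) → ∑ f ≡ + 0
  ∑-zero {n} f≗0 = trans (∑-cong f≗0) (∑-replicate-zero n)

  ∑-- : ∀ {n} (f g : Fin n → ℤ) → ∑ f - ∑ g ≡ ∑ (λ i → f i - g i)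
  ∑-- {zero}  f g = refl
  ∑-- {suc n} f g = trans (solve 4 (λ a b c d → (a :+ b) :- (c :+ d) := (a :- c) :+ (b :- d)) refl (f zero) (∑ (f ∘ suc)) (g zero) (∑ (g ∘ suc)))
                          (cong ((f zero - g zero) +ℤ_) (∑-- (f ∘ suc) (g ∘ suc)))

  ∑-+ : ∀ {n} (f g : Fin n → ℤ) → ∑ f +ℤ ∑ g ≡ ∑ (λ i → f i +ℤ g i)
  ∑-+ {zero}  f g = refl
  ∑-+ {suc n} f g = trans (solve 4 (λ a b c d → (a :+ b) :+ (c :+ d) := (a :+ c) :+ (b :+ d)) refl (f zero) (∑ (f ∘ suc)) (g zero) (∑ (g ∘ suc)))
                          (cong ((f zero +ℤ g zero) +ℤ_) (∑-+ (f ∘ suc) (g ∘ suc)))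

  ∑∑-- : ∀ {m n} (f g : Fin m → Fin n → ℤ) → ∑ (λ i → ∑ (f i)) - ∑ (λ i → ∑ (g i)) ≡ ∑ (λ i → ∑ (λ j → f i j - g i j))
  ∑∑-- f g = trans (∑-- (λ i → ∑ (f i)) (λ i → ∑ (g i))) (∑-cong λ i → ∑-- (f i) (g i))

  ∑∑-+ : ∀ {m n} (f g : Fin m → Fin n → ℤ) → ∑ (λ i → ∑ (f i)) +ℤ ∑ (λ i → ∑ (g i)) ≡ ∑ (λ i → ∑ (λ j → f i j +ℤ g i j))
  ∑∑-+ f g = trans (∑-+ (λ i → ∑ (f i)) (λ i → ∑ (g i))) (∑-cong λ i → ∑-+ (f i) (g i))

  ∑-select : ∀ {n} (f : Fin n → ℤ) i → ∑ (λ k → f k *ℤ [ k == i ]) ≡ f i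
  ∑-select {suc n} f zero = trans
    (cong₂ _+ℤ_ (ℤ.*-identityʳ (f zero)) (∑-zero (λ k → ℤ.*-zeroʳ (f (suc k))))) (ℤ.+-identityʳ (f zero))
  ∑-select {suc n} f (suc i) = trans
    (cong₂ _+ℤ_ (ℤ.*-zeroʳ (f zero)) (∑-select (f ∘ suc) i)) (ℤ.+-identityˡ (f (suc i)))

  module _ {n} (δ : Fin n → Fin n → ℤ) where

    form : (X Y : Fin n → ℤ) → ℤ
    form X Y = ∑ λ i → ∑ λ j → δ i j *ℤ (X i *ℤ Y j)

    form-cong : ∀ {X X′ Y Y′} → X ≗ X′ → Y ≗ Y′ → form X Y ≡ form X′ Y′
    form-cong X≗ Y≗ = ∑-cong λ i → ∑-cong λ j → cong₂ (λ a b → δ i j *ℤ (a *ℤ b)) (X≗ i) (Y≗ j)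

    form-zeroˡ : ∀ {X} Y → (∀ i → X i ≡ + 0) → form X Y ≡ + 0
    form-zeroˡ Y X₀ = ∑-zero λ i → ∑-zero λ j → trans (cong (λ a → δ i j *ℤ (a *ℤ Y j)) (X₀ i)) (ℤ.*-zeroʳ (δ i j))

    form-zeroʳ : ∀ X {Y} → (∀ i → Y i ≡ + 0) → form X Y ≡ + 0
    form-zeroʳ X Y₀ = ∑-zero λ i → ∑-zero λ j → trans (cong (λ a → δ i j *ℤ (X i *ℤ a)) (Y₀ j)) (trans (cong (δ i j *ℤ_) (ℤ.*-zeroʳ (X i))) (ℤ.*-zeroʳ (δ i j)))

    form-select : ∀ σ τ i j → form (λ k → σ *ℤ [ k == i ]) (λ k → τ *ℤ [ k == j ]) ≡ δ i j *ℤ (σ *ℤ τ)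
    form-select σ τ i j = trans
      (∑-cong λ k → trans (∑-cong λ l → solve 5 (λ d s a t b → d :* ((s :* a) :* (t :* b)) := (d :* (s :* t) :* a) :* b) refl (δ k l) σ [ k == i ] τ [ l == j ])
                          (∑-select (λ l → δ k l *ℤ (σ *ℤ τ) *ℤ [ k == i ]) j))
      (∑-select (λ k → δ k j *ℤ (σ *ℤ τ)) i)

    module _ (δ-sym : ∀ i j → δ i j ≡ δ j i) where

      form-sym : ∀ X Y → form X Y ≡ form Y X
      form-sym X Y = trans (∑-swap (λ i j → δ i j *ℤ (X i *ℤ Y j)))
        (∑-cong λ j → ∑-cong λ i → cong₂ _*ℤ_ (δ-sym i j) (ℤ.*-comm (X i) (Y j)))

      square : (X Y : Fin n → ℤ) → ℤ
      square X Y = form (λ k → Y k - X k) (λ k → Y k - X k)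

      -- Polarisation: only the terms mixing the increments of S and T survive, and they occur twice
      -- by symmetry.
      square-secondDifference : ∀ S S′ T T′ →
        (square S T′ - square S′ T′) - (square S T - square S′ T) ≡
        + 2 *ℤ form (λ k → S′ k - S k) (λ k → T′ k - T k)
      square-secondDifference S S′ T T′ = begin
        (square S T′ - square S′ T′) - (square S T - square S′ T)
          ≡⟨ trans (cong₂ _-_ (∑∑-- (entry S T′) (entry S′ T′)) (∑∑-- (entry S T) (entry S′ T)))
                   (∑∑-- (λ i j → entry S T′ i j - entry S′ T′ i j) (λ i j → entry S T i j - entry S′ T i j)) ⟩
        (∑ λ i → ∑ λ j →
          (δ i j *ℤ ((T′ i - S i) *ℤ (T′ j - S j)) - δ i j *ℤ ((T′ i - S′ i) *ℤ (T′ j - S′ j))) -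
          (δ i j *ℤ ((T i - S i) *ℤ (T j - S j)) - δ i j *ℤ ((T i - S′ i) *ℤ (T j - S′ j))))
          ≡⟨ (∑-cong λ i → ∑-cong λ j → solve 9 (λ d si s′i ti t′i sj s′j tj t′j →
               (d :* ((t′i :- si) :* (t′j :- sj)) :- d :* ((t′i :- s′i) :* (t′j :- s′j))) :-
               (d :* ((ti :- si) :* (tj :- sj)) :- d :* ((ti :- s′i) :* (tj :- s′j))) :=
               d :* ((s′i :- si) :* (t′j :- tj)) :+ d :* ((t′i :- ti) :* (s′j :- sj))) refl
               (δ i j) (S i) (S′ i) (T i) (T′ i) (S j) (S′ j) (T j) (T′ j)) ⟩
        (∑ λ i → ∑ λ j → δ i j *ℤ ((S′ i - S i) *ℤ (T′ j - T j)) +ℤ δ i j *ℤ ((T′ i - T i) *ℤ (S′ j - S j)))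
          ≡⟨ ∑∑-+ (λ i j → δ i j *ℤ (dS i *ℤ dT j)) (λ i j → δ i j *ℤ (dT i *ℤ dS j)) ⟨
        form dS dT +ℤ form dT dS
          ≡⟨ cong (form dS dT +ℤ_) (form-sym dT dS) ⟩
        form dS dT +ℤ form dS dT
          ≡⟨ solve 1 (λ a → a :+ a := con (+ 2) :* a) refl (form dS dT) ⟩
        + 2 *ℤ form dS dT ∎
        where
        open ≡-Reasoning
        dS dT : Fin n → ℤ
        dS k = S′ k - S k
        dT k = T′ k - T k
        entry : (X Y : Fin n → ℤ) → Fin n → Fin n → ℤ
        entry X Y i j = δ i j *ℤ ((Y i - X i) *ℤ (Y j - X j))

  module _ {n} (D : ChordDiagram n) where

    count : ℕ → Fin n → ℤ
    count t k = [ before D t (k , false) ] - [ before D t (k , true) ]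

    -- Coefficients of the form, read off the second differences at two first endpoints. On the
    -- diagonal the two endpoints of one chord count with opposite signs, so the second difference
    -- 2Ψ becomes -2Ψ.
    δ : Fin n → Fin n → ℤ
    δ i j = if i == j then - (+ 2 *ℤ Ψ (links D)) else rejoined D (i , false) (j , false) - rejoined D (i , false) (j , true)

    δ-diagonal : ∀ i → δ i i ≡ - (+ 2 *ℤ Ψ (links D))
    δ-diagonal i = cong (λ b → if b then - (+ 2 *ℤ Ψ (links D)) else rejoined D (i , false) (i , false) - rejoined D (i , false) (i , true)) (==-refl i)

    δ-off : ∀ {i j} → i ≢ j → δ i j ≡ rejoined D (i , false) (j , false) - rejoined D (i , false) (j , true)
    δ-off {i} {j} i≢j = cong (λ b → if b then - (+ 2 *ℤ Ψ (links D)) else rejoined D (i , false) (j , false) - rejoined D (i , false) (j , true)) (==-false i≢j)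

    δ-sym : ∀ i j → δ i j ≡ δ j i
    δ-sym i j = go (i Fin.≟ j)
      where
      go : Dec (i ≡ j) → δ i j ≡ δ j i
      go (yes refl) = refl
      go (no i≢j)   = trans (δ-off i≢j) (trans
        (cong₂ _-_ (rejoined-comm D (j , false) (i , false) (i≢j ∘ sym))
                   (trans (sym (rejoined-flip D (i , false) (j , true) i≢j)) (rejoined-comm D (j , false) (i , true) (i≢j ∘ sym))))
        (sym (δ-off (i≢j ∘ sym))))

    orientation : Bool → ℤ
    orientation false = + 1
    orientation true  = - (+ 1)

    -- Replacing one endpoint by its partner exchanges the two ways of rejoining, and replacing both
    -- changes nothing; the product of the orientations obeys the same rule.
    δ-oriented : ∀ {i j} → i ≢ j → ∀ b c →
      rejoined D (i , b) (j , c) - rejoined D (i , b) (j , not c) ≡ δ i j *ℤ (orientation b *ℤ orientation c)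
    δ-oriented {i} {j} i≢j b c = trans (go b c) (cong (_*ℤ (orientation b *ℤ orientation c)) (sym (δ-off i≢j)))
      where
      r : Bool → Bool → ℤ
      r b c = rejoined D (i , b) (j , c)
      flipped : ∀ b c → r (not b) (not c) ≡ r b c
      flipped b c = rejoined-flip D (i , b) (j , c) i≢j
      go : ∀ b c → r b c - r b (not c) ≡ (r false false - r false true) *ℤ (orientation b *ℤ orientation c)
      go false false = solve 2 (λ a b → a :- b := (a :- b) :* con (+ 1)) refl (r false false) (r false true)
      go false true  = solve 2 (λ a b → b :- a := (a :- b) :* con (- (+ 1))) refl (r false false) (r false true)
      go true  false = trans (cong₂ _-_ (flipped false true) (flipped false false))
        (solve 2 (λ a b → b :- a := (a :- b) :* con (- (+ 1))) refl (r false false) (r false true))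
      go true  true  = trans (cong₂ _-_ (flipped false false) (flipped false true))
        (solve 2 (λ a b → a :- b := (a :- b) :* con (+ 1)) refl (r false false) (r false true))

    step : ℕ → Fin n → ℤ
    step t k = count (suc t) k - count t k

    step-none : ∀ {t} → (∀ x → position D x ≢ t) → ∀ k → step t k ≡ + 0
    step-none none k = trans (cong (_- count _ k) (cong₂ (λ a b → [ a ] - [ b ]) (before-suc D (k , false) (none _)) (before-suc D (k , true) (none _))))
                             (ℤ.+-inverseʳ (count _ k))

    step-at : ∀ i b k → step (position D (i , b)) k ≡ orientation b *ℤ [ k == i ]
    step-at i b k = go (k Fin.≟ i) b
      where
      go : Dec (k ≡ i) → ∀ b → step (position D (i , b)) k ≡ orientation b *ℤ [ k == i ]
      go (yes refl) false = trans
        (cong₂ (λ p q → ([ p ] - [ q ]) - count (position D (i , false)) i) (before-suc-self D (i , false)) (before-suc-other D {i , false} {i , true} (λ ())))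
        (trans (cong (λ p → (+ 1 - [ before D (position D (i , false)) (i , true) ]) - ([ p ] - [ before D (position D (i , false)) (i , true) ])) (before-self D (i , false)))
          (trans (solve 1 (λ a → (con (+ 1) :- a) :- (con (+ 0) :- a) := con (+ 1)) refl [ before D (position D (i , false)) (i , true) ])
                 (cong (λ p → + 1 *ℤ [ p ]) (sym (==-refl i)))))
      go (yes refl) true = trans
        (cong₂ (λ p q → ([ p ] - [ q ]) - count (position D (i , true)) i) (before-suc-other D {i , true} {i , false} (λ ())) (before-suc-self D (i , true)))
        (trans (cong (λ p → ([ before D (position D (i , true)) (i , false) ] - + 1) - ([ before D (position D (i , true)) (i , false) ] - [ p ])) (before-self D (i , true)))
          (trans (solve 1 (λ a → (a :- con (+ 1)) :- (a :- con (+ 0)) := con (- (+ 1))) refl [ before D (position D (i , true)) (i , false) ])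
                 (cong (λ p → - (+ 1) *ℤ [ p ]) (sym (==-refl i)))))
      go (no k≢i) b = trans
        (cong₂ (λ p q → ([ p ] - [ q ]) - count (position D (i , b)) k) (before-suc-other D (chord-≢ k≢i)) (before-suc-other D (chord-≢ k≢i)))
        (trans (ℤ.+-inverseʳ (count (position D (i , b)) k))
          (sym (trans (cong (λ p → orientation b *ℤ [ p ]) (==-false k≢i)) (ℤ.*-zeroʳ (orientation b)))))

    occupied? : ∀ t → Dec (∃ λ x → position D x ≡ t)
    occupied? t = map′ (λ { (k , inj₁ eq) → (k , false) , eq ; (k , inj₂ eq) → (k , true) , eq })
                       (λ { ((k , false) , eq) → k , inj₁ eq ; ((k , true) , eq) → k , inj₂ eq })
                       (Fin.any? (λ k → (position D (k , false) ℕ.≟ t) ⊎-dec (position D (k , true) ℕ.≟ t)))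

    -- Both sides vanish unless `s` and `t` are positions of endpoints. If they are, each increment
    -- has a single non-zero coordinate, equal to ±1, and the form reduces to one entry of `δ`.
    secondDifference-form : ∀ {s t} → s < t → secondDifference D s t ≡ form δ (step s) (step t)
    secondDifference-form {s} {t} s<t = go (occupied? s) (occupied? t)
      where
      opposite-ends : ∀ i b c → position D (i , b) < position D (i , c) → c ≡ not b
      opposite-ends i false false lt = contradiction lt (ℕ.<-irrefl refl)
      opposite-ends i false true  _  = refl
      opposite-ends i true  false _  = refl
      opposite-ends i true  true  lt = contradiction lt (ℕ.<-irrefl refl)

      ends : ∀ x y → position D x < position D y → Dec (proj₁ x ≡ proj₁ y) →
             secondDifference D (position D x) (position D y) ≡ δ (proj₁ x) (proj₁ y) *ℤ (orientation (proj₂ x) *ℤ orientation (proj₂ y))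
      ends (i , b) (j , c) lt (no i≢j) = trans (secondDifference-distinct D (i , b) (j , c) i≢j lt) (δ-oriented i≢j b c)
      ends (i , b) (.i , c) lt (yes refl) = same i b c (opposite-ends i b c lt) lt
        where
        same : ∀ i b c → c ≡ not b → position D (i , b) < position D (i , c) →
               secondDifference D (position D (i , b)) (position D (i , c)) ≡ δ i i *ℤ (orientation b *ℤ orientation c)
        same i b .(not b) refl lt = trans (at D i b lt) (trans (sign b) (cong (_*ℤ (orientation b *ℤ orientation (not b))) (sym (δ-diagonal i))))
          where
          at : ∀ {n} (D : ChordDiagram n) i b → position D (i , b) < position D (i , not b) →
               secondDifference D (position D (i , b)) (position D (i , not b)) ≡ + 2 *ℤ Ψ (links D)
          at {suc n} D i b lt = secondDifference-same D (i , b) lt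
          sign : ∀ b → + 2 *ℤ Ψ (links D) ≡ - (+ 2 *ℤ Ψ (links D)) *ℤ (orientation b *ℤ orientation (not b))
          sign false = solve 1 (λ a → con (+ 2) :* a := (:- (con (+ 2) :* a)) :* con (- (+ 1))) refl (Ψ (links D))
          sign true  = solve 1 (λ a → con (+ 2) :* a := (:- (con (+ 2) :* a)) :* con (- (+ 1))) refl (Ψ (links D))

      go : Dec (∃ λ x → position D x ≡ s) → Dec (∃ λ y → position D y ≡ t) → secondDifference D s t ≡ form δ (step s) (step t)
      go (no none) _ = trans
        (cong₂ _-_ (cong (λ a → extended D s (suc t) - a) (extended-cong D (row-suc₀ D (λ x eq → none (x , eq)) (suc t))))
                   (cong (λ a → extended D s t - a) (extended-cong D (row-suc₀ D (λ x eq → none (x , eq)) t))))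
        (trans (solve 2 (λ a b → (a :- a) :- (b :- b) := con (+ 0)) refl (extended D s (suc t)) (extended D s t))
               (sym (form-zeroˡ δ (step t) (step-none (λ x eq → none (x , eq))))))
      go (yes _) (no none) = trans
        (cong₂ _-_ (cong₂ _-_ (extended-cong D (row-suc₁ D (λ x eq → none (x , eq)) s)) (extended-cong D (row-suc₁ D (λ x eq → none (x , eq)) (suc s)))) refl)
        (trans (ℤ.+-inverseʳ (extended D s t - extended D (suc s) t))
               (sym (form-zeroʳ δ (step s) (step-none (λ x eq → none (x , eq))))))
      go (yes (x , refl)) (yes (y , refl)) = trans (ends x y s<t (proj₁ x Fin.≟ proj₁ y)) (sym (trans
        (form-cong δ (step-at (proj₁ x) (proj₂ x)) (step-at (proj₁ y) (proj₂ y)))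
        (form-select δ (orientation (proj₂ x)) (orientation (proj₂ y)) (proj₁ x) (proj₁ y))))

    -- Both sides have the same second differences in (s , t).
    extended-square : ∀ d {s t} → t ≡ d + s → + 2 *ℤ extended D s t ≡ + 4 *ℤ Ψ (links D) +ℤ square δ δ-sym (count s) (count t)
    extended-square zero {s} refl = trans (cong (+ 2 *ℤ_) (extended-diagonal D s)) (trans
      (solve 1 (λ a → con (+ 2) :* (con (+ 2) :* a) := con (+ 4) :* a :+ con (+ 0)) refl (Ψ (links D)))
      (cong (+ 4 *ℤ Ψ (links D) +ℤ_) (sym (form-zeroˡ δ (λ k → count s k - count s k) (λ k → ℤ.+-inverseʳ (count s k))))))
    -- Second differences are known only for s < t, so distance 1 is a base case of its own; the
    -- added chord then encloses at most one endpoint.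
    extended-square (suc zero) {s} refl = go (occupied? s)
      where
      go : Dec (∃ λ x → position D x ≡ s) → + 2 *ℤ extended D s (suc s) ≡ + 4 *ℤ Ψ (links D) +ℤ square δ δ-sym (count s) (count (suc s))
      go (no none) = trans (cong (+ 2 *ℤ_) (trans (extended-cong D (row-suc₁ D (λ x eq → none (x , eq)) s)) (extended-diagonal D s))) (trans
        (solve 1 (λ a → con (+ 2) :* (con (+ 2) :* a) := con (+ 4) :* a :+ con (+ 0)) refl (Ψ (links D)))
        (cong (+ 4 *ℤ Ψ (links D) +ℤ_) (sym (form-zeroˡ δ (step s) (step-none (λ x eq → none (x , eq)))))))
      go (yes ((i , b) , refl)) = trans (cong (+ 2 *ℤ_) (at D i b)) (trans
        (solve 1 (λ a → con (+ 2) :* a := con (+ 4) :* a :+ :- (con (+ 2) :* a)) refl (Ψ (links D)))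
        (cong (+ 4 *ℤ Ψ (links D) +ℤ_) (sym (trans (form-cong δ (step-at i b) (step-at i b))
          (trans (form-select δ (orientation b) (orientation b) i i) (trans (cong₂ _*ℤ_ (δ-diagonal i) (unit b)) (ℤ.*-identityʳ _)))))))
        where
        at : ∀ {n} (D : ChordDiagram n) i b → extended D (position D (i , b)) (suc (position D (i , b))) ≡ Ψ (links D)
        at {suc n} D i b = extended-suc D (i , b)
        unit : ∀ b → orientation b *ℤ orientation b ≡ + 1
        unit false = refl
        unit true  = refl
    -- With t = s + d + 1 the corners (s + 1, t), (s, t) and (s + 1, t + 1) have distances d, d + 1
    -- and d + 1; the second difference gives the fourth corner (s, t + 1).
    extended-square (suc (suc d)) {s} refl = begin
      + 2 *ℤ extended D s (suc t)
        ≡⟨ solve 4 (λ a b c e → con (+ 2) :* a := con (+ 2) :* ((a :- b) :- (c :- e)) :+ ((con (+ 2) :* b :+ con (+ 2) :* c) :- con (+ 2) :* e)) refl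
             (extended D s (suc t)) (extended D (suc s) (suc t)) (extended D s t) (extended D (suc s) t) ⟩
      + 2 *ℤ secondDifference D s t +ℤ ((+ 2 *ℤ extended D (suc s) (suc t) +ℤ + 2 *ℤ extended D s t) - + 2 *ℤ extended D (suc s) t)
        ≡⟨ cong₂ _+ℤ_ (trans (cong (+ 2 *ℤ_) (secondDifference-form (s≤s (ℕ.m≤n+m s d)))) (sym (square-secondDifference δ δ-sym (count s) (count (suc s)) (count t) (count (suc t)))))
             (cong₂ _-_ (cong₂ _+ℤ_ (extended-square (suc d) (cong suc (sym (ℕ.+-suc d s)))) (extended-square (suc d) refl)) (extended-square d (sym (ℕ.+-suc d s)))) ⟩
      ((q s (suc t) - q (suc s) (suc t)) - (q s t - q (suc s) t)) +ℤ
        (((+ 4 *ℤ ψ +ℤ q (suc s) (suc t)) +ℤ (+ 4 *ℤ ψ +ℤ q s t)) - (+ 4 *ℤ ψ +ℤ q (suc s) t))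
        ≡⟨ solve 5 (λ a b c e p → ((a :- b) :- (c :- e)) :+ (((con (+ 4) :* p :+ b) :+ (con (+ 4) :* p :+ c)) :- (con (+ 4) :* p :+ e)) := con (+ 4) :* p :+ a) refl
             (q s (suc t)) (q (suc s) (suc t)) (q s t) (q (suc s) t) ψ ⟩
      + 4 *ℤ ψ +ℤ q s (suc t) ∎
      where
      open ≡-Reasoning
      t = suc (d + s)
      ψ = Ψ (links D)
      q : ℕ → ℕ → ℤ
      q s t = square δ δ-sym (count s) (count t)

  -- Cyclic order and signs in terms of comparisons

  ∀Bool? : ∀ {P : Bool → Set} → (∀ b → Dec (P b)) → Dec (∀ b → P b)
  ∀Bool? P? = map′ (λ (p , q) → λ { false → p ; true → q }) (λ f → f false , f true) (P? false ×-dec P? true)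

  -- Cyc P w Q in terms of c = [Q < P], a = [w < Q], b = [w < P].
  cycᵇ : (c a b : Bool) → Bool
  cycᵇ c a b = (not b ∧ a) ∨ ((a ∧ c) ∨ (c ∧ not b))

  -- Transitivity: w < Q < P gives w < P, and w < P ≤ Q gives w < Q. The tables below are checked
  -- for such triples.
  consistent : (c a b : Bool) → Bool
  consistent c a b = if c then not a ∨ b else not b ∨ a

  opaque
    unfolding _<ᵇ_

    <ᵇ-sound : ∀ {p q} → (p <ᵇ q) ≡ true → p < q
    <ᵇ-sound {p} {q} = go (p ℕ.<? q)
      where
      go : (d : Dec (p < q)) → does d ≡ true → p < q
      go (yes p<q) _ = p<q

    does-cyc : ∀ P w Q → does (cyc? P w Q) ≡ ((P <ᵇ w) ∧ (w <ᵇ Q)) ∨ (((w <ᵇ Q) ∧ (Q <ᵇ P)) ∨ ((Q <ᵇ P) ∧ (P <ᵇ w)))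
    does-cyc P w Q = refl

  does-cycᵇ : ∀ {P w Q} → w ≢ P → does (cyc? P w Q) ≡ cycᵇ (Q <ᵇ P) (w <ᵇ Q) (w <ᵇ P)
  does-cycᵇ {P} {w} {Q} w≢P = trans (does-cyc P w Q)
    (cong (λ x → (x ∧ (w <ᵇ Q)) ∨ (((w <ᵇ Q) ∧ (Q <ᵇ P)) ∨ ((Q <ᵇ P) ∧ x))) (<ᵇ-flip w≢P))

  <ᵇ-consistent : ∀ P Q w → consistent (Q <ᵇ P) (w <ᵇ Q) (w <ᵇ P) ≡ true
  <ᵇ-consistent P Q w = go (Q ℕ.<? P)
    where
    imp : ∀ {a b} → (a ≡ true → b ≡ true) → not a ∨ b ≡ true
    imp {false} f = refl
    imp {true}  f = f refl
    go : Dec (Q < P) → consistent (Q <ᵇ P) (w <ᵇ Q) (w <ᵇ P) ≡ true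
    go (yes Q<P) = trans (cong (λ c → consistent c (w <ᵇ Q) (w <ᵇ P)) (<ᵇ-true Q<P))
                         (imp (λ w<Q → <ᵇ-true (ℕ.<-trans (<ᵇ-sound w<Q) Q<P)))
    go (no Q≮P)  = trans (cong (λ c → consistent c (w <ᵇ Q) (w <ᵇ P)) (<ᵇ-false Q≮P))
                         (imp (λ w<P → <ᵇ-true (ℕ.<-≤-trans (<ᵇ-sound w<P) (ℕ.≮⇒≥ Q≮P))))

  interlace-table : ∀ c a b a′ b′ → consistent c a b ≡ true → consistent c a′ b′ ≡ true →
    (cycᵇ c a b ∧ cycᵇ (not c) b′ a′) ∨ (cycᵇ c a′ b′ ∧ cycᵇ (not c) b a) ≡ (not b xor not b′) xor (not a xor not a′)
  interlace-table = from-yes (∀Bool? λ c → ∀Bool? λ a → ∀Bool? λ b → ∀Bool? λ a′ → ∀Bool? λ b′ →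
    (consistent c a b Bool.≟ true) →-dec ((consistent c a′ b′ Bool.≟ true) →-dec (((cycᵇ c a b ∧ cycᵇ (not c) b′ a′) ∨ (cycᵇ c a′ b′ ∧ cycᵇ (not c) b a)) Bool.≟ ((not b xor not b′) xor (not a xor not a′)))))

  -- The difference of the signed counts at Q and P is ±1 for a chord that crosses (P, Q) and 0
  -- otherwise; the sign tells whether its first endpoint lies on the arc from P to Q.
  orientation-table : ∀ c a b a′ b′ → consistent c a b ≡ true → consistent c a′ b′ ≡ true →
    ([ a ] - [ a′ ]) - ([ b ] - [ b′ ]) ≡ [ (b xor b′) xor (a xor a′) ] *ℤ (if cycᵇ c a b then + 1 else - (+ 1))
  orientation-table = from-yes (∀Bool? λ c → ∀Bool? λ a → ∀Bool? λ b → ∀Bool? λ a′ → ∀Bool? λ b′ →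
    (consistent c a b Bool.≟ true) →-dec ((consistent c a′ b′ Bool.≟ true) →-dec ((([ a ] - [ a′ ]) - ([ b ] - [ b′ ])) ℤ.≟ ([ (b xor b′) xor (a xor a′) ] *ℤ (if cycᵇ c a b then + 1 else - (+ 1))))))

  module _ {n} (D : ChordDiagram n) where

    position-≢ : ∀ {x y} → x ≢ y → position D x ≢ position D y
    position-≢ x≢y = x≢y ∘ position-injective D

    does-intersect : ∀ {i j} → i ≢ j → does (intersect? D i j) ≡ links D i j
    does-intersect {i} {j} i≢j = begin
      does (intersect? D i j)
        ≡⟨ cong₂ _∨_ (cong₂ _∧_ (does-cycᵇ {p₀} {q₀} {p₁} (position-≢ (chord-≢ (i≢j ∘ sym)))) (does-cycᵇ {p₁} {q₁} {p₀} (position-≢ (chord-≢ (i≢j ∘ sym)))))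
                      (cong₂ _∧_ (does-cycᵇ {p₀} {q₁} {p₁} (position-≢ (chord-≢ (i≢j ∘ sym)))) (does-cycᵇ {p₁} {q₀} {p₀} (position-≢ (chord-≢ (i≢j ∘ sym))))) ⟩
      (cycᵇ (p₁ <ᵇ p₀) a b ∧ cycᵇ (p₀ <ᵇ p₁) b′ a′) ∨ (cycᵇ (p₁ <ᵇ p₀) a′ b′ ∧ cycᵇ (p₀ <ᵇ p₁) b a)
        ≡⟨ cong (λ c → (cycᵇ (p₁ <ᵇ p₀) a b ∧ cycᵇ c b′ a′) ∨ (cycᵇ (p₁ <ᵇ p₀) a′ b′ ∧ cycᵇ c b a)) (<ᵇ-flip (position-≢ (λ ()))) ⟩
      (cycᵇ (p₁ <ᵇ p₀) a b ∧ cycᵇ (not (p₁ <ᵇ p₀)) b′ a′) ∨ (cycᵇ (p₁ <ᵇ p₀) a′ b′ ∧ cycᵇ (not (p₁ <ᵇ p₀)) b a)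
        ≡⟨ interlace-table (p₁ <ᵇ p₀) a b a′ b′ (<ᵇ-consistent p₀ p₁ q₀) (<ᵇ-consistent p₀ p₁ q₁) ⟩
      (not b xor not b′) xor (not a xor not a′)
        ≡⟨ cong₂ _xor_ (cong₂ _xor_ (flip q₀ p₀ false false) (flip q₁ p₀ true false)) (cong₂ _xor_ (flip q₀ p₁ false true) (flip q₁ p₁ true true)) ⟨
      links D i j ∎
      where
      open ≡-Reasoning
      p₀ = position D (i , false)
      p₁ = position D (i , true)
      q₀ = position D (j , false)
      q₁ = position D (j , true)
      a = q₀ <ᵇ p₁
      b = q₀ <ᵇ p₀
      a′ = q₁ <ᵇ p₁
      b′ = q₁ <ᵇ p₀
      flip : ∀ q p s t → precedes D (i , t) (j , s) ≡ not (precedes D (j , s) (i , t))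
      flip _ _ s t = precedes-flip D {j , s} {i , t} (chord-≢ (i≢j ∘ sym))

    Ψ-intersectionGraph : Ψ (adj (intersectionGraph D)) ≡ Ψ (links D)
    Ψ-intersectionGraph = Ψ-cong (λ i j → does-intersect)

  -- Sums over intersecting chords and their pairs

  ∑-filter : ∀ {n m} {P : Pred (Fin m) 0ℓ} (P? : Decidable P) (f : Fin n → Fin m) (φ : Fin m → ℤ) →
             (∀ i → does (P? i) ≡ false → φ i ≡ + 0) →
             ∑ (λ p → φ (lookupᴸ (filter P? (tabulateᴸ f)) p)) ≡ ∑ (λ i → φ (f i))
  ∑-filter {zero}  P? f φ φ₀ = refl
  ∑-filter {suc n} P? f φ φ₀ = go (P? (f zero)) refl
    where
    go : ∀ (d : Dec _) → P? (f zero) ≡ d → ∑ (λ p → φ (lookupᴸ (filter P? (tabulateᴸ f)) p)) ≡ φ (f zero) +ℤ ∑ (λ i → φ (f (suc i)))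
    go (yes _) eq rewrite eq = cong (φ (f zero) +ℤ_) (∑-filter P? (f ∘ suc) φ φ₀)
    go (no _)  eq rewrite eq = trans (∑-filter P? (f ∘ suc) φ φ₀) (sym (trans
      (cong (_+ℤ ∑ (λ i → φ (f (suc i)))) (φ₀ (f zero) (cong does eq))) (ℤ.+-identityˡ _)))

  ∑-pairsᶻ : ∀ k → (Fin k → Fin k → ℤ) → ℤ
  ∑-pairsᶻ k g = ∑ {k} λ p → ∑ {k} λ q → if does (p F.<? q) then g p q else + 0

  ∑-symmetric : ∀ k (g : Fin k → Fin k → ℤ) → (∀ p q → g p q ≡ g q p) →
                ∑ (λ p → ∑ (g p)) ≡ ∑ (λ p → g p p) +ℤ + 2 *ℤ ∑-pairsᶻ k g
  ∑-symmetric zero    g g-sym = refl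
  ∑-symmetric (suc k) g g-sym = begin
    (g zero zero +ℤ ∑ (g zero ∘ suc)) +ℤ ∑ (λ p → g (suc p) zero +ℤ ∑ (g (suc p) ∘ suc))
      ≡⟨ cong ((g zero zero +ℤ ∑ (g zero ∘ suc)) +ℤ_) (trans (sym (∑-+ (λ p → g (suc p) zero) (λ p → ∑ (g (suc p) ∘ suc))))
           (cong₂ _+ℤ_ (∑-cong (λ p → g-sym (suc p) zero)) (∑-symmetric k (λ p q → g (suc p) (suc q)) (λ p q → g-sym (suc p) (suc q))))) ⟩
    (g zero zero +ℤ ∑ (g zero ∘ suc)) +ℤ (∑ (g zero ∘ suc) +ℤ (∑ (λ p → g (suc p) (suc p)) +ℤ + 2 *ℤ ∑-pairsᶻ k (λ p q → g (suc p) (suc q))))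
      ≡⟨ solve 4 (λ a b c d → (a :+ b) :+ (b :+ (c :+ con (+ 2) :* d)) := (a :+ c) :+ con (+ 2) :* ((con (+ 0) :+ b) :+ d)) refl
           (g zero zero) (∑ (g zero ∘ suc)) (∑ (λ p → g (suc p) (suc p))) (∑-pairsᶻ k (λ p q → g (suc p) (suc q))) ⟩
    (g zero zero +ℤ ∑ (λ p → g (suc p) (suc p))) +ℤ + 2 *ℤ ((+ 0 +ℤ ∑ (g zero ∘ suc)) +ℤ ∑-pairsᶻ k (λ p q → g (suc p) (suc q)))
      ≡⟨ cong (λ s → (g zero zero +ℤ ∑ (λ p → g (suc p) (suc p))) +ℤ + 2 *ℤ ((+ 0 +ℤ ∑ (g zero ∘ suc)) +ℤ s)) (∑-cong λ p → ℤ.+-identityˡ (∑ (λ q → if does (p F.<? q) then g (suc p) (suc q) else + 0))) ⟨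
    ∑ (λ p → g p p) +ℤ + 2 *ℤ ∑-pairsᶻ (suc k) g ∎
    where open ≡-Reasoning

  lookup-injective : ∀ {A : Set} {xs : List A} → Unique xs → ∀ {p q} → lookupᴸ xs p ≡ lookupᴸ xs q → p ≡ q
  lookup-injective (_ ∷ _)   {zero}  {zero}  _  = refl
  lookup-injective (x∉ ∷ _)  {zero}  {suc q} eq = contradiction eq (All.lookup x∉ (∈-lookup q))
  lookup-injective (x∉ ∷ _)  {suc p} {zero}  eq = contradiction (sym eq) (All.lookup x∉ (∈-lookup p))
  lookup-injective (_ ∷ uxs) {suc p} {suc q} eq = cong suc (lookup-injective uxs eq)

  ∑-pairsᶻ-cong : ∀ k {f g : Fin k → Fin k → ℤ} → (∀ p q → p F.< q → f p q ≡ g p q) → ∑-pairsᶻ k f ≡ ∑-pairsᶻ k g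
  ∑-pairsᶻ-cong k {f} {g} eq = ∑-cong λ p → ∑-cong λ q → go p q (p F.<? q)
    where
    go : ∀ p q (d : Dec (p F.< q)) → (if does d then f p q else + 0) ≡ (if does d then g p q else + 0)
    go p q (yes p<q) = eq p q p<q
    go p q (no _)    = refl

  ∑-constant : ∀ k c → ∑ {k} (λ _ → c) ≡ + k *ℤ c
  ∑-constant zero    c = refl
  ∑-constant (suc k) c = trans (cong (c +ℤ_) (∑-constant k c)) (trans
    (solve 2 (λ k c → c :+ k :* c := (con (+ 1) :+ k) :* c) refl (+ k) c) (cong (_*ℤ c) (sym (ℤ.pos-+ 1 k))))

  module _ {n} (D : ChordDiagram n) where

    extended-comm : ∀ s t → extended D s t ≡ extended D t s
    extended-comm s t = extended-cong D (λ k → Bool.xor-comm (before D s (k , false) xor before D s (k , true)) _)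

    extended-square′ : ∀ s t → + 2 *ℤ extended D s t ≡ + 4 *ℤ Ψ (links D) +ℤ square (δ D) (δ-sym D) (count D s) (count D t)
    extended-square′ s t = go (ℕ.≤-total s t)
      where
      go : s ≤ t ⊎ t ≤ s → + 2 *ℤ extended D s t ≡ + 4 *ℤ Ψ (links D) +ℤ square (δ D) (δ-sym D) (count D s) (count D t)
      go (inj₁ s≤t) = extended-square D (t ∸ s) (sym (ℕ.m∸n+n≡m s≤t))
      go (inj₂ t≤s) = trans (cong (+ 2 *ℤ_) (extended-comm s t)) (trans (extended-square D (s ∸ t) (sym (ℕ.m∸n+n≡m t≤s)))
        (cong (+ 4 *ℤ Ψ (links D) +ℤ_) (∑-cong λ i → ∑-cong λ j →
          solve 5 (λ d a b a′ b′ → d :* ((a :- b) :* (a′ :- b′)) := d :* ((b :- a) :* (b′ :- a′))) refl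
            (δ D i j) (count D s i) (count D t i) (count D s j) (count D t j))))

  -- The recursion at a chord

  module Recursion {n} (D : ChordDiagram (suc n)) where

    H : ChordDiagram n
    H = deleteChord D zero

    P Q : ℕ
    P = position D (zero , false)
    Q = position D (zero , true)

    ψ : ℤ
    ψ = Ψ (links H)

    -- `H` has no endpoint at P or Q, so a chord placed just before these positions is the deleted
    -- chord itself.
    Ψ-extended : Ψ (links D) ≡ extended H P Q
    Ψ-extended = Ψ-links₁ D
      (λ k → trans (links-sym D (λ ())) (solve₂ 4 (λ p q r s → (p ⊹ q) ⊹ (r ⊹ s) ⊜ (p ⊹ r) ⊹ (q ⊹ s)) refl
        (precedes D (suc k , false) (zero , false)) (precedes D (suc k , false) (zero , true))
        (precedes D (suc k , true) (zero , false)) (precedes D (suc k , true) (zero , true))))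
      (λ _ _ _ → refl)

    crosses : Fin n → Bool
    crosses k = row H P Q k

    does-crosses : ∀ k → does (intersect? D zero (suc k)) ≡ crosses k
    does-crosses k = trans (does-intersect D (λ ())) (trans (links-sym D (λ ())) (solve₂ 4 (λ p q r s → (p ⊹ q) ⊹ (r ⊹ s) ⊜ (p ⊹ r) ⊹ (q ⊹ s)) refl
        (precedes D (suc k , false) (zero , false)) (precedes D (suc k , false) (zero , true))
        (precedes D (suc k , true) (zero , false)) (precedes D (suc k , true) (zero , true))))

    side : Fin n → Bool
    side k = not (does (cyc? P (position D (suc k , false)) Q))

    near≡ : ∀ k → near D zero (suc k) ≡ (suc k , side k)
    near≡ k = go (does (cyc? P (position D (suc k , false)) Q))
      where
      go : ∀ c → (if c then (suc k , false) else (suc k , true)) ≡ (suc k , not c)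
      go false = refl
      go true  = refl

    far≡ : ∀ k → far D zero (suc k) ≡ (suc k , not (side k))
    far≡ k = cong partner (near≡ k)

    winding : Fin n → ℤ
    winding k = count H Q k - count H P k

    winding≡ : ∀ k → winding k ≡ [ crosses k ] *ℤ orientation H (side k)
    winding≡ k = trans (orientation-table (Q <ᵇ P) (w₀ <ᵇ Q) (w₀ <ᵇ P) (w₁ <ᵇ Q) (w₁ <ᵇ P) (<ᵇ-consistent P Q w₀) (<ᵇ-consistent P Q w₁))
      (cong ([ crosses k ] *ℤ_) (trans (go _) (cong (λ c → orientation H (not c)) (sym (does-cycᵇ (position-≢ D (λ ())))))))
      where
      w₀ = position D (suc k , false)
      w₁ = position D (suc k , true)
      go : ∀ c → (if c then + 1 else - (+ 1)) ≡ orientation H (not c)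
      go false = refl
      go true  = refl

    resolution : Fin (suc n) → Fin (suc n) → ℤ
    resolution x y = Ψ (links (parallel D zero x y)) - Ψ (links (crossed D zero x y))

    private
      ι : Endpoint n → Endpoint (suc n)
      ι (k , s) = suc k , s

      ι-injective : ∀ {x y} → ι x ≡ ι y → x ≡ y
      ι-injective refl = refl

      exchanged : ∀ {a b} a′ b′ → a ≡ ι a′ → b ≡ ι b′ → Ψ (links (deleteChord (exchange a b D) zero)) ≡ Ψ (links (exchange a′ b′ H))
      exchanged a′ b′ refl refl = Ψ-cong λ k l _ →
        link-positions (deleteChord (exchange (ι a′) (ι b′) D) zero) (exchange a′ b′ H) (λ w → w)
          (λ w → cong (position D) (transpose-natural ι ι-injective a′ b′ w)) _ _ _ _

    -- Exchanging far i with near j joins near i to near j, which is `rejoined` at the two near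
    -- endpoints; `crossed` is the same with far j in place of near j. The signs come from `side`,
    -- which names the near endpoints.
    resolution≡ : ∀ {i j} → i ≢ j → resolution (suc i) (suc j) ≡ δ H i j *ℤ (orientation H (side i) *ℤ orientation H (side j))
    resolution≡ {i} {j} i≢j = trans
      (cong₂ _-_ (exchanged (i , not (side i)) (j , side j) (far≡ i) (near≡ j)) (exchanged (i , not (side i)) (j , not (side j)) (far≡ i) (far≡ j)))
      (δ-oriented H i≢j (side i) (side j))

    chords : List (Fin (suc n))
    chords = intersecting D zero

    k : ℕ
    k = length chords

    private
      -- The terms of the square, indexed by the chords of `D` with zeros at the deleted chord, so
      -- that sums over the list of intersecting chords can be compared with sums over all chords.
      Φ : Fin (suc n) → Fin (suc n) → ℤ
      Φ zero    _       = + 0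
      Φ (suc _) zero    = + 0
      Φ (suc i) (suc j) = δ H i j *ℤ (winding i *ℤ winding j)

      Φ-sym : ∀ x y → Φ x y ≡ Φ y x
      Φ-sym zero    zero    = refl
      Φ-sym zero    (suc _) = refl
      Φ-sym (suc _) zero    = refl
      Φ-sym (suc i) (suc j) = cong₂ _*ℤ_ (δ-sym H i j) (ℤ.*-comm (winding i) (winding j))

      winding₀ : ∀ i → does (intersect? D zero (suc i)) ≡ false → winding i ≡ + 0
      winding₀ i eq = trans (winding≡ i) (cong (λ b → [ b ] *ℤ orientation H (side i)) (trans (sym (does-crosses i)) eq))

      winding₁ : ∀ {i} → Intersect D zero (suc i) → winding i ≡ orientation H (side i)
      winding₁ {i} int = trans (winding≡ i) (trans
        (cong (λ b → [ b ] *ℤ orientation H (side i)) (trans (sym (does-crosses i)) (dec-true (intersect? D zero (suc i)) int)))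
        (ℤ.*-identityˡ (orientation H (side i))))

      Φ₀ : ∀ x y → does (intersect? D zero x) ≡ false → Φ x y ≡ + 0
      Φ₀ zero    y       _  = refl
      Φ₀ (suc i) zero    _  = refl
      Φ₀ (suc i) (suc j) eq = trans (cong (λ w → δ H i j *ℤ (w *ℤ winding j)) (winding₀ i eq)) (ℤ.*-zeroʳ (δ H i j))

      intersects : ∀ p → Intersect D zero (lookupᴸ chords p)
      intersects p = All.lookup (All.all-filter (intersect? D zero) (allFin (suc n))) (∈-lookup p)

      unique : Unique chords
      unique = Unique.filter⁺ (intersect? D zero) (Unique.allFin⁺ (suc n))

      square≡ : square (δ H) (δ-sym H) (count H P) (count H Q) ≡ ∑ (λ p → ∑ (λ q → Φ (lookupᴸ chords p) (lookupᴸ chords q)))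
      square≡ = sym (begin
        ∑ (λ p → ∑ (λ q → Φ (lookupᴸ chords p) (lookupᴸ chords q)))
          ≡⟨ (∑-cong λ p → ∑-filter (intersect? D zero) (λ i → i) (Φ (lookupᴸ chords p)) (λ y eq → trans (Φ-sym (lookupᴸ chords p) y) (Φ₀ y _ eq))) ⟩
        ∑ (λ p → ∑ (Φ (lookupᴸ chords p)))
          ≡⟨ ∑-filter (intersect? D zero) (λ i → i) (λ x → ∑ (Φ x)) (λ x eq → ∑-zero (λ y → Φ₀ x y eq)) ⟩
        ∑ (λ x → ∑ (Φ x))
          ≡⟨ trans (cong₂ _+ℤ_ (∑-zero {suc n} (λ _ → refl)) (∑-cong λ i → ℤ.+-identityˡ (∑ (λ j → Φ (suc i) (suc j))))) (ℤ.+-identityˡ _) ⟩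
        square (δ H) (δ-sym H) (count H P) (count H Q) ∎)
        where open ≡-Reasoning

      diagonal : ∀ x → Intersect D zero x → Φ x x ≡ - (+ 2 *ℤ ψ)
      diagonal zero    int = contradiction int interlace-irrefl
      diagonal (suc i) int = trans (cong₂ (λ d w → d *ℤ (w *ℤ w)) (δ-diagonal H i) (winding₁ int))
        (trans (cong (- (+ 2 *ℤ ψ) *ℤ_) (unit (side i))) (ℤ.*-identityʳ _))
        where
        unit : ∀ b → orientation H b *ℤ orientation H b ≡ + 1
        unit false = refl
        unit true  = refl

      off-diagonal : ∀ x y → Intersect D zero x → Intersect D zero y → x ≢ y → Φ x y ≡ resolution x y
      off-diagonal zero    _       int _    _   = contradiction int interlace-irrefl
      off-diagonal (suc i) zero    _   int  _   = contradiction int interlace-irrefl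
      off-diagonal (suc i) (suc j) int int′ i≢j = trans
        (cong₂ (λ a b → δ H i j *ℤ (a *ℤ b)) (winding₁ int) (winding₁ int′)) (sym (resolution≡ (i≢j ∘ cong suc)))

    -- Doubled, this is the square formula for `extended`: chords with winding 0 drop out, each of
    -- the k diagonal terms is -2ψ because the signs square to 1, and every pair occurs twice. The
    -- factor 2 is then cancelled in ℤ.
    Ψ-recursion : Ψ (links D) ≡ (+ 2 - + k) *ℤ ψ +ℤ ∑-pairsᶻ k (λ p q → resolution (lookupᴸ chords p) (lookupᴸ chords q))
    Ψ-recursion = ℤ.*-cancelˡ-≡ (+ 2) _ _ (begin
      + 2 *ℤ Ψ (links D)
        ≡⟨ trans (cong (+ 2 *ℤ_) Ψ-extended) (extended-square′ H P Q) ⟩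
      + 4 *ℤ ψ +ℤ square (δ H) (δ-sym H) (count H P) (count H Q)
        ≡⟨ cong (+ 4 *ℤ ψ +ℤ_) (trans square≡ (∑-symmetric k (λ p q → Φ (lookupᴸ chords p) (lookupᴸ chords q)) (λ p q → Φ-sym (lookupᴸ chords p) (lookupᴸ chords q)))) ⟩
      + 4 *ℤ ψ +ℤ (∑ (λ p → Φ (lookupᴸ chords p) (lookupᴸ chords p)) +ℤ + 2 *ℤ ∑-pairsᶻ k (λ p q → Φ (lookupᴸ chords p) (lookupᴸ chords q)))
        ≡⟨ cong₂ (λ a b → + 4 *ℤ ψ +ℤ (a +ℤ + 2 *ℤ b))
             (trans (∑-cong (λ p → diagonal (lookupᴸ chords p) (intersects p))) (∑-constant k (- (+ 2 *ℤ ψ))))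
             (∑-pairsᶻ-cong k (λ p q p<q → off-diagonal (lookupᴸ chords p) (lookupᴸ chords q) (intersects p) (intersects q) (λ eq → ℕ.<-irrefl (cong F.toℕ (lookup-injective unique eq)) p<q))) ⟩
      + 4 *ℤ ψ +ℤ (+ k *ℤ - (+ 2 *ℤ ψ) +ℤ + 2 *ℤ S)
        ≡⟨ solve 3 (λ a k s → con (+ 4) :* a :+ (k :* (:- (con (+ 2) :* a)) :+ con (+ 2) :* s) := con (+ 2) :* ((con (+ 2) :- k) :* a :+ s)) refl ψ (+ k) S ⟩
      + 2 *ℤ ((+ 2 - + k) *ℤ ψ +ℤ S) ∎)
      where
      open ≡-Reasoning
      S = ∑-pairsᶻ k (λ p q → resolution (lookupᴸ chords p) (lookupᴸ chords q))

open IntegerInvariant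

-- The four-term relation

module FourTerm (G : Graph) {m} (π : Permutation (suc (suc m)) (order G)) where

  private
    a b : Vertex G
    a = π ⟨$⟩ʳ zero
    b = π ⟨$⟩ʳ suc zero

    π-== : ∀ i j → ((π ⟨$⟩ʳ i) == (π ⟨$⟩ʳ j)) ≡ (i == j)
    π-== i j = go (i Fin.≟ j)
      where
      go : Dec (i ≡ j) → ((π ⟨$⟩ʳ i) == (π ⟨$⟩ʳ j)) ≡ (i == j)
      go (yes ≡.refl) = ≡.trans (==-refl (π ⟨$⟩ʳ i)) (≡.sym (==-refl i))
      go (no i≢j)     = ≡.trans (==-false (λ eq → i≢j (≡.trans (≡.sym (inverseˡ π)) (≡.trans (cong (π ⟨$⟩ˡ_) eq) (inverseˡ π))))) (≡.sym (==-false i≢j))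

  x y : Fin m → Bool
  x r = adj G a (π ⟨$⟩ʳ suc (suc r))
  y r = adj G b (π ⟨$⟩ʳ suc (suc r))

  M : Matrix₂ m
  M r s = adj G (π ⟨$⟩ʳ suc (suc r)) (π ⟨$⟩ʳ suc (suc s))

  -- Moves `a` and `b` to the front, the shape in which `Ψ-4T` applies.
  Ψ-front : ∀ (A : Matrix₂ (order G)) → (∀ i j → A i j ≡ A j i) → ∀ {ε x′} → A a b ≡ ε →
            (∀ r → A a (π ⟨$⟩ʳ suc (suc r)) ≡ x′ r) → (∀ r → A b (π ⟨$⟩ʳ suc (suc r)) ≡ y r) →
            (∀ r s → A (π ⟨$⟩ʳ suc (suc r)) (π ⟨$⟩ʳ suc (suc s)) ≡ M r s) →
            Ψ A ≡ Ψ (border (ε ∷ᶠ x′) (border y M))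
  Ψ-front A A-sym ε≡ x≡ y≡ M≡ = ≡.sym (Ψ-permute π λ
    { zero          zero          z≢z → contradiction ≡.refl z≢z
    ; zero          (suc zero)    _   → ≡.sym ε≡
    ; zero          (suc (suc s)) _   → ≡.sym (x≡ s)
    ; (suc zero)    zero          _   → ≡.sym (≡.trans (A-sym b a) ε≡)
    ; (suc zero)    (suc zero)    z≢z → contradiction ≡.refl z≢z
    ; (suc zero)    (suc (suc s)) _   → ≡.sym (y≡ s)
    ; (suc (suc r)) zero          _   → ≡.sym (≡.trans (A-sym _ a) (x≡ r))
    ; (suc (suc r)) (suc zero)    _   → ≡.sym (≡.trans (A-sym _ b) (y≡ r))
    ; (suc (suc r)) (suc (suc s)) _   → ≡.sym (M≡ r s) })

  removed : Matrix₂ (order G) → Matrix₂ (order G)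
  removed A i j = A i j ∧ not (((i == a) ∧ (j == b)) ∨ ((i == b) ∧ (j == a)))

  removed-π : ∀ A i j → removed A (π ⟨$⟩ʳ i) (π ⟨$⟩ʳ j) ≡
              A (π ⟨$⟩ʳ i) (π ⟨$⟩ʳ j) ∧ not (((i == zero) ∧ (j == suc zero)) ∨ ((i == suc zero) ∧ (j == zero)))
  removed-π A i j = cong₂ (λ p q → A (π ⟨$⟩ʳ i) (π ⟨$⟩ʳ j) ∧ not (p ∨ q))
    (cong₂ _∧_ (π-== i zero) (π-== j (suc zero))) (cong₂ _∧_ (π-== i (suc zero)) (π-== j zero))

  toggled-π : ∀ i j → toggled G a b (π ⟨$⟩ʳ i) (π ⟨$⟩ʳ j) ≡
              (i == zero) ∧ not (j == zero) ∧ not (j == suc zero) ∧ adj G (π ⟨$⟩ʳ j) b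
  toggled-π i j = cong₂ _∧_ (π-== i zero) (cong₂ (λ p q → not p ∧ not q ∧ adj G (π ⟨$⟩ʳ j) b) (π-== j zero) (π-== j (suc zero)))

  switch-π : ∀ i j → adj (switch G a b) (π ⟨$⟩ʳ i) (π ⟨$⟩ʳ j) ≡ adj G (π ⟨$⟩ʳ i) (π ⟨$⟩ʳ j) xor
    (((i == zero) ∧ not (j == zero) ∧ not (j == suc zero) ∧ adj G (π ⟨$⟩ʳ j) b) ∨
     ((j == zero) ∧ not (i == zero) ∧ not (i == suc zero) ∧ adj G (π ⟨$⟩ʳ i) b))
  switch-π i j = cong₂ (λ p q → adj G (π ⟨$⟩ʳ i) (π ⟨$⟩ʳ j) xor (p ∨ q)) (toggled-π i j) (toggled-π j i)

  module _ (edge : adj G a b ≡ true) where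

    Ψ-graph : Ψ (adj G) ≡ Ψ (border (true ∷ᶠ x) (border y M))
    Ψ-graph = Ψ-front (adj G) (adj-sym G) edge (λ _ → ≡.refl) (λ _ → ≡.refl) (λ _ _ → ≡.refl)

    Ψ-removed : Ψ (adj (removeEdge G a b)) ≡ Ψ (border (false ∷ᶠ x) (border y M))
    Ψ-removed = Ψ-front (adj (removeEdge G a b)) (adj-sym (removeEdge G a b))
      (≡.trans (removed-π (adj G) zero (suc zero)) (Bool.∧-zeroʳ _))
      (λ r → ≡.trans (removed-π (adj G) zero (suc (suc r))) (Bool.∧-identityʳ _))
      (λ r → ≡.trans (removed-π (adj G) (suc zero) (suc (suc r))) (Bool.∧-identityʳ _))
      (λ r s → ≡.trans (removed-π (adj G) (suc (suc r)) (suc (suc s))) (Bool.∧-identityʳ _))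

    private
      switched-edge : adj (switch G a b) a b ≡ true
      switched-edge = ≡.trans (switch-π zero (suc zero)) (≡.trans (Bool.xor-identityʳ _) edge)
      switched-x : ∀ r → adj (switch G a b) a (π ⟨$⟩ʳ suc (suc r)) ≡ x r xor y r
      switched-x r = ≡.trans (switch-π zero (suc (suc r))) (cong (x r xor_) (≡.trans (Bool.∨-identityʳ _) (adj-sym G _ b)))
      switched-y : ∀ r → adj (switch G a b) b (π ⟨$⟩ʳ suc (suc r)) ≡ y r
      switched-y r = ≡.trans (switch-π (suc zero) (suc (suc r))) (Bool.xor-identityʳ _)
      switched-M : ∀ r s → adj (switch G a b) (π ⟨$⟩ʳ suc (suc r)) (π ⟨$⟩ʳ suc (suc s)) ≡ M r s
      switched-M r s = ≡.trans (switch-π (suc (suc r)) (suc (suc s))) (Bool.xor-identityʳ _)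

    Ψ-switched : Ψ (adj (switch G a b)) ≡ Ψ (border (true ∷ᶠ λ r → x r xor y r) (border y M))
    Ψ-switched = Ψ-front (adj (switch G a b)) (adj-sym (switch G a b)) switched-edge switched-x switched-y switched-M

    Ψ-switched-removed : Ψ (adj (removeEdge (switch G a b) a b)) ≡ Ψ (border (false ∷ᶠ λ r → x r xor y r) (border y M))
    Ψ-switched-removed = Ψ-front (adj (removeEdge (switch G a b) a b)) (adj-sym (removeEdge (switch G a b) a b))
      (≡.trans (removed-π (adj (switch G a b)) zero (suc zero)) (Bool.∧-zeroʳ _))
      (λ r → ≡.trans (removed-π (adj (switch G a b)) zero (suc (suc r))) (≡.trans (Bool.∧-identityʳ _) (switched-x r)))
      (λ r → ≡.trans (removed-π (adj (switch G a b)) (suc zero) (suc (suc r))) (≡.trans (Bool.∧-identityʳ _) (switched-y r)))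
      (λ r s → ≡.trans (removed-π (adj (switch G a b)) (suc (suc r)) (suc (suc s))) (≡.trans (Bool.∧-identityʳ _) (switched-M r s)))

    Ψ-fourTerm : Ψ (adj G) -ℤ Ψ (adj (removeEdge G a b)) ≡ Ψ (adj (switch G a b)) -ℤ Ψ (adj (removeEdge (switch G a b) a b))
    Ψ-fourTerm = ≡.trans (cong₂ _-ℤ_ Ψ-graph Ψ-removed) (≡.trans (Ψ-4T x y M) (≡.sym (cong₂ _-ℤ_ Ψ-switched Ψ-switched-removed)))

graph-4T : ∀ (G : Graph) (a b : Vertex G) → adj G a b ≡ true →
  Ψ (adj G) -ℤ Ψ (adj (removeEdge G a b)) ≡ Ψ (adj (switch G a b)) -ℤ Ψ (adj (removeEdge (switch G a b) a b))
graph-4T G a b edge = go (front₂ a≢b)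
  where
  a≢b : a ≢ b
  a≢b a≡b with () ← ≡.trans (≡.sym (adj-irrefl G a)) (≡.trans (cong (adj G a) a≡b) edge)
  go : (∃ λ m → ∃ λ (π : Permutation (suc (suc m)) (order G)) → π ⟨$⟩ʳ zero ≡ a × π ⟨$⟩ʳ suc zero ≡ b) → _
  go (m , π , ≡.refl , ≡.refl) = FourTerm.Ψ-fourTerm G π edge

-- Transfer to the ring K

module _ {k ℓ s ℓs m ℓm} (K : CommutativeRing k ℓ) (S : Setoid s ℓs) (M : Module K m ℓm) where
  open FreeModule K S
  open Module M
  open CommutativeRing K using (1#; 0#) renaming (-_ to -ᴷ_; -‿inverseˡ to negate-inverseˡ)
  open Setoid S using () renaming (Carrier to X; _≈_ to _∼_)

  module _ (f : X → Carrierᴹ) (f-cong : ∀ {x y} → x ∼ y → f x ≈ᴹ f y) where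

    private
      F : Free → Carrierᴹ
      F = linearExtension M f

    linearExtension-cong : ∀ {p q} → p ≋ q → F p ≈ᴹ F q
    linearExtension-cong ≋-refl             = ≈ᴹ-refl
    linearExtension-cong (≋-sym e)          = ≈ᴹ-sym (linearExtension-cong e)
    linearExtension-cong (≋-trans e e′)     = ≈ᴹ-trans (linearExtension-cong e) (linearExtension-cong e′)
    linearExtension-cong (⟦⟧-cong e)        = f-cong e
    linearExtension-cong (⊕-cong e e′)      = +ᴹ-cong (linearExtension-cong e) (linearExtension-cong e′)
    linearExtension-cong (·-cong r e)       = *ₗ-cong r (linearExtension-cong e)
    linearExtension-cong (⊕-assoc p q r)    = +ᴹ-assoc (F p) (F q) (F r)
    linearExtension-cong (⊕-comm p q)       = +ᴹ-comm (F p) (F q)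
    linearExtension-cong (⊕-idˡ p)          = +ᴹ-identityˡ (F p)
    linearExtension-cong (·-distribˡ r p q) = *ₗ-distribˡ r (F p) (F q)
    linearExtension-cong (·-distribʳ p r t) = *ₗ-distribʳ (F p) r t
    linearExtension-cong (·-assoc r t p)    = *ₗ-assoc r t (F p)
    linearExtension-cong (·-idˡ p)          = *ₗ-identityˡ (F p)
    linearExtension-cong (·-zeroˡ p)        = *ₗ-zeroˡ (F p)

    -1*ₗ : ∀ w → ((-ᴷ 1#) *ₗ w) ≈ᴹ (-ᴹ w)
    -1*ₗ w = uniqueˡ ((-ᴷ 1#) *ₗ w) w (≈ᴹ-trans (+ᴹ-congˡ (≈ᴹ-sym (*ₗ-identityˡ w)))
      (≈ᴹ-trans (≈ᴹ-sym (*ₗ-distribʳ w (-ᴷ 1#) 1#)) (≈ᴹ-trans (*ₗ-cong (negate-inverseˡ 1#) ≈ᴹ-refl) (*ₗ-zeroˡ w))))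
      where
      open AbelianGroupProperties +ᴹ-abelianGroup using () renaming (inverseˡ-unique to uniqueˡ)

    linearExtension-linear : IsLinear freeModule M F
    linearExtension-linear = record
      { isBimoduleHomomorphism = record
        { +ᴹ-isGroupHomomorphism = record
          { isMonoidHomomorphism = record
            { isMagmaHomomorphism = record
              { isRelHomomorphism = record { cong = linearExtension-cong }
              ; homo = λ _ _ → ≈ᴹ-refl }
            ; ε-homo = ≈ᴹ-refl }
          ; ⁻¹-homo = λ p → -1*ₗ (F p) }
        ; *ₗ-homo = λ _ _ → ≈ᴹ-refl
        ; *ᵣ-homo = λ r p → *ₗ-*ᵣ-coincident r (F p) } }

module FromℤProperties {k ℓ} (K : CommutativeRing k ℓ) where
  open CommutativeRing K
  open RingProperties ring using (-‿involutive; -0#≈0#; -‿+-comm)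
  open Mult semiring using (×-homo-+; ×1-homo-*) renaming (_×_ to _×ᴷ_)
  open Exp semiring using (_^_)
  open SetoidReasoning setoid

  fromℤ : ℤ → Carrier
  fromℤ (+ n)    = n ×ᴷ 1#
  fromℤ -[1+ n ] = - (suc n ×ᴷ 1#)

  fromℤ-neg : ∀ z → fromℤ (-ℤ z) ≈ - fromℤ z
  fromℤ-neg (+ zero)  = sym -0#≈0#
  fromℤ-neg (+ suc n) = refl
  fromℤ-neg -[1+ n ]  = sym (-‿involutive _)

  interchange : ∀ a b c d → (a + b) + (c + d) ≈ (a + c) + (b + d)
  interchange a b c d = trans (+-assoc a b (c + d)) (trans (+-congˡ (trans (sym (+-assoc b c d))
    (trans (+-congʳ (+-comm b c)) (+-assoc c b d)))) (sym (+-assoc a c (b + d))))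

  fromℤ-⊖ : ∀ m n → fromℤ (m ⊖ n) ≈ m ×ᴷ 1# + - (n ×ᴷ 1#)
  fromℤ-⊖ zero    zero    = sym (-‿inverseʳ 0#)
  fromℤ-⊖ zero    (suc n) = sym (+-identityˡ _)
  fromℤ-⊖ (suc m) zero    = sym (trans (+-congˡ -0#≈0#) (+-identityʳ _))
  fromℤ-⊖ (suc m) (suc n) = begin
    fromℤ (suc m ⊖ suc n)                          ≡⟨ cong fromℤ (ℤ.[1+m]⊖[1+n]≡m⊖n m n) ⟩
    fromℤ (m ⊖ n)                                  ≈⟨ fromℤ-⊖ m n ⟩
    m ×ᴷ 1# + - (n ×ᴷ 1#)                          ≈⟨ +-identityˡ _ ⟨
    0# + (m ×ᴷ 1# + - (n ×ᴷ 1#))                   ≈⟨ +-congʳ (-‿inverseʳ 1#) ⟨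
    (1# + - 1#) + (m ×ᴷ 1# + - (n ×ᴷ 1#))          ≈⟨ interchange 1# (- 1#) (m ×ᴷ 1#) (- (n ×ᴷ 1#)) ⟩
    (1# + m ×ᴷ 1#) + (- 1# + - (n ×ᴷ 1#))          ≈⟨ +-congˡ (-‿+-comm 1# (n ×ᴷ 1#)) ⟩
    suc m ×ᴷ 1# + - (suc n ×ᴷ 1#)                  ∎

  fromℤ-+ : ∀ x y → fromℤ (x +ℤ y) ≈ fromℤ x + fromℤ y
  fromℤ-+ (+ m)    (+ n)    = ×-homo-+ 1# m n
  fromℤ-+ (+ m)    -[1+ n ] = fromℤ-⊖ m (suc n)
  fromℤ-+ -[1+ m ] (+ n)    = trans (fromℤ-⊖ n (suc m)) (+-comm _ _)
  fromℤ-+ -[1+ m ] -[1+ n ] = begin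
    - (suc (suc (m ℕ.+ n)) ×ᴷ 1#)          ≡⟨ cong (λ j → - (suc j ×ᴷ 1#)) (≡.sym (ℕ.+-suc m n)) ⟩
    - ((suc m ℕ.+ suc n) ×ᴷ 1#)            ≈⟨ -‿cong (×-homo-+ 1# (suc m) (suc n)) ⟩
    - (suc m ×ᴷ 1# + suc n ×ᴷ 1#)          ≈⟨ -‿+-comm _ _ ⟨
    - (suc m ×ᴷ 1#) + - (suc n ×ᴷ 1#)      ∎

  fromℤ-- : ∀ x y → fromℤ (x -ℤ y) ≈ fromℤ x + - fromℤ y
  fromℤ-- x y = trans (fromℤ-+ x (-ℤ y)) (+-congˡ (fromℤ-neg y))

  fromℤ-* : ∀ n z → fromℤ (+ n *ℤ z) ≈ n ×ᴷ fromℤ z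
  fromℤ-* zero    z = reflexive (cong fromℤ (ℤ.*-zeroˡ z))
  fromℤ-* (suc n) z = trans (reflexive (cong fromℤ (≡.trans (ℤ.*-distribʳ-+ z (+ 1) (+ n)) (cong (_+ℤ (+ n *ℤ z)) (ℤ.*-identityˡ z)))))
    (trans (fromℤ-+ z (+ n *ℤ z)) (+-congˡ (fromℤ-* n z)))

  fromℤ-3^ : ∀ d → fromℤ (3^ d) ≈ (1# + 1# + 1#) ^ d
  fromℤ-3^ zero    = +-identityʳ 1#
  fromℤ-3^ (suc d) = trans (×1-homo-* 3 (3 ℕ.^ d)) (*-cong three (fromℤ-3^ d))
    where
    three : 3 ×ᴷ 1# ≈ 1# + 1# + 1#
    three = trans (+-congˡ (+-congˡ (+-identityʳ 1#))) (sym (+-assoc 1# 1# 1#))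

opaque
  unfolding Ψ cork

  -- Once unfolded, the two sides agree by definition: `framed` is the framed adjacency matrix, and
  -- `cork` is the length of the basis that defines `η`.
  Ψ-η : ∀ G → Ψ (adj G) ≡ ∑± (order G) (λ V → 3^ η (G framedOn V))
  Ψ-η G = ≡.refl

-- Comparison with ψ and with the weight system

module Transfer {k ℓ} (K : CommutativeRing k ℓ) (½ : CommutativeRing.Carrier K)
                (½+½≈1 : CommutativeRing._≈_ K (CommutativeRing._+_ K ½ ½) (CommutativeRing.1# K)) where
  open CommutativeRing K hiding (zero)
  open WeightSystems K ½
  open FromℤProperties K
  open RingProperties ring using (-‿distribˡ-*; -‿distribʳ-*; -1*x≈-x; -‿+-comm; -0#≈0#)
  open Mult semiring using (×-comm-*; ×-assoc-*; ×-congʳ) renaming (_×_ to _×ᴷ_)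
  open Exp semiring using (_^_; ^-congʳ; ^-homo-*)
  open SetoidReasoning setoid

  ∑⊆-cong : ∀ n {f g : Subset n → Carrier} → (∀ V → f V ≈ g V) → ∑⊆ n f ≈ ∑⊆ n g
  ∑⊆-cong zero    eq = eq []
  ∑⊆-cong (suc n) eq = +-cong (∑⊆-cong n (λ V → eq (false ∷ V))) (∑⊆-cong n (λ V → eq (true ∷ V)))

  ∑⊆-neg : ∀ n (f : Subset n → Carrier) → - ∑⊆ n f ≈ ∑⊆ n (λ V → - f V)
  ∑⊆-neg zero    f = refl
  ∑⊆-neg (suc n) f = trans (sym (-‿+-comm _ _)) (+-cong (∑⊆-neg n _) (∑⊆-neg n _))

  fromℤ-∑± : ∀ n (f : Subset n → ℤ) → fromℤ (∑± n f) ≈ ∑⊆ n (λ V → (- 1#) ^ ∣ V ∣ * fromℤ (f V))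
  fromℤ-∑± zero    f = sym (*-identityˡ _)
  fromℤ-∑± (suc n) f = begin
    fromℤ (∑± (suc n) f)
      ≡⟨ cong fromℤ (Δ-def _) ⟩
    fromℤ (∑± n (f ∘ (false ∷_)) -ℤ ∑± n (f ∘ (true ∷_)))
      ≈⟨ fromℤ-- (∑± n (f ∘ (false ∷_))) (∑± n (f ∘ (true ∷_))) ⟩
    fromℤ (∑± n (f ∘ (false ∷_))) + - fromℤ (∑± n (f ∘ (true ∷_)))
      ≈⟨ +-cong (fromℤ-∑± n (f ∘ (false ∷_))) (trans (-‿cong (fromℤ-∑± n (f ∘ (true ∷_)))) (trans (∑⊆-neg n _)
           (∑⊆-cong n (λ V → trans (-‿distribˡ-* _ _) (*-congʳ (sym (-1*x≈-x _))))))) ⟩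
    ∑⊆ (suc n) (λ V → (- 1#) ^ ∣ V ∣ * fromℤ (f V)) ∎

  ψᴳ≈ : ∀ G → ψᴳ G ≈ ½ ^ order G * fromℤ (Ψ (adj G))
  ψᴳ≈ G = *-congˡ (sym (trans (reflexive (cong fromℤ (Ψ-η G))) (trans (fromℤ-∑± (order G) _)
    (∑⊆-cong (order G) (λ V → *-congˡ (fromℤ-3^ (η (G framedOn V))))))))

  ψᴳ-cong : ∀ {G H} → G ≅ᴳ H → ψᴳ G ≈ ψᴳ H
  ψᴳ-cong {G} {H} f = trans (ψᴳ≈ G) (trans
    (*-cong (^-congʳ ½ (↔⇒≡ bijection)) (reflexive (cong fromℤ (Ψ-permute bijection (λ i j _ → adjacency i j)))))
    (sym (ψᴳ≈ H)))
    where open _≅ᴳ_ f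

  ψᴳ-difference : ∀ G H → order G ≡ order H → ψᴳ G + - ψᴳ H ≈ ½ ^ order G * fromℤ (Ψ (adj G) -ℤ Ψ (adj H))
  ψᴳ-difference G H G≡H = begin
    ψᴳ G + - ψᴳ H
      ≈⟨ +-cong (ψᴳ≈ G) (-‿cong (trans (ψᴳ≈ H) (*-congʳ (^-congʳ ½ (≡.sym G≡H))))) ⟩
    ½ ^ order G * fromℤ (Ψ (adj G)) + - (½ ^ order G * fromℤ (Ψ (adj H)))
      ≈⟨ +-congˡ (-‿distribʳ-* _ _) ⟩
    ½ ^ order G * fromℤ (Ψ (adj G)) + ½ ^ order G * - fromℤ (Ψ (adj H))
      ≈⟨ distribˡ _ _ _ ⟨
    ½ ^ order G * (fromℤ (Ψ (adj G)) + - fromℤ (Ψ (adj H)))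
      ≈⟨ *-congˡ (fromℤ-- (Ψ (adj G)) (Ψ (adj H))) ⟨
    ½ ^ order G * fromℤ (Ψ (adj G) -ℤ Ψ (adj H)) ∎

  ψ-is4Invariant : Is4Invariant scalars ψ
  ψ-is4Invariant = record
    { linear   = linearExtension-linear K graphs scalars ψᴳ ψᴳ-cong
    ; fourTerm = λ G a b edge → trans (ψᴳ-difference G (removeEdge G a b) ≡.refl)
        (trans (*-congˡ (reflexive (cong fromℤ (graph-4T G a b edge))))
               (sym (ψᴳ-difference (switch G a b) (removeEdge (switch G a b) a b) ≡.refl)))
    }

  ψᴰ≈ : ∀ {n} (D : ChordDiagram n) → ψᴳ (intersectionGraph D) ≈ ½ ^ n * fromℤ (Ψ (links D))
  ψᴰ≈ D = trans (ψᴳ≈ (intersectionGraph D)) (*-congˡ (reflexive (cong fromℤ (Ψ-intersectionGraph D))))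

  private
    Poly : Set _
    Poly = Module.Carrierᴹ K[c]

  eval-cong : ∀ z {p q : Poly} → Module._≈ᴹ_ K[c] p q → eval z p ≈ eval z q
  eval-cong z = linearExtension-cong K (≡.setoid ℕ) scalars (z ^_) (^-congʳ z)

  open Polynomials using (⟦_⟧; 𝟎; _⊕_; _·_)

  eval-* : ∀ z p q → eval z (p *ᴾ q) ≈ eval z p * eval z q
  eval-* z ⟦ m ⟧ q = monomial q
    where
    monomial : ∀ q → eval z (⟦ m ⟧ *ᴾ q) ≈ z ^ m * eval z q
    monomial ⟦ n ⟧   = ^-homo-* z m n
    monomial 𝟎       = sym (zeroʳ _)
    monomial (p ⊕ q) = trans (+-cong (monomial p) (monomial q)) (sym (distribˡ _ _ _))
    monomial (r · q) = trans (*-congˡ (monomial q)) (trans (sym (*-assoc _ _ _)) (trans (*-congʳ (*-comm _ _)) (*-assoc _ _ _)))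
  eval-* z 𝟎       q = sym (zeroˡ _)
  eval-* z (p ⊕ p′) q = trans (+-cong (eval-* z p q) (eval-* z p′ q)) (sym (distribʳ _ _ _))
  eval-* z (r · p) q = trans (*-congˡ (eval-* z p q)) (sym (*-assoc _ _ _))

  eval-sum : ∀ {n} c (f : Fin n → Poly) (g : Fin n → ℤ) → (∀ i → eval 1# (f i) ≈ c * fromℤ (g i)) →
             eval 1# (Sumᴾ.sum f) ≈ c * fromℤ (∑ g)
  eval-sum {zero}  c f g eq = sym (zeroʳ c)
  eval-sum {suc n} c f g eq = trans (+-cong (eq zero) (eval-sum c (f ∘ suc) (g ∘ suc) (eq ∘ suc)))
    (trans (sym (distribˡ _ _ _)) (*-congˡ (sym (fromℤ-+ (g zero) (∑ (g ∘ suc))))))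

  eval-pairs : ∀ j c (f : Fin j → Fin j → Poly) (g : Fin j → Fin j → ℤ) → (∀ p q → eval 1# (f p q) ≈ c * fromℤ (g p q)) →
               eval 1# (∑-pairs j f) ≈ c * fromℤ (∑-pairsᶻ j g)
  eval-pairs j c f g eq = eval-sum c _ _ λ p → eval-sum c _ _ λ q → go p q (does (p F.<? q))
    where
    go : ∀ p q b → eval 1# (if b then f p q else 𝟎) ≈ c * fromℤ (if b then g p q else + 0)
    go p q false = sym (zeroʳ c)
    go p q true  = eq p q

  eval-- : ∀ p q → eval 1# (p -ᴾ q) ≈ eval 1# p + - eval 1# q
  eval-- p q = +-congˡ (-1*x≈-x (eval 1# q))

  -- With a = ½^n this divides `Ψ-recursion` by 2^(n+1): the coefficient 2 - j becomes 1 - j/2, that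
  -- is, c - j/2 at c = 1.
  halve : ∀ a z j S → (½ * a) * fromℤ ((+ 2 -ℤ + j) *ℤ z +ℤ S) ≈
          (1# + - (j ×ᴷ ½)) * (a * fromℤ z) + ½ * (a * fromℤ S)
  halve a z j S = begin
    (½ * a) * fromℤ ((+ 2 -ℤ + j) *ℤ z +ℤ S)
      ≈⟨ *-congˡ (trans (fromℤ-+ ((+ 2 -ℤ + j) *ℤ z) S) (+-congʳ (trans (reflexive (cong fromℤ (expand (+ j))))
           (trans (fromℤ-- (z +ℤ z) (+ j *ℤ z)) (+-cong (fromℤ-+ z z) (-‿cong (fromℤ-* j z))))))) ⟩
    (½ * a) * (((w + w) + - (j ×ᴷ w)) + fromℤ S)
      ≈⟨ trans (distribˡ _ _ _) (+-cong (trans (distribˡ _ _ _) (+-cong double (trans (sym (-‿distribʳ-* _ _)) (-‿cong multiple)))) (*-assoc ½ a (fromℤ S))) ⟩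
    (a * w + - ((j ×ᴷ ½) * (a * w))) + ½ * (a * fromℤ S)
      ≈⟨ +-congʳ (trans (+-cong (sym (*-identityˡ _)) (-‿distribˡ-* _ _)) (sym (distribʳ _ _ _))) ⟩
    (1# + - (j ×ᴷ ½)) * (a * w) + ½ * (a * fromℤ S) ∎
    where
    w = fromℤ z
    expand : ∀ j → (+ 2 -ℤ j) *ℤ z ≡ (z +ℤ z) -ℤ j *ℤ z
    expand j = solve 2 (λ j z → (con (+ 2) :- j) :* z := (z :+ z) :- j :* z) ≡.refl j z
      where open +-*-Solver
    double : (½ * a) * (w + w) ≈ a * w
    double = begin
      (½ * a) * (w + w)                ≈⟨ distribˡ _ _ _ ⟩
      (½ * a) * w + (½ * a) * w        ≈⟨ +-cong (*-assoc ½ a w) (*-assoc ½ a w) ⟩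
      ½ * (a * w) + ½ * (a * w)        ≈⟨ distribʳ _ _ _ ⟨
      (½ + ½) * (a * w)                ≈⟨ *-congʳ ½+½≈1 ⟩
      1# * (a * w)                     ≈⟨ *-identityˡ _ ⟩
      a * w                            ∎
    multiple : (½ * a) * (j ×ᴷ w) ≈ (j ×ᴷ ½) * (a * w)
    multiple = begin
      (½ * a) * (j ×ᴷ w)               ≈⟨ ×-comm-* j (½ * a) w ⟩
      j ×ᴷ ((½ * a) * w)               ≈⟨ ×-congʳ j (*-assoc ½ a w) ⟩
      j ×ᴷ (½ * (a * w))               ≈⟨ ×-assoc-* j ½ (a * w) ⟨
      (j ×ᴷ ½) * (a * w)               ∎

  module _ (w : Module.Carrierᴹ 𝔸 → Poly) (isSl2 : IsSl2WeightSystem w) where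
    open IsSl2WeightSystem isSl2

    -- Induction on the order: at c = 1 the recursion at the chord `zero` is `Ψ-recursion`
    -- multiplied by ½^(n+1), and the diagrams on its right side have one chord fewer.
    eval-w : ∀ {n} (D : ChordDiagram n) → eval 1# (w [ D ]ᴰ) ≈ ½ ^ n * fromℤ (Ψ (links D))
    eval-w {zero} D = trans (eval-cong 1# (empty D)) (sym (trans (*-identityˡ _) (trans (reflexive (cong fromℤ Ψ-empty)) (+-identityʳ 1#))))
      where
      opaque
        unfolding Ψ cork
        Ψ-empty : Ψ (links D) ≡ + 1
        Ψ-empty = ≡.refl
    eval-w {suc n} D = begin
      eval 1# (w [ D ]ᴰ)
        ≈⟨ eval-cong 1# (recursion D zero) ⟩
      eval 1# ((c^ 1 -ᴾ const (j ×ᴷ ½)) *ᴾ w [ H ]ᴰ) + ½ * eval 1# (∑-pairs j resolved-pair)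
        ≈⟨ +-cong (trans (eval-* 1# (c^ 1 -ᴾ const (j ×ᴷ ½)) (w [ H ]ᴰ)) (*-cong coefficient (eval-w H)))
                  (*-congˡ (eval-pairs j (½ ^ n) resolved-pair (λ p q → resolution (lookupᴸ chords p) (lookupᴸ chords q))
                     (λ p q → pair (lookupᴸ chords p) (lookupᴸ chords q)))) ⟩
      (1# + - (j ×ᴷ ½)) * (½ ^ n * fromℤ (Ψ (links H))) + ½ * (½ ^ n * fromℤ S)
        ≈⟨ halve (½ ^ n) (Ψ (links H)) j S ⟨
      (½ * ½ ^ n) * fromℤ ((+ 2 -ℤ + j) *ℤ Ψ (links H) +ℤ S)
        ≡⟨ cong (λ z → (½ * ½ ^ n) * fromℤ z) (≡.sym Ψ-recursion) ⟩
      ½ ^ suc n * fromℤ (Ψ (links D)) ∎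
      where
      open Recursion D renaming (k to j)
      S : ℤ
      S = ∑-pairsᶻ j (λ p q → resolution (lookupᴸ chords p) (lookupᴸ chords q))
      resolved-pair : Fin j → Fin j → Poly
      resolved-pair p q = w [ parallel D zero (lookupᴸ chords p) (lookupᴸ chords q) ]ᴰ -ᴾ w [ crossed D zero (lookupᴸ chords p) (lookupᴸ chords q) ]ᴰ
      coefficient : eval 1# (c^ 1 -ᴾ const (j ×ᴷ ½)) ≈ 1# + - (j ×ᴷ ½)
      coefficient = trans (eval-- (c^ 1) (const (j ×ᴷ ½))) (+-cong (*-identityˡ 1#) (-‿cong (*-identityʳ _)))
      pair : ∀ x y → eval 1# (w [ parallel D zero x y ]ᴰ -ᴾ w [ crossed D zero x y ]ᴰ) ≈ ½ ^ n * fromℤ (resolution x y)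
      pair x y = begin
        eval 1# (w [ parallel D zero x y ]ᴰ -ᴾ w [ crossed D zero x y ]ᴰ)
          ≈⟨ eval-- (w [ parallel D zero x y ]ᴰ) (w [ crossed D zero x y ]ᴰ) ⟩
        eval 1# (w [ parallel D zero x y ]ᴰ) + - eval 1# (w [ crossed D zero x y ]ᴰ)
          ≈⟨ +-cong (eval-w (parallel D zero x y)) (-‿cong (eval-w (crossed D zero x y))) ⟩
        ½ ^ n * fromℤ (Ψ (links (parallel D zero x y))) + - (½ ^ n * fromℤ (Ψ (links (crossed D zero x y))))
          ≈⟨ trans (+-congˡ (-‿distribʳ-* _ _)) (sym (distribˡ _ _ _)) ⟩
        ½ ^ n * (fromℤ (Ψ (links (parallel D zero x y))) + - fromℤ (Ψ (links (crossed D zero x y))))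
          ≈⟨ *-congˡ (fromℤ-- (Ψ (links (parallel D zero x y))) (Ψ (links (crossed D zero x y)))) ⟨
        ½ ^ n * fromℤ (resolution x y) ∎

    ψ-extends : ∀ {n} (D : ChordDiagram n) → ψᴳ (intersectionGraph D) ≈ eval 1# (w [ D ]ᴰ)
    ψ-extends D = trans (ψᴰ≈ D) (sym (eval-w D))

proposition3p5 : ∀ {k ℓ} (K : CommutativeRing k ℓ) (½ : CommutativeRing.Carrier K) →
    let open CommutativeRing K
        open WeightSystems K ½
    in (½ + ½) ≈ 1# →
       Is4Invariant scalars ψ ×
       (∀ (w : Module.Carrierᴹ 𝔸 → Module.Carrierᴹ K[c]) → IsSl2WeightSystem w →
        ∀ {n : ℕ} (D : ChordDiagram n) → ψ [ intersectionGraph D ]ᴳ ≈ eval 1# (w [ D ]ᴰ))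
proposition3p5 K ½ ½+½≈1 = ψ-is4Invariant , ψ-extends
  where open Transfer K ½ ½+½≈1
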